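{- There exist $\varepsilon > 0$ and $n_0 \in \mathbb{N}$ such that the following holds for all integers $n \ge n_0$ that are divisible by $3$. Suppose $H$ is a $3$-uniform hypergraph on $n$ vertices with no isolated vertex and $\sigma_2'(H) > \frac{2}{3}n^2 - \varepsilon n^2$. Then either $H \subseteq H^*$ (that is, $V(H)$ can be partitioned into sets $S$ and $T$ with $|S| = n/3+1$ and $|T| = 2n/3-1$ such that every edge of $H$ contains at least two vertices of $T$), or $H$ contains a perfect matching.
   Context: A $3$-uniform hypergraph $H=(V,E)$ has edges that are $3$-element subsets of $V$. The degree $\deg(v)$ of a vertex is the number of edges containing it; a vertex is isolated if its degree is $0$. Two distinct vertices $u,v$ are adjacent if some edge contains both. $\sigma_2'(H) = \min\{\deg(u)+\deg(v) : u,v \text{ adjacent in } H\}$. $H^*$ denotes the $3$-graph on $n$ vertices whose vertex set is partitioned into $S$ of size $n/3+1$ and $T$ of size $2n/3-1$, with edge set all triples containing at least two vertices of $T$. A perfect matching is a set of pairwise disjoint edges covering all vertices. -}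

module Defs where

open import Data.Nat using (ℕ; _+_; _*_; _<_; _<ᵇ_)
open import Data.Bool using (Bool; true; false; _∧_; if_then_else_)
open import Data.Fin using (Fin; toℕ)
open import Data.Fin.Subset using (Subset; _∈_; _∉_; ∣_∣)
open import Data.List using (List; []; _∷_; length; filter; concatMap; map; _++_)
open import Data.List.Base using (allFin)
open import Data.List.Relation.Unary.All using (All)
open import Data.List.Relation.Unary.Unique.Propositional using (Unique)
import Data.List.Membership.Propositional as LM
open import Data.Product using (_×_; _,_; Σ; ∃; ∃-syntax)
open import Relation.Binary.PropositionalEquality using (_≡_; _≢_)
open import Relation.Nullary using (¬_)
open import Data.Bool.Properties using (T?)
open import Data.Bool using (T)

record Hypergraph3 (n : ℕ) : Set where
  field
    E       : Fin n → Fin n → Fin n → Bool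
    sym₁₂   : ∀ a b c → E a b c ≡ E b a c
    sym₂₃   : ∀ a b c → E a b c ≡ E a c b
    distinct : ∀ a b c → E a b c ≡ true → a ≢ b × b ≢ c × a ≢ c
open Hypergraph3 public

pairs : (n : ℕ) → List (Fin n × Fin n)
pairs n = concatMap (λ a → map (λ b → (a , b)) (allFin n)) (allFin n)

-- degree of v: number of edges {v,a,b}, counted once per unordered pair {a,b}
-- (pairs (a,b) with toℕ a < toℕ b)
deg : ∀ {n} → Hypergraph3 n → Fin n → ℕ
deg {n} H v = length (filter (λ p → T? (sel p)) (pairs n))
  where
  sel : Fin n × Fin n → Bool
  sel (a , b) = (toℕ a <ᵇ toℕ b) ∧ E H v a b

Adjacent : ∀ {n} → Hypergraph3 n → Fin n → Fin n → Set
Adjacent H u v = u ≢ v × ∃[ w ] E H u v w ≡ true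

NoIsolated : ∀ {n} → Hypergraph3 n → Set
NoIsolated H = ∀ v → ¬ (deg H v ≡ 0)

AtLeastTwoIn : ∀ {n} → Subset n → Fin n → Fin n → Fin n → Set
AtLeastTwoIn T a b c = (a ∈ T × b ∈ T) Data.Sum.⊎ ((b ∈ T × c ∈ T) Data.Sum.⊎ (a ∈ T × c ∈ T))
  where import Data.Sum

-- V(H) partitioned into S (= complement of T) and T with |S| = k+1, |T| = 2k-1 where n = 3k,
-- every edge having at least two vertices in T
SubH* : ∀ {n} → Hypergraph3 n → ℕ → Set
SubH* {n} H k = ∃[ T ] (∣ T ∣ + 1 ≡ 2 * k) × (∀ a b c → E H a b c ≡ true → AtLeastTwoIn T a b c)

flatten : ∀ {n} → List (Fin n × Fin n × Fin n) → List (Fin n)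
flatten [] = []
flatten ((a , b , c) ∷ es) = a ∷ b ∷ c ∷ flatten es

PerfectMatching : ∀ {n} → Hypergraph3 n → Set
PerfectMatching {n} H =
  ∃[ M ] All (λ { (a , b , c) → E H a b c ≡ true }) M
       × Unique (flatten M)
       × (∀ v → v LM.∈ flatten M)

{-# OPTIONS --safe #-}
module Submission where

-- Write n = 3k and let W be the set of vertices of degree at least about n²/3. Two
-- adjacent vertices are not both outside W, so if |W| < 2k then H ⊆ H*. Otherwise
-- partition the vertices into k triples ("rows") with at most one vertex outside W,
-- such a vertex being adjacent to a second vertex of its row, and exchange vertices
-- between rows so as to decrease the number of fake rows, i.e. rows that are not edges.
--
-- Let t be fake and let e, f be two other rows. If t × e × f contains three disjoint
-- edges, t can be repaired. Otherwise it contains at most 18 of the 27 triples, because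
-- these split into nine matchings, and if exactly 18 then all missing triples pass
-- through one vertex, the centre. If few vertices lie in W, the degrees of t add up to
-- more than 18 per pair of rows. Otherwise a fake row meeting the complement of W can
-- be traded for a fake row inside W, and if t ⊆ W then almost all pairs (e , f) have
-- exactly 18 edges. Pairs with centres at two different vertices of t allow an exchange
-- of five rows; since the vertices of t all have degree about n²/3, almost no centre is
-- in t. If the centre of (e , f) is in f, any vertex of e can be moved into the fake
-- row, so it has the same link on almost every pair (g , h) as the vertices of t. For
-- three such rows e, g, h that determine each other's links, these links are constant,
-- which contradicts the existence of a centre.

open import Defs
open import Data.Bool using (Bool; true; false; _∧_; _∨_; not; T)
open import Data.Bool.Properties using (T-∧; T?)
import Data.Bool.Properties as Bool
open import Data.Empty using (⊥; ⊥-elim)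
open import Data.Fin using (Fin; zero; suc; combine; remQuot; toℕ)
open import Data.Fin.Patterns using (0F; 1F; 2F; 3F; 4F)
open import Data.Fin.Permutation using (Permutation′; permutation; _⟨$⟩ʳ_; _⟨$⟩ˡ_; inverseˡ; inverseʳ; id)
import Data.Fin.Properties as Fin
open import Data.Fin.Subset using (∣_∣) renaming (_∈_ to _∈ₛ_)
import Data.Fin.Subset as Subset
open import Data.List using (List; []; _∷_; length; filter; map; _++_; tabulate; concatMap)
open import Data.List.Base using (allFin)
open import Data.List.Membership.Propositional using (_∈_)
open import Data.List.Membership.Propositional.Properties using (∈-allFin)
open import Data.List.Relation.Unary.All using (All; []; _∷_)
import Data.List.Relation.Unary.All.Properties as All
open import Data.List.Relation.Unary.AllPairs using ([]; _∷_)
open import Data.List.Relation.Unary.Any using (here; there)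
open import Data.List.Relation.Unary.Unique.Propositional using (Unique)
open import Data.List.Relation.Unary.Unique.Propositional.Properties using (allFin⁺)
open import Data.Maybe using (Maybe; just; nothing)
open import Data.Nat
open import Data.Nat.DivMod using (m≡m%n+[m/n]*n; m%n<n; m/n*n≤m; m≥n⇒m/n>0)
open import Data.Nat.Properties
open import Data.Nat.Tactic.RingSolver using (solve-∀)
open import Data.Product using (∃-syntax; _×_; _,_; proj₁; proj₂)
open import Data.Product.Properties using (≡-dec)
open import Data.Sum using (_⊎_; inj₁; inj₂)
open import Data.Unit using (tt)
open import Data.Vec using (Vec; []; _∷_; here; there)
open import Function using (_∘_; Equivalence)
open import Relation.Binary.Definitions using (tri<; tri≈; tri>)
open import Relation.Binary.PropositionalEquality
open import Relation.Nullary using (¬_; Dec; yes; no; does)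
open import Relation.Nullary.Decidable using (_×-dec_; _→-dec_; map′; decidable-stable; dec-true)

-- Finite sums

-- The case distinction is made at |W| = 12k/5, a constant that only has to lie strictly between 2
-- and √6. Below √6 the square of |W| stays under 6k², so (counting ordered pairs) a link inside W
-- is too small for a vertex of W. Above 2 a positive proportion of the rows lies inside W. There
-- are two scales of error. Degrees are known up to `r`, a small multiple of k². Centres at two
-- different vertices of t are excluded only through quadruples of rows, which bounds the product of
-- two counts by about k²r. This forces a second scale `z` with k²r below z² and z still far below
-- k². An exchange that leaves t fake is useful as well: it puts another triple in the place of t,
-- and whatever was shown for t then holds for that triple. For this reason links are studied for an
-- arbitrary triple `y` against rows of the unchanged arrangement. Whether an improving exchange
-- exists is never decided. A contradiction is drawn from the absence of a perfect arrangement, and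
-- a finite search turns this into a matching.

-- Opaque: unfolding these would evaluate the ring identities they are applied to.
opaque
  contra-≤ : ∀ {x y} z → x ≤ y → x ≡ y + suc z → ⊥
  contra-≤ {x} {y} z x≤y refl = <-irrefl refl (≤-trans (s≤s (m≤m+n y z)) (≤-trans (≤-reflexive (sym (+-suc y z))) x≤y))

  -- Certificates for linear arithmetic: `l≤r` is a combination of the hypotheses with nonnegative
  -- coefficients, `c` is the slack, and the identity is left to the ring solver. `contra-≤` plays
  -- the same part for contradictory hypotheses.
  farkas : ∀ {l r} a b c → l ≤ r → a + r + c ≡ b + l → a ≤ b
  farkas {l} {r} a b c l≤r eq = +-cancelʳ-≤ r a b (≤-trans (m≤m+n (a + r) c) (≤-trans (≤-reflexive eq) (+-monoʳ-≤ b l≤r)))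

+-interchange : ∀ a b c d → (a + b) + (c + d) ≡ (a + c) + (b + d)
+-interchange = solve-∀

-- Opaque, so that the unifier infers the summand from a sum.
opaque
  sum : ∀ {n} → (Fin n → ℕ) → ℕ
  sum {zero}  f = 0
  sum {suc n} f = f zero + sum (λ i → f (suc i))

  sum-cong-≗ : ∀ {n} {f g : Fin n → ℕ} → (∀ i → f i ≡ g i) → sum f ≡ sum g
  sum-cong-≗ {zero}  h = refl
  sum-cong-≗ {suc n} h = cong₂ _+_ (h zero) (sum-cong-≗ (λ i → h (suc i)))

  sum-mono : ∀ {n} {f g : Fin n → ℕ} → (∀ i → f i ≤ g i) → sum f ≤ sum g
  sum-mono {zero}  h = z≤n
  sum-mono {suc n} h = +-mono-≤ (h zero) (sum-mono (λ i → h (suc i)))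

  sum-mono-< : ∀ {n} {f g : Fin n → ℕ} → (∀ i → f i ≤ g i) → ∀ j → f j < g j → sum f < sum g
  sum-mono-< h zero    l = +-mono-<-≤ l (sum-mono (λ i → h (suc i)))
  sum-mono-< h (suc j) l = +-mono-≤-< (h zero) (sum-mono-< (λ i → h (suc i)) j l)

  sum-const : ∀ n c → sum {n} (λ _ → c) ≡ n * c
  sum-const zero    c = refl
  sum-const (suc n) c = cong (c +_) (sum-const n c)

  sum-+ : ∀ {n} (f g : Fin n → ℕ) → sum (λ i → f i + g i) ≡ sum f + sum g
  sum-+ {zero}  f g = refl
  sum-+ {suc n} f g = trans (cong (f zero + g zero +_) (sum-+ (λ i → f (suc i)) (λ i → g (suc i)))) (+-interchange (f zero) (g zero) _ _)

  sum-* : ∀ {n} c (f : Fin n → ℕ) → sum (λ i → c * f i) ≡ c * sum f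
  sum-* {zero}  c f = sym (*-zeroʳ c)
  sum-* {suc n} c f = trans (cong (c * f zero +_) (sum-* c (λ i → f (suc i)))) (sym (*-distribˡ-+ c (f zero) _))

  sum-*ʳ : ∀ {n} c (f : Fin n → ℕ) → sum (λ i → f i * c) ≡ sum f * c
  sum-*ʳ c f = trans (sum-cong-≗ (λ i → *-comm (f i) c)) (trans (sum-* c f) (*-comm c (sum f)))

  sum-zero : ∀ {n} {f : Fin n → ℕ} → (∀ i → f i ≡ 0) → sum f ≡ 0
  sum-zero {zero}  h = refl
  sum-zero {suc n} h = cong₂ _+_ (h zero) (sum-zero (λ i → h (suc i)))

  sum-comm : ∀ {m n} (f : Fin m → Fin n → ℕ) → sum (λ i → sum (f i)) ≡ sum (λ j → sum (λ i → f i j))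
  sum-comm {zero} {n} f = sym (sum-zero {n} (λ j → refl))
  sum-comm {suc m} f = trans (cong (sum (f zero) +_) (sum-comm (λ i → f (suc i)))) (sym (sum-+ (f zero) _))

  sum-pos : ∀ {n} (f : Fin n → ℕ) → 0 < sum f → ∃[ i ] 0 < f i
  sum-pos {suc n} f h with f zero in eq
  ... | suc x = zero , subst (0 <_) (sym eq) (s≤s z≤n)
  ... | zero with sum-pos (f ∘ suc) h
  ...   | i , p = suc i , p

ind : Bool → ℕ
ind true  = 1
ind false = 0

ind≤1 : ∀ b → ind b ≤ 1
ind≤1 true  = ≤-refl
ind≤1 false = z≤n

ind-true : ∀ {b} → b ≡ true → ind b ≡ 1
ind-true refl = refl

ind-false : ∀ {b} → b ≡ false → ind b ≡ 0
ind-false refl = refl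

ind-mono : ∀ {a b} → (a ≡ true → b ≡ true) → ind a ≤ ind b
ind-mono {false}     h = z≤n
ind-mono {true}  {b} h = ≤-reflexive (sym (ind-true (h refl)))

bool-case : ∀ {ℓ} {A : Set ℓ} b → (b ≡ true → A) → (b ≡ false → A) → A
bool-case true  f g = f refl
bool-case false f g = g refl

true≢false : ∀ {b} → b ≡ true → b ≡ false → ⊥
true≢false refl ()

δ : ∀ {n} → Fin n → Fin n → ℕ
δ i j = ind (does (i Fin.≟ j))

δ-refl : ∀ {n} (i : Fin n) → δ i i ≡ 1
δ-refl i with i Fin.≟ i
... | yes _ = refl
... | no ¬p = ⊥-elim (¬p refl)

δ-≢ : ∀ {n} {i j : Fin n} → i ≢ j → δ i j ≡ 0
δ-≢ {i = i} {j} i≢j with i Fin.≟ j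
... | yes p = ⊥-elim (i≢j p)
... | no _  = refl

δ-suc : ∀ {n} (i j : Fin n) → δ (suc i) (suc j) ≡ δ i j
δ-suc i j with i Fin.≟ j
... | yes _ = refl
... | no _  = refl

opaque
  unfolding sum

  sum-δ : ∀ {n} (j : Fin n) (f : Fin n → ℕ) → sum (λ i → δ i j * f i) ≡ f j
  sum-δ {suc n} zero f = trans (cong₂ _+_ (+-identityʳ (f zero)) (sum-zero {n} (λ i → refl))) (+-identityʳ _)
  sum-δ {suc n} (suc j) f = trans (sum-cong-≗ (λ i → cong (_* f (suc i)) (δ-suc i j))) (sum-δ j (f ∘ suc))

sum-δ₁ : ∀ {n} (j : Fin n) → sum (λ i → δ i j) ≡ 1
sum-δ₁ j = trans (sum-cong-≗ (λ i → sym (*-identityʳ (δ i j)))) (sum-δ j (λ _ → 1))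

δ-sym : ∀ {n} (i j : Fin n) → δ i j ≡ δ j i
δ-sym i j with i Fin.≟ j
... | yes refl = sym (δ-refl i)
... | no ¬p    = sym (δ-≢ (¬p ∘ sym))

sum-δ₂ : ∀ {n} (j : Fin n) → sum (λ i → δ j i) ≡ 1
sum-δ₂ j = trans (sum-cong-≗ (δ-sym j)) (sum-δ₁ j)

sum₂ : ∀ {k} → (Fin k → Fin k → ℕ) → ℕ
sum₂ F = sum (λ e → sum (λ f → F e f))

sum₂-mono : ∀ {k} {F G : Fin k → Fin k → ℕ} → (∀ e f → F e f ≤ G e f) → sum₂ F ≤ sum₂ G
sum₂-mono h = sum-mono (λ e → sum-mono (h e))

sum₂-cong : ∀ {k} {F G : Fin k → Fin k → ℕ} → (∀ e f → F e f ≡ G e f) → sum₂ F ≡ sum₂ G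
sum₂-cong h = sum-cong-≗ (λ e → sum-cong-≗ (h e))

sum₂-+ : ∀ {k} (F G : Fin k → Fin k → ℕ) → sum₂ (λ e f → F e f + G e f) ≡ sum₂ F + sum₂ G
sum₂-+ F G = trans (sum-cong-≗ (λ e → sum-+ (F e) (G e))) (sum-+ _ _)

sum₂-* : ∀ {k} c (F : Fin k → Fin k → ℕ) → sum₂ (λ e f → c * F e f) ≡ c * sum₂ F
sum₂-* c F = trans (sum-cong-≗ (λ e → sum-* c (F e))) (sum-* c _)

sum₂-const : ∀ k c → sum₂ {k} (λ _ _ → c) ≡ k * k * c
sum₂-const k c = trans (sum-cong-≗ (λ _ → sum-const k c)) (trans (sum-const k (k * c)) (sym (*-assoc k k c)))

sum₂-prod : ∀ {k} (f g : Fin k → ℕ) → sum₂ (λ i j → f i * g j) ≡ sum f * sum g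
sum₂-prod f g = trans (sum-cong-≗ (λ i → sum-* (f i) g)) (sum-*ʳ (sum g) f)

sum₂-swap : ∀ {k} (F : Fin k → Fin k → ℕ) → sum₂ F ≡ sum₂ (λ i j → F j i)
sum₂-swap F = sum-comm F

-- Matchings in a 3 × 3 × 3 array

sum₃ : (Fin 3 → ℕ) → ℕ
sum₃ g = g 0F + (g 1F + g 2F)

Mat : Set
Mat = Fin 3 → Fin 3 → Bool

cnt : Mat → ℕ
cnt M = sum₃ (λ a → sum₃ (λ b → ind (M a b)))

eq : Fin 3 → Fin 3 → Bool
eq 0F 0F = true
eq 1F 1F = true
eq 2F 2F = true
eq _  _  = false

eq-sound : ∀ a b → eq a b ≡ true → a ≡ b
eq-sound 0F 0F _ = refl
eq-sound 1F 1F _ = refl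
eq-sound 2F 2F _ = refl

eq-refl : ∀ a → eq a a ≡ true
eq-refl 0F = refl
eq-refl 1F = refl
eq-refl 2F = refl

eq-≢ : ∀ {a b} → a ≢ b → eq a b ≡ false
eq-≢ {a} {b} a≢b with eq a b in p
... | true  = ⊥-elim (a≢b (eq-sound a b p))
... | false = refl

-- Exhaustive checks over Boolean 3 × 3 matrices

allV : ∀ n → (Vec Bool n → Bool) → Bool
allV zero    P = P []
allV (suc n) P = allV n (λ v → P (true ∷ v)) ∧ allV n (λ v → P (false ∷ v))

allV-sound : ∀ {n} P → T (allV n P) → ∀ v → T (P v)
allV-sound P t []          = t
allV-sound P t (true ∷ v)  = allV-sound (λ v → P (true ∷ v)) (proj₁ (Equivalence.to T-∧ t)) v
allV-sound P t (false ∷ v) = allV-sound (λ v → P (false ∷ v)) (proj₂ (Equivalence.to (T-∧ {allV _ (λ v → P (true ∷ v))}) t)) v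

mat : Vec Bool 9 → Mat
mat (a ∷ b ∷ c ∷ d ∷ e ∷ f ∷ g ∷ h ∷ i ∷ []) = λ
  { 0F 0F → a ; 0F 1F → b ; 0F 2F → c
  ; 1F 0F → d ; 1F 1F → e ; 1F 2F → f
  ; 2F 0F → g ; 2F 1F → h ; 2F 2F → i }

entries : Mat → Vec Bool 9
entries M = M 0F 0F ∷ M 0F 1F ∷ M 0F 2F ∷ M 1F 0F ∷ M 1F 1F ∷ M 1F 2F ∷ M 2F 0F ∷ M 2F 1F ∷ M 2F 2F ∷ []

-- `cnt` and `meets` inspect only the nine entries. For a `P` built from them `P (mat (entries M))`
-- therefore computes to `P M`, without extensionality.
all-mat-sound : ∀ P → T (allV 9 (P ∘ mat)) → ∀ M → T (P (mat (entries M)))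
all-mat-sound P t M = allV-sound (P ∘ mat) t (entries M)

all₃ : (Fin 3 → Bool) → Bool
all₃ f = f 0F ∧ (f 1F ∧ f 2F)

all₃-complete : ∀ f → (∀ i → f i ≡ true) → all₃ f ≡ true
all₃-complete f h rewrite h 0F | h 1F | h 2F = refl

-- The cells that share a row or a column with every cell of `A`. If `A` is what one layer of an
-- extremal cube misses, the other layers can miss only cells of `meets A`.
meets : Mat → Mat
meets A c d = all₃ λ a → all₃ λ b → not (A a b) ∨ (eq a c ∨ eq b d)

implies : Bool → Bool → Bool
implies a b = not a ∨ b

implies-sound : ∀ a b → T (implies a b) → T a → T b
implies-sound true b h _ = h

cross-check : Mat → Bool
cross-check A = implies ((1 ≤ᵇ cnt A) ∧ (1 ≤ᵇ cnt (meets A))) (cnt A + cnt (meets A) ≤ᵇ 6)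

-- By inspection of all 512 matrices. Equality occurs for a line paired with itself and for a single
-- cell paired with its row and column.
cross-≤6 : ∀ A → 1 ≤ cnt A → 1 ≤ cnt (meets A) → cnt A + cnt (meets A) ≤ 6
cross-≤6 A h h′ = ≤ᵇ⇒≤ _ _ (implies-sound _ _ (all-mat-sound cross-check tt A) (Equivalence.from T-∧ (≤⇒≤ᵇ h , ≤⇒≤ᵇ h′)))

row-line col-line : Fin 3 → Mat
row-line r a b = eq a r
col-line r a b = eq b r

eqB : Bool → Bool → Bool
eqB true  b = b
eqB false b = not b

eqB-sound : ∀ a b → T (eqB a b) → a ≡ b
eqB-sound true  true  _ = refl
eqB-sound false false _ = refl

eqM : Mat → Mat → Bool
eqM A B = all₃ λ a → all₃ λ b → eqB (A a b) (B a b)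

all₃-sound : ∀ f → T (all₃ f) → ∀ i → T (f i)
all₃-sound f t 0F = proj₁ (Equivalence.to T-∧ t)
all₃-sound f t 1F = proj₁ (Equivalence.to T-∧ (proj₂ (Equivalence.to (T-∧ {f 0F}) t)))
all₃-sound f t 2F = proj₂ (Equivalence.to (T-∧ {f 1F}) (proj₂ (Equivalence.to (T-∧ {f 0F}) t)))

eqM-sound : ∀ A B → T (eqM A B) → ∀ a b → A a b ≡ B a b
eqM-sound A B t a b = eqB-sound _ _ (all₃-sound (λ b → eqB (A a b) (B a b)) (all₃-sound (λ a → all₃ λ b → eqB (A a b) (B a b)) t a) b)

line-check : Mat → Bool
line-check A = implies ((cnt A ≡ᵇ 3) ∧ (3 ≤ᵇ cnt (meets A)))
  (is row-line 0F ∨ (is row-line 1F ∨ (is row-line 2F ∨ (is col-line 0F ∨ (is col-line 1F ∨ is col-line 2F)))))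
  where
  is : (Fin 3 → Mat) → Fin 3 → Bool
  is l r = eqM A (l r) ∧ eqM (meets A) (l r)

T-∨-elim : ∀ {ℓ} {X : Set ℓ} a b → T (a ∨ b) → (T a → X) → (T b → X) → X
T-∨-elim true  b t f g = f tt
T-∨-elim false b t f g = g t

record IsLine (A : Mat) (l : Mat) : Set where
  constructor isLine
  field
    self  : ∀ a b → A a b ≡ l a b
    other : ∀ a b → meets A a b ≡ l a b

Lines : Mat → Set
Lines A = (∃[ r ] IsLine A (row-line r)) ⊎ (∃[ r ] IsLine A (col-line r))

-- Again by inspection. This is the balanced extremal case, in which each of the three layers misses
-- three cells.
line-of : ∀ A → cnt A ≡ 3 → 3 ≤ cnt (meets A) → Lines A
line-of A p q = T-∨-elim _ _ t (row 0F) λ t → T-∨-elim _ _ t (row 1F) λ t → T-∨-elim _ _ t (row 2F) λ t →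
  T-∨-elim _ _ t (col 0F) λ t → T-∨-elim _ _ t (col 1F) (col 2F)
  where
  t = implies-sound _ _ (all-mat-sound line-check tt A) (Equivalence.from T-∧ (≡⇒≡ᵇ _ _ p , ≤⇒≤ᵇ q))
  conv : ∀ l → T (eqM A l ∧ eqM (meets A) l) → IsLine A l
  conv l t = isLine (eqM-sound A l (proj₁ (Equivalence.to T-∧ t))) (eqM-sound (meets A) l (proj₂ (Equivalence.to (T-∧ {eqM A l}) t)))
  row : ∀ r → T (eqM A (row-line r) ∧ eqM (meets A) (row-line r)) → Lines A
  row r t = inj₁ (r , conv (row-line r) t)
  col : ∀ r → T (eqM A (col-line r) ∧ eqM (meets A) (col-line r)) → Lines A
  col r t = inj₂ (r , conv (col-line r) t)

sum₃-mono : ∀ {f g} → (∀ i → f i ≤ g i) → sum₃ f ≤ sum₃ g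
sum₃-mono h = +-mono-≤ (h 0F) (+-mono-≤ (h 1F) (h 2F))

sum₃-mono-< : ∀ {f g} → (∀ i → f i ≤ g i) → ∀ j → f j < g j → sum₃ f < sum₃ g
sum₃-mono-< h 0F l = +-mono-<-≤ l (+-mono-≤ (h 1F) (h 2F))
sum₃-mono-< h 1F l = +-mono-≤-< (h 0F) (+-mono-<-≤ l (h 2F))
sum₃-mono-< h 2F l = +-mono-≤-< (h 0F) (+-mono-≤-< (h 1F) l)

sum₃-cong : ∀ {f g} → (∀ i → f i ≡ g i) → sum₃ f ≡ sum₃ g
sum₃-cong h = cong₂ _+_ (h 0F) (cong₂ _+_ (h 1F) (h 2F))

sum₃-+ : ∀ f g → sum₃ (λ i → f i + g i) ≡ sum₃ f + sum₃ g
sum₃-+ f g = lemma (f 0F) (f 1F) (f 2F) (g 0F) (g 1F) (g 2F)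
  where
  lemma : ∀ a b c x y z → (a + x) + ((b + y) + (c + z)) ≡ (a + (b + c)) + (x + (y + z))
  lemma = solve-∀

sum₃-comm : ∀ (F : Fin 3 → Fin 3 → ℕ) → sum₃ (λ i → sum₃ (F i)) ≡ sum₃ (λ j → sum₃ (λ i → F i j))
sum₃-comm F = trans (cong (sum₃ (F 0F) +_) (sym (sum₃-+ (F 1F) (F 2F)))) (sym (sum₃-+ (F 0F) (λ j → F 1F j + F 2F j)))

cnt-mono : ∀ {A B : Mat} → (∀ a b → A a b ≡ true → B a b ≡ true) → cnt A ≤ cnt B
cnt-mono h = sum₃-mono λ a → sum₃-mono λ b → ind-mono (h a b)

cnt≤9 : ∀ A → cnt A ≤ 9
cnt≤9 A = cnt-mono {A} {λ _ _ → true} (λ _ _ _ → refl)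

cnt-eq : ∀ {A B : Mat} → (∀ a b → A a b ≡ true → B a b ≡ true) → cnt A ≡ cnt B → ∀ a b → A a b ≡ B a b
cnt-eq {A} {B} h e a b with A a b in p | B a b in q
... | true  | true  = refl
... | false | false = refl
... | true  | false = sym (trans (sym q) (h a b p))
... | false | true  = ⊥-elim (<-irrefl e (sum₃-mono-< (λ a → sum₃-mono λ b → ind-mono (h a b)) a
                        (sum₃-mono-< (λ b → ind-mono (h a b)) b (subst₂ _<_ (sym (ind-false p)) (sym (ind-true q)) ≤-refl))))

cnt-not : ∀ A → cnt A + cnt (λ a b → not (A a b)) ≡ 9
cnt-not A = trans (sym (sum₃-+ (λ a → sum₃ λ b → ind (A a b)) (λ a → sum₃ λ b → ind (not (A a b)))))
  (sum₃-cong λ a → trans (sym (sum₃-+ (λ b → ind (A a b)) (λ b → ind (not (A a b))))) (sum₃-cong λ b → ind-not (A a b)))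
  where
  ind-not : ∀ b → ind b + ind (not b) ≡ 1
  ind-not true  = refl
  ind-not false = refl

-- The values on the diagonal are arbitrary: every use either assumes distinct arguments or is
-- masked by `eq`.
third : Fin 3 → Fin 3 → Fin 3
third 0F 1F = 2F
third 1F 0F = 2F
third 0F 2F = 1F
third 2F 0F = 1F
third 1F 2F = 0F
third 2F 1F = 0F
third 0F 0F = 1F
third 1F 1F = 2F
third 2F 2F = 0F

record Through (a b : Fin 3) : Set where
  field
    π    : Permutation′ 3
    at0  : π ⟨$⟩ʳ 0F ≡ a
    at1  : π ⟨$⟩ʳ 1F ≡ b
    at2  : π ⟨$⟩ʳ 2F ≡ third a b
    sums : ∀ g → sum₃ (λ s → g (π ⟨$⟩ʳ s)) ≡ sum₃ g

tri : Fin 3 → Fin 3 → Fin 3 → Fin 3 → Fin 3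
tri a b c 0F = a
tri a b c 1F = b
tri a b c 2F = c

rearrange : ∀ x y z → (x + (z + y) ≡ x + (y + z)) × (y + (x + z) ≡ x + (y + z)) × (y + (z + x) ≡ x + (y + z)) × (z + (x + y) ≡ x + (y + z)) × (z + (y + x) ≡ x + (y + z))
rearrange x y z = l₁ x y z , l₂ x y z , l₃ x y z , l₄ x y z , l₅ x y z
  where
  l₁ : ∀ x y z → x + (z + y) ≡ x + (y + z)
  l₁ = solve-∀
  l₂ : ∀ x y z → y + (x + z) ≡ x + (y + z)
  l₂ = solve-∀
  l₃ : ∀ x y z → y + (z + x) ≡ x + (y + z)
  l₃ = solve-∀
  l₄ : ∀ x y z → z + (x + y) ≡ x + (y + z)
  l₄ = solve-∀
  l₅ : ∀ x y z → z + (y + x) ≡ x + (y + z)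
  l₅ = solve-∀

through : ∀ a b → a ≢ b → Through a b
through 0F 1F _ = record { π = id ; at0 = refl ; at1 = refl ; at2 = refl ; sums = λ g → refl }
through 0F 2F _ = record { π = permutation (tri 0F 2F 1F) (tri 0F 2F 1F) (λ { 0F → refl ; 1F → refl ; 2F → refl }) (λ { 0F → refl ; 1F → refl ; 2F → refl })
  ; at0 = refl ; at1 = refl ; at2 = refl ; sums = λ g → proj₁ (rearrange (g 0F) (g 1F) (g 2F)) }
through 1F 0F _ = record { π = permutation (tri 1F 0F 2F) (tri 1F 0F 2F) (λ { 0F → refl ; 1F → refl ; 2F → refl }) (λ { 0F → refl ; 1F → refl ; 2F → refl })
  ; at0 = refl ; at1 = refl ; at2 = refl ; sums = λ g → proj₁ (proj₂ (rearrange (g 0F) (g 1F) (g 2F))) }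
through 1F 2F _ = record { π = permutation (tri 1F 2F 0F) (tri 2F 0F 1F) (λ { 0F → refl ; 1F → refl ; 2F → refl }) (λ { 0F → refl ; 1F → refl ; 2F → refl })
  ; at0 = refl ; at1 = refl ; at2 = refl ; sums = λ g → proj₁ (proj₂ (proj₂ (rearrange (g 0F) (g 1F) (g 2F)))) }
through 2F 0F _ = record { π = permutation (tri 2F 0F 1F) (tri 1F 2F 0F) (λ { 0F → refl ; 1F → refl ; 2F → refl }) (λ { 0F → refl ; 1F → refl ; 2F → refl })
  ; at0 = refl ; at1 = refl ; at2 = refl ; sums = λ g → proj₁ (proj₂ (proj₂ (proj₂ (rearrange (g 0F) (g 1F) (g 2F))))) }
through 2F 1F _ = record { π = permutation (tri 2F 1F 0F) (tri 2F 1F 0F) (λ { 0F → refl ; 1F → refl ; 2F → refl }) (λ { 0F → refl ; 1F → refl ; 2F → refl })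
  ; at0 = refl ; at1 = refl ; at2 = refl ; sums = λ g → proj₂ (proj₂ (proj₂ (proj₂ (rearrange (g 0F) (g 1F) (g 2F))))) }
through 0F 0F n = ⊥-elim (n refl)
through 1F 1F n = ⊥-elim (n refl)
through 2F 2F n = ⊥-elim (n refl)

-- Cubes without three disjoint triples

Cube : Set
Cube = Fin 3 → Mat

size : Cube → ℕ
size c = sum₃ (λ p → cnt (c p))

-- Three permutations rather than two leave the order of the triples free. This order determines the
-- row into which `swap` places each of them.
NoPM : Cube → Set
NoPM c = ∀ (ρ σ τ : Permutation′ 3) → ¬ (∀ s → c (ρ ⟨$⟩ʳ s) (σ ⟨$⟩ʳ s) (τ ⟨$⟩ʳ s) ≡ true)

next : Bool → Fin 3 → Fin 3
next true  0F = 1F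
next true  1F = 2F
next true  2F = 0F
next false 0F = 2F
next false 1F = 0F
next false 2F = 1F

next-≢ : ∀ ε a → a ≢ next ε a
next-≢ true  0F ()
next-≢ true  1F ()
next-≢ true  2F ()
next-≢ false 0F ()
next-≢ false 1F ()
next-≢ false 2F ()

next-onto : ∀ a b → a ≢ b → ∃[ ε ] next ε a ≡ b
next-onto 0F 1F _ = true , refl
next-onto 1F 2F _ = true , refl
next-onto 2F 0F _ = true , refl
next-onto 0F 2F _ = false , refl
next-onto 1F 0F _ = false , refl
next-onto 2F 1F _ = false , refl
next-onto 0F 0F n = ⊥-elim (n refl)
next-onto 1F 1F n = ⊥-elim (n refl)
next-onto 2F 2F n = ⊥-elim (n refl)

-- The rows (a , next a , next² a), a = 0, 1, 2, form a Latin square, so the nine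
-- matchings indexed by pairs (a , b) below partition the 27 cells.
spin : Bool → Fin 3 → Fin 3 → Fin 3
spin ε a 0F = a
spin ε a 1F = next ε a
spin ε a 2F = next ε (next ε a)

spin-perm : ∀ ε a → ∃[ π ] (∀ s → π ⟨$⟩ʳ s ≡ spin ε a s)
spin-perm ε a = π , λ { 0F → at0 ; 1F → at1 ; 2F → trans at2 (third-next ε a) }
  where
  open Through (through a (next ε a) (next-≢ ε a))
  third-next : ∀ ε a → third a (next ε a) ≡ next ε (next ε a)
  third-next true  0F = refl
  third-next true  1F = refl
  third-next true  2F = refl
  third-next false 0F = refl
  third-next false 1F = refl
  third-next false 2F = refl

spin-sum : ∀ ε s g → sum₃ (λ a → g (spin ε a s)) ≡ sum₃ g
spin-sum ε     0F g = refl
spin-sum true  1F g = proj₁ (proj₂ (proj₂ (rearrange (g 0F) (g 1F) (g 2F))))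
spin-sum true  2F g = proj₁ (proj₂ (proj₂ (proj₂ (rearrange (g 0F) (g 1F) (g 2F)))))
spin-sum false 1F g = proj₁ (proj₂ (proj₂ (proj₂ (rearrange (g 0F) (g 1F) (g 2F)))))
spin-sum false 2F g = proj₁ (proj₂ (proj₂ (rearrange (g 0F) (g 1F) (g 2F))))

module _ (c : Cube) (nopm : NoPM c) (ρ : Permutation′ 3) (ρ-sums : ∀ g → sum₃ (λ s → g (ρ ⟨$⟩ʳ s)) ≡ sum₃ g) (ε η : Bool) where

  private
    cell : Fin 3 → Fin 3 → Fin 3 → Bool
    cell a b s = c (ρ ⟨$⟩ʳ s) (spin ε a s) (spin η b s)

    hits : Fin 3 → Fin 3 → ℕ
    hits a b = sum₃ (λ s → ind (cell a b s))

  size-hits : size c ≡ sum₃ (λ a → sum₃ (λ b → hits a b))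
  size-hits = begin
    sum₃ (λ p → cnt (c p))                                                  ≡⟨ sym (ρ-sums (λ p → cnt (c p))) ⟩
    sum₃ (λ s → sum₃ (λ a → sum₃ (λ b → ind (c (ρ ⟨$⟩ʳ s) a b))))           ≡⟨ sum₃-cong (λ s → sym (spin-sum ε s (λ a → sum₃ (λ b → ind (c (ρ ⟨$⟩ʳ s) a b))))) ⟩
    sum₃ (λ s → sum₃ (λ a → sum₃ (λ b → ind (c (ρ ⟨$⟩ʳ s) (spin ε a s) b)))) ≡⟨ sum₃-cong (λ s → sum₃-cong (λ a → sym (spin-sum η s (λ b → ind (c (ρ ⟨$⟩ʳ s) (spin ε a s) b))))) ⟩
    sum₃ (λ s → sum₃ (λ a → sum₃ (λ b → ind (cell a b s))))                 ≡⟨ sum₃-comm (λ s a → sum₃ (λ b → ind (cell a b s))) ⟩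
    sum₃ (λ a → sum₃ (λ s → sum₃ (λ b → ind (cell a b s))))                 ≡⟨ sum₃-cong (λ a → sum₃-comm (λ s b → ind (cell a b s))) ⟩
    sum₃ (λ a → sum₃ (λ b → hits a b)) ∎
    where open ≡-Reasoning

  hits≤2 : ∀ a b → hits a b ≤ 2
  hits≤2 a b with cell a b 0F in p | cell a b 1F in q | cell a b 2F in r
  ... | false | false | false = z≤n
  ... | false | false | true  = s≤s z≤n
  ... | false | true  | false = s≤s z≤n
  ... | false | true  | true  = ≤-refl
  ... | true  | false | false = s≤s z≤n
  ... | true  | false | true  = ≤-refl
  ... | true  | true  | false = ≤-refl
  ... | true  | true  | true  = ⊥-elim (nopm ρ (proj₁ (spin-perm ε a)) (proj₁ (spin-perm η b))
      λ s → trans (cong₂ (c (ρ ⟨$⟩ʳ s)) (proj₂ (spin-perm ε a) s) (proj₂ (spin-perm η b) s)) (all s))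
    where
    all : ∀ s → cell a b s ≡ true
    all 0F = p
    all 1F = q
    all 2F = r

  size≤18′ : size c ≤ 18
  size≤18′ = ≤-trans (≤-reflexive size-hits) (sum₃-mono λ a → sum₃-mono λ b → hits≤2 a b)

  two-missing : ∀ a b → cell a b 0F ≡ false → cell a b 1F ≡ false → size c < 18
  two-missing a b p q = ≤-trans (s≤s (≤-reflexive size-hits))
    (sum₃-mono-< (λ a → sum₃-mono λ b → hits≤2 a b) a (sum₃-mono-< (hits≤2 a) b hits<2))
    where
    hits<2 : hits a b < 2
    hits<2 rewrite p | q = s≤s (ind≤1 _)

size≤18 : ∀ c → NoPM c → size c ≤ 18
size≤18 c nopm = size≤18′ c nopm id (λ g → refl) true true

-- Two cells that differ in all three coordinates lie in one of the nine matchings, for a suitable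
-- order of the layers and suitable directions `ε` and `η`. If both are missing, that matching has
-- at most one cell while the other eight have at most two each.
missing-meet : ∀ c → NoPM c → size c ≡ 18 → ∀ {p q} → p ≢ q → ∀ {a b a′ b′} → c p a b ≡ false → c q a′ b′ ≡ false → a ≢ a′ → b ≢ b′ → ⊥
missing-meet c nopm sz {p} {q} p≢q {a} {b} {a′} {b′} m m′ a≢ b≢ with next-onto a a′ a≢ | next-onto b b′ b≢
... | ε , refl | η , refl = <-irrefl sz (two-missing c nopm π sums ε η a b (trans (cong (λ x → c x a b) at0) m) (trans (cong (λ x → c x (next ε a) (next η b)) at1) m′))
  where open Through (through p q p≢q)

-- The position of the centre: in the first row for `hole`, in the second for `rows`, in the third
-- for `cols`.
data Shape (c : Cube) : Set where
  hole : ∀ p → cnt (c p) ≡ 0 → (∀ q → q ≢ p → cnt (c q) ≡ 9) → Shape c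
  rows : ∀ r → (∀ p a b → c p a b ≡ not (eq a r)) → Shape c
  cols : ∀ r → (∀ p a b → c p a b ≡ not (eq b r)) → Shape c

module _ (c : Cube) (nopm : NoPM c) (sz : size c ≡ 18) where

  private
    A : Cube
    A p a b = not (c p a b)

    n : Fin 3 → ℕ
    n p = cnt (A p)

    not-true : ∀ {b} → not b ≡ true → b ≡ false
    not-true {false} _ = refl

    total : n 0F + (n 1F + n 2F) ≡ 9
    total = +-cancelˡ-≡ (size c) _ _ (trans (trans (sym (sum₃-+ (λ p → cnt (c p)) n)) (sum₃-cong (λ p → cnt-not (c p)))) (cong (_+ 9) (sym sz)))

    cross : ∀ p q → p ≢ q → ∀ a b → A q a b ≡ true → meets (A p) a b ≡ true
    cross p q p≢q a′ b′ m′ = all₃-complete _ λ a → all₃-complete _ λ b → cell a b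
      where
      cell : ∀ a b → not (A p a b) Data.Bool.∨ (eq a a′ Data.Bool.∨ eq b b′) ≡ true
      cell a b with c p a b in m
      ... | true = refl
      ... | false with a Fin.≟ a′ | b Fin.≟ b′
      ...   | yes refl | _ rewrite eq-refl a = refl
      ...   | no _ | yes refl rewrite eq-refl b with eq a a′
      ...     | true  = refl
      ...     | false = refl
      cell a b | false | no a≢ | no b≢ = ⊥-elim (missing-meet c nopm sz p≢q m (not-true m′) a≢ b≢)

    cross-cnt : ∀ p q → p ≢ q → n q ≤ cnt (meets (A p))
    cross-cnt p q p≢q = cnt-mono {A q} {meets (A p)} (cross p q p≢q)

    pair≤6 : ∀ p q → p ≢ q → 1 ≤ n p → 1 ≤ n q → n p + n q ≤ 6
    pair≤6 p q p≢q hp hq = ≤-trans (+-monoʳ-≤ (n p) (cross-cnt p q p≢q)) (cross-≤6 (A p) hp (≤-trans hq (cross-cnt p q p≢q)))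

    full : ∀ p → n p ≡ 0 → cnt (c p) ≡ 9
    full p e = trans (sym (+-identityʳ _)) (trans (cong (cnt (c p) +_) (sym e)) (cnt-not (c p)))

    empty : ∀ p → n p ≡ 9 → cnt (c p) ≡ 0
    empty p e = +-cancelʳ-≡ 9 (cnt (c p)) 0 (trans (cong (cnt (c p) +_) (sym e)) (cnt-not (c p)))

    hole-at : ∀ p q s → p ≢ q → p ≢ s → q ≢ s → (∀ i → i ≡ p ⊎ i ≡ q ⊎ i ≡ s) → n q ≡ 0 → n s ≡ 0 → n p ≡ 9 → Shape c
    hole-at p q s pq ps qs cover eq es ep = hole p (empty p ep) λ i i≢p → go i i≢p (cover i)
      where
      go : ∀ i → i ≢ p → i ≡ p ⊎ i ≡ q ⊎ i ≡ s → cnt (c i) ≡ 9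
      go i i≢p (inj₁ e)           = ⊥-elim (i≢p e)
      go i i≢p (inj₂ (inj₁ refl)) = full q eq
      go i i≢p (inj₂ (inj₂ refl)) = full s es

    -- If one link misses nothing, the other two cannot both miss something: 9 > 6.
    two-zero : ∀ p q s → p ≢ q → p ≢ s → q ≢ s → (∀ i → i ≡ p ⊎ i ≡ q ⊎ i ≡ s) → n p ≡ 0 → n q + n s ≡ 9 → Shape c
    two-zero p q s pq ps qs cover ep t with n q in eq | n s in es
    ... | zero  | y     = hole-at s p q (ps ∘ sym) (qs ∘ sym) pq (λ i → rot (cover i)) ep eq (trans es t)
      where
      rot : ∀ {i} → i ≡ p ⊎ i ≡ q ⊎ i ≡ s → i ≡ s ⊎ i ≡ p ⊎ i ≡ q
      rot (inj₁ e)        = inj₂ (inj₁ e)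
      rot (inj₂ (inj₁ e)) = inj₂ (inj₂ e)
      rot (inj₂ (inj₂ e)) = inj₁ e
    ... | suc x | zero  = hole-at q p s (pq ∘ sym) qs ps (λ i → rot (cover i)) ep es (trans eq (trans (sym (+-identityʳ _)) t))
      where
      rot : ∀ {i} → i ≡ p ⊎ i ≡ q ⊎ i ≡ s → i ≡ q ⊎ i ≡ p ⊎ i ≡ s
      rot (inj₁ e)        = inj₂ (inj₁ e)
      rot (inj₂ (inj₁ e)) = inj₁ e
      rot (inj₂ (inj₂ e)) = inj₂ (inj₂ e)
    ... | suc x | suc y = ⊥-elim (contra-≤ 2 (subst₂ (λ u v → u + v ≤ 6) eq es (pair≤6 q s qs (subst (1 ≤_) (sym eq) (s≤s z≤n)) (subst (1 ≤_) (sym es) (s≤s z≤n)))) t)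

    -- Two layers together miss at most six cells and all three miss nine, so each misses at least
    -- three and hence exactly three.
    all-three : 1 ≤ n 0F → 1 ≤ n 1F → 1 ≤ n 2F → n 0F ≡ 3 × n 1F ≡ 3 × n 2F ≡ 3
    all-three h₀ h₁ h₂ = go (n 0F) (n 1F) (n 2F) total (pair≤6 0F 1F (λ ()) h₀ h₁) (pair≤6 0F 2F (λ ()) h₀ h₂) (pair≤6 1F 2F (λ ()) h₁ h₂)
      where
      ge3 : ∀ x y → x + y ≡ 9 → x ≤ 6 → 3 ≤ y
      ge3 x y e h = +-cancelˡ-≤ 6 3 y (≤-trans (≤-reflexive (sym e)) (+-monoˡ-≤ y h))
      sq : ∀ x y z → x + (y + z) ≡ 9 → 3 ≤ x → 3 ≤ y → 3 ≤ z → x ≤ 3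
      sq x y z e hx hy hz = +-cancelʳ-≤ 6 x 3 (≤-trans (+-monoʳ-≤ x (+-mono-≤ hy hz)) (≤-reflexive e))
      p₁ : ∀ x y z → (x + y) + z ≡ x + (y + z)
      p₁ = solve-∀
      p₂ : ∀ x y z → (x + z) + y ≡ x + (y + z)
      p₂ = solve-∀
      p₃ : ∀ x y z → (y + z) + x ≡ x + (y + z)
      p₃ = solve-∀
      p₄ : ∀ x y z → y + (x + z) ≡ x + (y + z)
      p₄ = solve-∀
      p₅ : ∀ x y z → z + (x + y) ≡ x + (y + z)
      p₅ = solve-∀
      go : ∀ x y z → x + (y + z) ≡ 9 → x + y ≤ 6 → x + z ≤ 6 → y + z ≤ 6 → x ≡ 3 × y ≡ 3 × z ≡ 3
      go x y z e a b d = ≤-antisym (sq x y z e hx hy hz) hx , ≤-antisym (sq y x z (trans (p₄ x y z) e) hy hx hz) hy , ≤-antisym (sq z x y (trans (p₅ x y z) e) hz hx hy) hz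
        where
        hz = ge3 (x + y) z (trans (p₁ x y z) e) a
        hy = ge3 (x + z) y (trans (p₂ x y z) e) b
        hx = ge3 (y + z) x (trans (p₃ x y z) e) d

    -- The only cells meeting every cell of the line `l` are those of `l`, so each further layer has
    -- its three missing cells inside `l`.
    same-line : ∀ l → cnt l ≡ 3 → IsLine (A 0F) l → n 1F ≡ 3 → n 2F ≡ 3 → ∀ p a b → A p a b ≡ l a b
    same-line l cl L e₁ e₂ 0F a b = IsLine.self L a b
    same-line l cl L e₁ e₂ 1F = cnt-eq {A 1F} {l} (λ a b m → trans (sym (IsLine.other L a b)) (cross 0F 1F (λ ()) a b m)) (trans e₁ (sym cl))
    same-line l cl L e₁ e₂ 2F = cnt-eq {A 2F} {l} (λ a b m → trans (sym (IsLine.other L a b)) (cross 0F 2F (λ ()) a b m)) (trans e₂ (sym cl))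

    cnt-row : ∀ r → cnt (row-line r) ≡ 3
    cnt-row 0F = refl
    cnt-row 1F = refl
    cnt-row 2F = refl

    cnt-col : ∀ r → cnt (col-line r) ≡ 3
    cnt-col 0F = refl
    cnt-col 1F = refl
    cnt-col 2F = refl

    not-flip : ∀ {b b′} → not b ≡ b′ → b ≡ not b′
    not-flip {true}  refl = refl
    not-flip {false} refl = refl

  shape : Shape c
  shape with n 0F in e₀ | n 1F in e₁ | n 2F in e₂
  ... | zero | _ | _ = two-zero 0F 1F 2F (λ ()) (λ ()) (λ ()) (λ { 0F → inj₁ refl ; 1F → inj₂ (inj₁ refl) ; 2F → inj₂ (inj₂ refl) }) e₀ (trans (cong (_+ (n 1F + n 2F)) (sym e₀)) total)
  ... | suc _ | zero | _ = two-zero 1F 0F 2F (λ ()) (λ ()) (λ ()) (λ { 0F → inj₂ (inj₁ refl) ; 1F → inj₁ refl ; 2F → inj₂ (inj₂ refl) }) e₁ (trans (cong (λ y → n 0F + (y + n 2F)) (sym e₁)) total)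
  ... | suc _ | suc _ | zero = two-zero 2F 0F 1F (λ ()) (λ ()) (λ ()) (λ { 0F → inj₂ (inj₁ refl) ; 1F → inj₂ (inj₂ refl) ; 2F → inj₁ refl }) e₂ (trans (cong (n 0F +_) (trans (sym (+-identityʳ (n 1F))) (cong (n 1F +_) (sym e₂)))) total)
  ... | suc _ | suc _ | suc _ = lines (line-of (A 0F) (proj₁ t) (≤-trans (≤-reflexive (sym (proj₁ (proj₂ t)))) (cross-cnt 0F 1F (λ ()))))
    where
    pos : ∀ {x y} → x ≡ suc y → 1 ≤ x
    pos refl = s≤s z≤n
    t = all-three (pos e₀) (pos e₁) (pos e₂)
    lines : Lines (A 0F) → Shape c
    lines (inj₁ (r , L)) = rows r λ p a b → not-flip (same-line (row-line r) (cnt-row r) L (proj₁ (proj₂ t)) (proj₂ (proj₂ t)) p a b)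
    lines (inj₂ (r , L)) = cols r λ p a b → not-flip (same-line (col-line r) (cnt-col r) L (proj₁ (proj₂ t)) (proj₂ (proj₂ t)) p a b)

-- The argument is the position of the only vertex of a row outside W, if any.
mark : Maybe (Fin 3) → Fin 3 → Bool
mark nothing  _ = false
mark (just i) a = eq i a

unmarked : Maybe (Fin 3) → ℕ
unmarked nothing  = 1
unmarked (just _) = 0

-- What the link of a second vertex may contain if no two disjoint cells, one from each link, leave
-- over two vertices of W. A cell with both vertices outside W is ruled out too, since no edge
-- contains two such vertices.
compatible : Maybe (Fin 3) → Maybe (Fin 3) → Mat → Mat
compatible u v M c d = not (mark u c ∧ mark v d) ∧ all₃ λ a → all₃ λ b →
  not (M a b) ∨ (eq a c ∨ (eq b d ∨ (mark u (third a c) ∨ mark v (third b d))))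

avoids : Maybe (Fin 3) → Maybe (Fin 3) → Mat → Bool
avoids u v M = all₃ λ a → all₃ λ b → not (M a b) ∨ not (mark u a ∨ mark v b)

-- The degree sum of an adjacent pair is about 12 per pair of rows, so the 3 lost on each pair of
-- rows inside W is the gain.
link-check : Maybe (Fin 3) → Maybe (Fin 3) → Mat → Bool
link-check u v M = implies (avoids u v M) (cnt M + cnt (compatible u v M) + 3 * (unmarked u * unmarked v) ≤ᵇ 12)

-- The check evaluates only for concrete marks, whence the sixteen cases.
link-checked : ∀ u v M → T (link-check u v (mat (entries M)))
link-checked nothing   nothing   = all-mat-sound (link-check nothing nothing) tt
link-checked nothing   (just 0F) = all-mat-sound (link-check nothing (just 0F)) tt
link-checked nothing   (just 1F) = all-mat-sound (link-check nothing (just 1F)) tt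
link-checked nothing   (just 2F) = all-mat-sound (link-check nothing (just 2F)) tt
link-checked (just 0F) nothing   = all-mat-sound (link-check (just 0F) nothing) tt
link-checked (just 0F) (just 0F) = all-mat-sound (link-check (just 0F) (just 0F)) tt
link-checked (just 0F) (just 1F) = all-mat-sound (link-check (just 0F) (just 1F)) tt
link-checked (just 0F) (just 2F) = all-mat-sound (link-check (just 0F) (just 2F)) tt
link-checked (just 1F) nothing   = all-mat-sound (link-check (just 1F) nothing) tt
link-checked (just 1F) (just 0F) = all-mat-sound (link-check (just 1F) (just 0F)) tt
link-checked (just 1F) (just 1F) = all-mat-sound (link-check (just 1F) (just 1F)) tt
link-checked (just 1F) (just 2F) = all-mat-sound (link-check (just 1F) (just 2F)) tt
link-checked (just 2F) nothing   = all-mat-sound (link-check (just 2F) nothing) tt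
link-checked (just 2F) (just 0F) = all-mat-sound (link-check (just 2F) (just 0F)) tt
link-checked (just 2F) (just 1F) = all-mat-sound (link-check (just 2F) (just 1F)) tt
link-checked (just 2F) (just 2F) = all-mat-sound (link-check (just 2F) (just 2F)) tt

≡⇒T : ∀ {b} → b ≡ true → T b
≡⇒T refl = tt

link-pair≤12 : ∀ u v (M M′ : Mat)
  → (∀ a b → M a b ≡ true → mark u a ≡ false × mark v b ≡ false)
  → (∀ a b → M′ a b ≡ true → mark u a ≡ true → mark v b ≡ true → ⊥)
  → (∀ a b c d → M a b ≡ true → M′ c d ≡ true → a ≢ c → b ≢ d → mark u (third a c) ≡ false → mark v (third b d) ≡ false → ⊥)
  → cnt M + cnt M′ + 3 * (unmarked u * unmarked v) ≤ 12
link-pair≤12 u v M M′ hM hM′ h = ≤-trans (+-monoˡ-≤ (3 * (unmarked u * unmarked v)) (+-monoʳ-≤ (cnt M) (cnt-mono {M′} {compatible u v M} sub)))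
    (≤ᵇ⇒≤ _ _ (checked u v M (≡⇒T avoid)))
  where
  checked : ∀ u v M → T (avoids u v M) → T (cnt M + cnt (compatible u v M) + 3 * (unmarked u * unmarked v) ≤ᵇ 12)
  checked u v M = implies-sound (avoids u v M) _ (link-checked u v M)
  avoid : avoids u v M ≡ true
  avoid = all₃-complete _ λ a → all₃-complete _ λ b → cell a b
    where
    cell : ∀ a b → not (M a b) ∨ not (mark u a ∨ mark v b) ≡ true
    cell a b with M a b in m
    ... | false = refl
    ... | true rewrite proj₁ (hM a b m) | proj₂ (hM a b m) = refl
  sub : ∀ c d → M′ c d ≡ true → compatible u v M c d ≡ true
  sub c d m′ = and (first c d m′) (all₃-complete _ λ a → all₃-complete _ λ b → cell a b)
    where
    and : ∀ {x y} → x ≡ true → y ≡ true → x ∧ y ≡ true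
    and refl refl = refl
    first : ∀ c d → M′ c d ≡ true → not (mark u c ∧ mark v d) ≡ true
    first c d m′ with mark u c in p | mark v d in q
    ... | true  | true  = ⊥-elim (hM′ c d m′ p q)
    ... | true  | false = refl
    ... | false | _     = refl
    cell : ∀ a b → not (M a b) ∨ (eq a c ∨ (eq b d ∨ (mark u (third a c) ∨ mark v (third b d)))) ≡ true
    cell a b with M a b in m | eq a c in p | eq b d in q | mark u (third a c) in r | mark v (third b d) in s
    ... | false | _ | _ | _ | _ = refl
    ... | true | true | _ | _ | _ = refl
    ... | true | false | true | _ | _ = refl
    ... | true | false | false | true | _ = refl
    ... | true | false | false | false | true = refl
    ... | true | false | false | false | false = ⊥-elim (h a b c d m m′ (neq p) (neq q) r s)
      where
      neq : ∀ {x y} → eq x y ≡ false → x ≢ y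
      neq {x} e refl = true≢false (eq-refl x) e

-- Arrangements of the vertices in rows

record Arr (k n : ℕ) : Set where
  field
    at     : Fin k → Fin 3 → Fin n
    pos    : Fin n → Fin k × Fin 3
    at-pos : ∀ v → at (proj₁ (pos v)) (proj₂ (pos v)) ≡ v
    pos-at : ∀ e i → pos (at e i) ≡ (e , i)

  at-injective : ∀ {e i f j} → at e i ≡ at f j → (e , i) ≡ (f , j)
  at-injective {e} {i} {f} {j} p = trans (sym (pos-at e i)) (trans (cong pos p) (pos-at f j))

open Arr public

sum₃≡sum : ∀ g → sum₃ g ≡ sum g
sum₃≡sum g = lemma
  where
  opaque
    unfolding sum
    lemma : sum₃ g ≡ sum g
    lemma = cong (λ z → g 0F + (g 1F + z)) (sym (+-identityʳ (g 2F)))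

sum-at : ∀ {k n} (m : Arr k n) (F : Fin n → ℕ) → sum F ≡ sum (λ e → sum₃ (λ i → F (at m e i)))
sum-at {k} {n} m F = begin
  sum F                                                        ≡⟨ sum-cong-≗ (λ v → sym (weight v)) ⟩
  sum (λ v → sum (λ e → sum (λ i → δ v (at m e i) * F v)))     ≡⟨ sum-comm (λ v e → sum (λ i → δ v (at m e i) * F v)) ⟩
  sum (λ e → sum (λ v → sum (λ i → δ v (at m e i) * F v)))     ≡⟨ sum-cong-≗ (λ e → sum-comm (λ v i → δ v (at m e i) * F v)) ⟩
  sum (λ e → sum (λ i → sum (λ v → δ v (at m e i) * F v)))     ≡⟨ sum-cong-≗ (λ e → sum-cong-≗ (λ i → sum-δ (at m e i) F)) ⟩
  sum (λ e → sum (λ i → F (at m e i)))                         ≡⟨ sum-cong-≗ (λ e → sym (sum₃≡sum (λ i → F (at m e i)))) ⟩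
  sum (λ e → sum₃ (λ i → F (at m e i)))                        ∎
  where
  open ≡-Reasoning
  δ-at : ∀ v e i → δ v (at m e i) ≡ δ e (proj₁ (pos m v)) * δ i (proj₂ (pos m v))
  δ-at v e i with e Fin.≟ proj₁ (pos m v) | i Fin.≟ proj₂ (pos m v)
  ... | yes refl | yes refl = trans (cong (δ v) (at-pos m v)) (δ-refl v)
  ... | yes _ | no ¬p = δ-≢ {i = v} λ q → ¬p (sym (cong proj₂ (trans (cong (pos m) q) (pos-at m e i))))
  ... | no ¬p | _ = δ-≢ {i = v} λ q → ¬p (sym (cong proj₁ (trans (cong (pos m) q) (pos-at m e i))))
  weight : ∀ v → sum (λ e → sum (λ i → δ v (at m e i) * F v)) ≡ F v
  weight v = begin
    sum (λ e → sum (λ i → δ v (at m e i) * F v)) ≡⟨ sum-cong-≗ (λ e → sum-*ʳ (F v) (λ i → δ v (at m e i))) ⟩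
    sum (λ e → sum (λ i → δ v (at m e i)) * F v) ≡⟨ sum-*ʳ (F v) (λ e → sum (λ i → δ v (at m e i))) ⟩
    sum (λ e → sum (λ i → δ v (at m e i))) * F v ≡⟨ cong (_* F v) (sum-cong-≗ (λ e → trans (sum-cong-≗ (λ i → δ-at v e i)) (trans (sum-* (δ e _) (λ i → δ i (proj₂ (pos m v)))) (trans (cong (δ e (proj₁ (pos m v)) *_) (sum-δ₁ (proj₂ (pos m v)))) (*-identityʳ _))))) ⟩
    sum (λ e → δ e (proj₁ (pos m v))) * F v ≡⟨ cong (_* F v) (sum-δ₁ (proj₁ (pos m v))) ⟩
    1 * F v ≡⟨ *-identityˡ (F v) ⟩
    F v ∎

-- A permutation of the positions in `r` rows. `fwd` leads from a new position to the old one that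
-- supplies its vertex; in `Move` the permutations `σ` first reorder the old rows.
record Shuffle (r : ℕ) : Set where
  field
    fwd bwd : Fin r × Fin 3 → Fin r × Fin 3
    bwd-fwd : ∀ x → bwd (fwd x) ≡ x
    fwd-bwd : ∀ x → fwd (bwd x) ≡ x

module Move {k n r : ℕ} (m : Arr k n) (ρ : Fin r → Fin k) (ρ-inj : ∀ {s t} → ρ s ≡ ρ t → s ≡ t) (P : Shuffle r) (σ : Fin r → Permutation′ 3) where

  open Shuffle P

  private
    found? : ∀ e → Dec (∃[ s ] ρ s ≡ e)
    found? e = Fin.any? (λ s → ρ s Fin.≟ e)

    src : Fin r × Fin 3 → Fin k × Fin 3
    src (s , j) = ρ s , σ s ⟨$⟩ʳ j

    φ : Fin k × Fin 3 → Fin k × Fin 3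
    φ (e , i) with found? e
    ... | yes (s , _) = src (fwd (s , i))
    ... | no _        = e , i

    ψ : Fin k × Fin 3 → Fin k × Fin 3
    ψ (e , i) with found? e
    ... | yes (s , _) = ρ (proj₁ (bwd (s , σ s ⟨$⟩ˡ i))) , proj₂ (bwd (s , σ s ⟨$⟩ˡ i))
    ... | no _        = e , i

    φ-row : ∀ s i → φ (ρ s , i) ≡ src (fwd (s , i))
    φ-row s i with found? (ρ s)
    ... | yes (s′ , p) rewrite ρ-inj p = refl
    ... | no ¬p = ⊥-elim (¬p (s , refl))

    ψ-row : ∀ s i → ψ (ρ s , i) ≡ (ρ (proj₁ (bwd (s , σ s ⟨$⟩ˡ i))) , proj₂ (bwd (s , σ s ⟨$⟩ˡ i)))
    ψ-row s i with found? (ρ s)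
    ... | yes (s′ , p) rewrite ρ-inj p = refl
    ... | no ¬p = ⊥-elim (¬p (s , refl))

    φ-out : ∀ e i → (∀ s → ρ s ≢ e) → φ (e , i) ≡ (e , i)
    φ-out e i h with found? e
    ... | yes (s , p) = ⊥-elim (h s p)
    ... | no _        = refl

    ψ-out : ∀ e i → (∀ s → ρ s ≢ e) → ψ (e , i) ≡ (e , i)
    ψ-out e i h with found? e
    ... | yes (s , p) = ⊥-elim (h s p)
    ... | no _        = refl

    ψ-src : ∀ x → ψ (src x) ≡ (ρ (proj₁ (bwd x)) , proj₂ (bwd x))
    ψ-src (s , j) = trans (ψ-row s (σ s ⟨$⟩ʳ j)) (cong (λ y → ρ (proj₁ (bwd (s , y))) , proj₂ (bwd (s , y))) (inverseˡ (σ s)))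

    ψφ : ∀ e i → ψ (φ (e , i)) ≡ (e , i)
    ψφ e i with found? e
    ... | yes (s , refl) = trans (ψ-src (fwd (s , i))) (cong (λ y → ρ (proj₁ y) , proj₂ y) (bwd-fwd (s , i)))
    ... | no ¬p = ψ-out e i (λ s q → ¬p (s , q))

    φψ : ∀ e i → φ (ψ (e , i)) ≡ (e , i)
    φψ e i with found? e
    ... | yes (s , refl) = trans (φ-row _ _) (trans (cong src (fwd-bwd (s , σ s ⟨$⟩ˡ i))) (cong (ρ s ,_) (inverseʳ (σ s))))
    ... | no ¬p = φ-out e i (λ s q → ¬p (s , q))

    get : Fin k × Fin 3 → Fin n
    get (e , i) = at m e i

  move : Arr k n
  move = record
    { at     = λ e i → get (φ (e , i))
    ; pos    = λ v → ψ (pos m v)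
    ; at-pos = λ v → trans (cong get (φψ _ _)) (at-pos m v)
    ; pos-at = λ e i → trans (cong ψ (pos-at m _ _)) (ψφ e i)
    }

  move-row : ∀ s i → at move (ρ s) i ≡ at m (ρ (proj₁ (fwd (s , i)))) (σ (proj₁ (fwd (s , i))) ⟨$⟩ʳ proj₂ (fwd (s , i)))
  move-row s i = cong get (φ-row s i)

  move-out : ∀ e → (∀ s → ρ s ≢ e) → ∀ i → at move e i ≡ at m e i
  move-out e h i = cong get (φ-out e i h)

-- Transposition: the new row s collects the s-th vertices of the three old rows, so three disjoint
-- transversal triples become rows.
transversal : Shuffle 3
transversal = record { fwd = λ (s , i) → i , s ; bwd = λ (s , i) → i , s ; bwd-fwd = λ _ → refl ; fwd-bwd = λ _ → refl }

-- Rows 0 … 4 stand for t, e, f, g, h and become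
-- (t e g), (t e f), (t g h), (h e f), (f g h).
pentagon : Shuffle 5
pentagon = record { fwd = λ (s , i) → f s i ; bwd = λ (s , i) → b s i ; bwd-fwd = λ (s , i) → bf s i ; fwd-bwd = λ (s , i) → fb s i }
  where
  f : Fin 5 → Fin 3 → Fin 5 × Fin 3
  f 0F 0F = 0F , 0F
  f 0F 1F = 1F , 0F
  f 0F 2F = 3F , 0F
  f 1F 0F = 0F , 1F
  f 1F 1F = 1F , 1F
  f 1F 2F = 2F , 1F
  f 2F 0F = 0F , 2F
  f 2F 1F = 3F , 1F
  f 2F 2F = 4F , 1F
  f 3F 0F = 4F , 0F
  f 3F 1F = 1F , 2F
  f 3F 2F = 2F , 2F
  f 4F 0F = 2F , 0F
  f 4F 1F = 3F , 2F
  f 4F 2F = 4F , 2F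
  b : Fin 5 → Fin 3 → Fin 5 × Fin 3
  b 0F 0F = 0F , 0F
  b 1F 0F = 0F , 1F
  b 3F 0F = 0F , 2F
  b 0F 1F = 1F , 0F
  b 1F 1F = 1F , 1F
  b 2F 1F = 1F , 2F
  b 0F 2F = 2F , 0F
  b 3F 1F = 2F , 1F
  b 4F 1F = 2F , 2F
  b 4F 0F = 3F , 0F
  b 1F 2F = 3F , 1F
  b 2F 2F = 3F , 2F
  b 2F 0F = 4F , 0F
  b 3F 2F = 4F , 1F
  b 4F 2F = 4F , 2F
  bf : ∀ s i → b (proj₁ (f s i)) (proj₂ (f s i)) ≡ (s , i)
  bf = λ { 0F 0F → refl ; 0F 1F → refl ; 0F 2F → refl ; 1F 0F → refl ; 1F 1F → refl ; 1F 2F → refl ; 2F 0F → refl ; 2F 1F → refl ; 2F 2F → refl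
         ; 3F 0F → refl ; 3F 1F → refl ; 3F 2F → refl ; 4F 0F → refl ; 4F 1F → refl ; 4F 2F → refl }
  fb : ∀ s i → f (proj₁ (b s i)) (proj₂ (b s i)) ≡ (s , i)
  fb = λ { 0F 0F → refl ; 0F 1F → refl ; 0F 2F → refl ; 1F 0F → refl ; 1F 1F → refl ; 1F 2F → refl ; 2F 0F → refl ; 2F 1F → refl ; 2F 2F → refl
         ; 3F 0F → refl ; 3F 1F → refl ; 3F 2F → refl ; 4F 0F → refl ; 4F 1F → refl ; 4F 2F → refl }

exchange : ∀ {k n} (m : Arr k n) (p q : Fin k × Fin 3) → ∃[ m′ ]
  (at {k} {n} m′ (proj₁ p) (proj₂ p) ≡ at m (proj₁ q) (proj₂ q)) × (at m′ (proj₁ q) (proj₂ q) ≡ at m (proj₁ p) (proj₂ p))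
  × (∀ e i → (e , i) ≢ p → (e , i) ≢ q → at m′ e i ≡ at m e i)
exchange {k} {n} m p q = m′ , cong get (τ-p p refl) , cong get (τ-q q refl) , λ e i h h′ → cong get (τ-out (e , i) h h′)
  where
  _≟ₚ_ = ≡-dec (Fin._≟_ {k}) (Fin._≟_ {3})
  get : Fin k × Fin 3 → Fin n
  get (e , i) = at m e i
  τ : Fin k × Fin 3 → Fin k × Fin 3
  τ x with x ≟ₚ p | x ≟ₚ q
  ... | yes _ | _     = q
  ... | no _  | yes _ = p
  ... | no _  | no _  = x
  τ-p : ∀ x → x ≡ p → τ x ≡ q
  τ-p x e with x ≟ₚ p | x ≟ₚ q
  ... | yes _ | _ = refl
  ... | no ¬e | _ = ⊥-elim (¬e e)
  τ-q : ∀ x → x ≡ q → τ x ≡ p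
  τ-q x e with x ≟ₚ p | x ≟ₚ q
  ... | yes e′ | _     = trans (sym e) e′
  ... | no _   | yes _ = refl
  ... | no _   | no ¬e = ⊥-elim (¬e e)
  τ-out : ∀ x → x ≢ p → x ≢ q → τ x ≡ x
  τ-out x h h′ with x ≟ₚ p | x ≟ₚ q
  ... | yes e | _     = ⊥-elim (h e)
  ... | no _  | yes e = ⊥-elim (h′ e)
  ... | no _  | no _  = refl
  ττ : ∀ x → τ (τ x) ≡ x
  ττ x with x ≟ₚ p | x ≟ₚ q
  ... | yes e | _     = trans (τ-q q refl) (sym e)
  ... | no _  | yes e = trans (τ-p p refl) (sym e)
  ... | no h  | no h′ = τ-out x h h′
  m′ : Arr k n
  m′ = record { at = λ e i → get (τ (e , i)) ; pos = λ v → τ (pos m v)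
              ; at-pos = λ v → trans (cong get (ττ (pos m v))) (at-pos m v)
              ; pos-at = λ e i → trans (cong τ (pos-at m _ _)) (ττ (e , i)) }

NoPM-cong : ∀ {c d : Cube} → (∀ p a b → d p a b ≡ c p a b) → NoPM c → NoPM d
NoPM-cong h nopm ρ σ τ all = nopm ρ σ τ (λ s → trans (sym (h _ _ _)) (all s))

triple : ∀ {A : Set} → A → A → A → Fin 3 → A
triple a b c 0F = a
triple a b c 1F = b
triple a b c 2F = c

-- Degrees as sums over pairs of rows

sum₃-sum : ∀ {k} (F : Fin 3 → Fin k → ℕ) → sum₃ (λ i → sum (F i)) ≡ sum (λ f → sum₃ (λ i → F i f))
sum₃-sum F = trans (cong (sum (F 0F) +_) (sym (sum-+ (F 1F) (F 2F)))) (sym (sum-+ (F 0F) (λ f → F 1F f + F 2F f)))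

-- Counting ordered pairs doubles the degree and makes it a plain sum over all ordered pairs of
-- rows. On this scale a vertex of W has about 6k² or more, an adjacent pair about 12k² or more.
deg₂ : ∀ {n} → Hypergraph3 n → Fin n → ℕ
deg₂ H v = sum₂ (λ a b → ind (E H v a b))

deg₂-rows : ∀ {k n} (H : Hypergraph3 n) (m : Arr k n) v → deg₂ H v ≡ sum₂ (λ e f → cnt (λ a b → E H v (at m e a) (at m f b)))
deg₂-rows H m v = begin
  sum (λ a → sum (λ b → ind (E H v a b)))                                                       ≡⟨ sum-at m (λ a → sum (λ b → ind (E H v a b))) ⟩
  sum (λ e → sum₃ (λ i → sum (λ b → ind (E H v (at m e i) b))))                                 ≡⟨ sum-cong-≗ (λ e → sum₃-cong (λ i → sum-at m (λ b → ind (E H v (at m e i) b)))) ⟩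
  sum (λ e → sum₃ (λ i → sum (λ f → sum₃ (λ j → ind (E H v (at m e i) (at m f j))))))           ≡⟨ sum-cong-≗ (λ e → sum₃-sum (λ i f → sum₃ (λ j → ind (E H v (at m e i) (at m f j))))) ⟩
  sum₂ (λ e f → cnt (λ a b → E H v (at m e a) (at m f b)))                                     ∎
  where open ≡-Reasoning

-- The common form of the counts over pairs of rows: `F` is at most `c` on ordinary pairs, and
-- exceptional pairs, recorded by `G`, are few.
sum₂-bound : ∀ {k} (F G : Fin k → Fin k → ℕ) c b → (∀ e f → F e f ≤ c + G e f * b) → ∀ g → sum₂ G ≤ g → sum₂ F ≤ k * k * c + g * b
sum₂-bound {k} F G c b h g hg = begin
  sum₂ F                                ≤⟨ sum₂-mono h ⟩
  sum₂ (λ e f → c + G e f * b)          ≡⟨ sum₂-+ (λ _ _ → c) (λ e f → G e f * b) ⟩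
  sum₂ {k} (λ _ _ → c) + sum₂ (λ e f → G e f * b) ≡⟨ cong₂ _+_ (sum₂-const k c) (trans (sum₂-cong (λ e f → *-comm (G e f) b)) (trans (sum₂-* b G) (*-comm b _))) ⟩
  k * k * c + sum₂ G * b                ≤⟨ +-monoʳ-≤ (k * k * c) (*-monoˡ-≤ b hg) ⟩
  k * k * c + g * b ∎
  where open ≤-Reasoning

-- Vanishes on the pairs of distinct rows that avoid the rows s₁, s₂, s₃.
clash : ∀ {k} → Fin k → Fin k → Fin k → Fin k → Fin k → ℕ
clash s₁ s₂ s₃ g h = δ g h + ((δ g s₁ + (δ g s₂ + δ g s₃)) + (δ h s₁ + (δ h s₂ + δ h s₃)))

sum₂-δˡ : ∀ {k} (s : Fin k) → sum₂ {k} (λ g h → δ g s) ≡ k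
sum₂-δˡ {k} s = trans (sum-cong-≗ (λ g → sum-const k (δ g s))) (trans (sum-* k (λ g → δ g s)) (trans (cong (k *_) (sum-δ₁ s)) (*-identityʳ k)))

sum₂-δʳ : ∀ {k} (s : Fin k) → sum₂ {k} (λ g h → δ h s) ≡ k
sum₂-δʳ s = trans (sum₂-swap (λ g h → δ h s)) (sum₂-δˡ s)

sum₂-δ : ∀ {k} → sum₂ {k} δ ≡ k
sum₂-δ {k} = trans (sum-cong-≗ sum-δ₂) (trans (sum-const k 1) (*-identityʳ k))

sum₂-clash : ∀ {k} (s₁ s₂ s₃ : Fin k) → sum₂ (clash s₁ s₂ s₃) ≡ k * 7
sum₂-clash {k} s₁ s₂ s₃ = begin
  sum₂ (clash s₁ s₂ s₃) ≡⟨ sum₂-+ δ _ ⟩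
  _ ≡⟨ cong₂ _+_ sum₂-δ (sum₂-+ (λ g h → δ g s₁ + (δ g s₂ + δ g s₃)) _) ⟩
  _ ≡⟨ cong (k +_) (cong₂ _+_ (trans (sum₂-+ (λ g h → δ g s₁) _) (cong₂ _+_ (sum₂-δˡ s₁) (trans (sum₂-+ (λ g h → δ g s₂) _) (cong₂ _+_ (sum₂-δˡ s₂) (sum₂-δˡ s₃)))))
                            (trans (sum₂-+ (λ g h → δ h s₁) _) (cong₂ _+_ (sum₂-δʳ s₁) (trans (sum₂-+ (λ g h → δ h s₂) _) (cong₂ _+_ (sum₂-δʳ s₂) (sum₂-δʳ s₃)))))) ⟩
  k + ((k + (k + k)) + (k + (k + k))) ≡⟨ seven k ⟩
  k * 7 ∎
  where
  open ≡-Reasoning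
  seven : ∀ k → k + ((k + (k + k)) + (k + (k + k))) ≡ k * 7
  seven = solve-∀

record Apart {k} (s₁ s₂ s₃ g h : Fin k) : Set where
  constructor apart
  field
    gh : g ≢ h
    g₁ : g ≢ s₁
    g₂ : g ≢ s₂
    g₃ : g ≢ s₃
    h₁ : h ≢ s₁
    h₂ : h ≢ s₂
    h₃ : h ≢ s₃

clash-or-apart : ∀ {k} (s₁ s₂ s₃ g h : Fin k) → 1 ≤ clash s₁ s₂ s₃ g h ⊎ Apart s₁ s₂ s₃ g h
clash-or-apart s₁ s₂ s₃ g h with g Fin.≟ h | g Fin.≟ s₁ | g Fin.≟ s₂ | g Fin.≟ s₃ | h Fin.≟ s₁ | h Fin.≟ s₂ | h Fin.≟ s₃
... | yes _ | _ | _ | _ | _ | _ | _ = inj₁ (s≤s z≤n)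
... | no _ | yes _ | _ | _ | _ | _ | _ = inj₁ (s≤s z≤n)
... | no _ | no _ | yes _ | _ | _ | _ | _ = inj₁ (s≤s z≤n)
... | no _ | no _ | no _ | yes _ | _ | _ | _ = inj₁ (s≤s z≤n)
... | no _ | no _ | no _ | no _ | yes _ | _ | _ = inj₁ (s≤s z≤n)
... | no _ | no _ | no _ | no _ | no _ | yes _ | _ = inj₁ (s≤s z≤n)
... | no _ | no _ | no _ | no _ | no _ | no _ | yes _ = inj₁ (s≤s z≤n)
... | no a | no b | no c | no d | no e | no f | no i = inj₂ (apart a b c d e f i)

-- Exchanges that repair a fake row

module Rearrange {k n : ℕ} (H : Hypergraph3 n) where

  Real : Arr k n → Fin k → Set
  Real m e = E H (at m e 0F) (at m e 1F) (at m e 2F) ≡ true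

  Same : Arr k n → Arr k n → Fin k → Set
  Same m m′ e = ∀ i → at m′ e i ≡ at m e i

  Real-same : ∀ {m m′ e} → Same m m′ e → Real m e → Real m′ e
  Real-same {m} {m′} {e} s r rewrite s 0F | s 1F | s 2F = r

  -- No row other than `t` turns fake. Nothing is required of `t`, so an exchange that merely puts
  -- another triple there can be continued by `Step-trans`.
  Step : Arr k n → Fin k → Arr k n → Set
  Step m t m′ = ∀ e → e ≢ t → Real m′ e ⊎ Same m m′ e

  Better : Arr k n → Fin k → Set
  Better m t = ∃[ m′ ] Step m t m′ × Real m′ t

  Step-trans : ∀ {m m₁ m₂ t} → Step m t m₁ → Step m₁ t m₂ → Step m t m₂
  Step-trans {m} {m₁} {m₂} p q e e≢t with q e e≢t
  ... | inj₁ r = inj₁ r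
  ... | inj₂ s with p e e≢t
  ...   | inj₁ r  = inj₁ (Real-same {m₁} {m₂} s r)
  ...   | inj₂ s′ = inj₂ (λ i → trans (s i) (s′ i))

  -- `y` need not be a row of `m`: it stands for the content of the fake row after an exchange that
  -- does not touch `e` and `f`.
  cube : Arr k n → (Fin 3 → Fin n) → Fin k → Fin k → Cube
  cube m y e f p a b = E H (y p) (at m e a) (at m f b)

  module _ (m : Arr k n) {t e f : Fin k} (t≢e : t ≢ e) (t≢f : t ≢ f) (e≢f : e ≢ f) (ρ σ τ : Permutation′ 3) where

    private
      row : Fin 3 → Fin k
      row = triple t e f
      row-inj : ∀ {i j} → row i ≡ row j → i ≡ j
      row-inj {0F} {0F} p = refl
      row-inj {0F} {1F} p = ⊥-elim (t≢e p)
      row-inj {0F} {2F} p = ⊥-elim (t≢f p)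
      row-inj {1F} {0F} p = ⊥-elim (t≢e (sym p))
      row-inj {1F} {1F} p = refl
      row-inj {1F} {2F} p = ⊥-elim (e≢f p)
      row-inj {2F} {0F} p = ⊥-elim (t≢f (sym p))
      row-inj {2F} {1F} p = ⊥-elim (e≢f (sym p))
      row-inj {2F} {2F} p = refl
      open Move m row row-inj transversal (triple ρ σ τ)

    swap : Arr k n
    swap = move

    cell : Fin 3 → Fin 3 → Fin n
    cell s = triple (at m t (ρ ⟨$⟩ʳ s)) (at m e (σ ⟨$⟩ʳ s)) (at m f (τ ⟨$⟩ʳ s))

    swap-row : ∀ s i → at swap (row s) i ≡ cell s i
    swap-row s 0F = move-row s 0F
    swap-row s 1F = move-row s 1F
    swap-row s 2F = move-row s 2F

    swap-out : ∀ g → g ≢ t → g ≢ e → g ≢ f → Same m swap g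
    swap-out g g≢t g≢e g≢f = move-out g λ { 0F → g≢t ∘ sym ; 1F → g≢e ∘ sym ; 2F → g≢f ∘ sym }

    hit : Fin 3 → Set
    hit s = E H (at m t (ρ ⟨$⟩ʳ s)) (at m e (σ ⟨$⟩ʳ s)) (at m f (τ ⟨$⟩ʳ s)) ≡ true

    swap-real : ∀ s → hit s → Real swap (row s)
    swap-real s h rewrite swap-row s 0F | swap-row s 1F | swap-row s 2F = h

    swap-step : hit 1F → hit 2F → Step m t swap
    swap-step h₁ h₂ g g≢t with g Fin.≟ e | g Fin.≟ f
    ... | yes refl | _        = inj₁ (swap-real 1F h₁)
    ... | no _     | yes refl = inj₁ (swap-real 2F h₂)
    ... | no g≢e   | no g≢f   = inj₂ (swap-out g g≢t g≢e g≢f)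

  no-pm : ∀ {m t} → ¬ Better m t → ∀ {e f} → Apart t t t e f → NoPM (cube m (at m t) e f)
  no-pm {m} {t} ¬b (apart ef et _ _ ft _ _) ρ σ τ all = ¬b (swap m t≢e t≢f ef ρ σ τ , swap-step m t≢e t≢f ef ρ σ τ (all 1F) (all 2F) , swap-real m t≢e t≢f ef ρ σ τ 0F (all 0F))
    where
    t≢e = et ∘ sym
    t≢f = ft ∘ sym

  Tight : Arr k n → (Fin 3 → Fin n) → Fin k → Fin k → Fin k → Set
  Tight m y s₁ s₂ s₃ = ∀ {g h} → Apart s₁ s₂ s₃ g h → NoPM (cube m y g h)

  tight : ∀ {m t} → ¬ Better m t → Tight m (at m t) t t t
  tight {m} {t} ¬b = no-pm {m} {t} ¬b

  tight-swap : ∀ {m t e f} → ¬ Better m t → (t≢e : t ≢ e) (t≢f : t ≢ f) (e≢f : e ≢ f) (ρ σ τ : Permutation′ 3)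
    → hit m t≢e t≢f e≢f ρ σ τ 1F → hit m t≢e t≢f e≢f ρ σ τ 2F → Tight m (cell m t≢e t≢f e≢f ρ σ τ 0F) t e f
  tight-swap {m} {t} {e} {f} ¬b t≢e t≢f e≢f ρ σ τ h₁ h₂ {g} {h} (apart gh g₁ g₂ g₃ h₁′ h₂′ h₃′) =
    NoPM-cong {cube m₁ (at m₁ t) g h} same (no-pm {m₁} {t} ¬b₁ (apart gh g₁ g₁ g₁ h₁′ h₁′ h₁′))
    where
    m₁ = swap m t≢e t≢f e≢f ρ σ τ
    step = swap-step m t≢e t≢f e≢f ρ σ τ h₁ h₂
    ¬b₁ : ¬ Better m₁ t
    ¬b₁ (m₂ , s , r) = ¬b (m₂ , Step-trans {m} {m₁} {m₂} step s , r)
    same : ∀ p a b → cube m (cell m t≢e t≢f e≢f ρ σ τ 0F) g h p a b ≡ cube m₁ (at m₁ t) g h p a b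
    same p a b rewrite swap-row m t≢e t≢f e≢f ρ σ τ 0F p | swap-out m t≢e t≢f e≢f ρ σ τ g g₁ g₂ g₃ a | swap-out m t≢e t≢f e≢f ρ σ τ h h₁′ h₂′ h₃′ b = refl

  bad : Arr k n → (Fin 3 → Fin n) → Fin k → Fin k → ℕ
  bad m y g h = ind (not (size (cube m y g h) ≡ᵇ 18))

  bad≤1 : ∀ m y g h → bad m y g h ≤ 1
  bad≤1 m y g h = ind≤1 _

  exact : ∀ m y g h → bad m y g h ≡ 0 → size (cube m y g h) ≡ 18
  exact m y g h p with size (cube m y g h) ≡ᵇ 18 in q
  ... | true = ≡ᵇ⇒≡ _ _ (subst T (sym q) _)

  size≤27 : ∀ c → size c ≤ 27
  size≤27 c = sum₃-mono {λ p → cnt (c p)} {λ _ → 9} (λ p → cnt≤9 (c p))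

  size-bad≤18 : ∀ m y g h → NoPM (cube m y g h) → size (cube m y g h) + bad m y g h ≤ 18
  size-bad≤18 m y g h nopm with size (cube m y g h) ≡ᵇ 18 in q
  ... | true  = ≤-trans (≤-reflexive (+-identityʳ _)) (size≤18 (cube m y g h) nopm)
  ... | false = ≤-trans (≤-reflexive (+-comm _ 1)) (≤∧≢⇒< (size≤18 (cube m y g h) nopm) λ p → subst T q (≡⇒≡ᵇ _ 18 p))

  degree-sum : Arr k n → (Fin 3 → Fin n) → ℕ
  degree-sum m y = sum₃ (λ p → deg₂ H (y p))

  degree-sum-rows : ∀ m y → degree-sum m y ≡ sum₂ (λ g h → size (cube m y g h))
  degree-sum-rows m y = trans (sum₃-cong (λ p → deg₂-rows H m (y p)))
    (trans (sum₃-sum (λ p e → sum (λ f → cnt (cube m y e f p)))) (sum-cong-≗ (λ e → sum₃-sum (λ p f → cnt (cube m y e f p)))))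

  -- An ordinary pair contributes at most 18, and at most 17 if it is bad. On a clashing pair the
  -- trivial bound is 27 + 1 = 18 + 10, and the clashes have total weight 7k.
  degree-sum-bad : ∀ m y {s₁ s₂ s₃} → Tight m y s₁ s₂ s₃ → degree-sum m y + sum₂ (bad m y) ≤ k * k * 18 + k * 7 * 10
  degree-sum-bad m y {s₁} {s₂} {s₃} ti = ≤-trans (≤-reflexive (trans (cong (_+ sum₂ (bad m y)) (degree-sum-rows m y)) (sym (sum₂-+ _ (bad m y)))))
    (sum₂-bound _ (clash s₁ s₂ s₃) 18 10 pointwise (k * 7) (≤-reflexive (sum₂-clash s₁ s₂ s₃)))
    where
    pointwise : ∀ g h → size (cube m y g h) + bad m y g h ≤ 18 + clash s₁ s₂ s₃ g h * 10
    pointwise g h with clash-or-apart s₁ s₂ s₃ g h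
    ... | inj₂ ap = ≤-trans (size-bad≤18 m y g h (ti ap)) (m≤m+n 18 _)
    ... | inj₁ c  = ≤-trans (+-mono-≤ (size≤27 (cube m y g h)) (bad≤1 m y g h)) (+-monoʳ-≤ 18 (*-monoˡ-≤ 10 c))

-- The two kinds of vertices

third-≢ : ∀ a c → a ≢ c → third a c ≢ a
third-≢ 0F 0F n _ = n refl
third-≢ 1F 1F n _ = n refl
third-≢ 2F 2F n _ = n refl
third-≢ 0F 1F _ ()
third-≢ 0F 2F _ ()
third-≢ 1F 0F _ ()
third-≢ 1F 2F _ ()
third-≢ 2F 0F _ ()
third-≢ 2F 1F _ ()

third-third : ∀ a c → a ≢ c → third (third a c) a ≡ c
third-third 0F 0F n = ⊥-elim (n refl)
third-third 1F 1F n = ⊥-elim (n refl)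
third-third 2F 2F n = ⊥-elim (n refl)
third-third 0F 1F n = refl
third-third 0F 2F n = refl
third-third 1F 0F n = refl
third-third 1F 2F n = refl
third-third 2F 0F n = refl
third-third 2F 1F n = refl

pick : ∀ a c → a ≢ c → ∃[ π ] (π ⟨$⟩ʳ 0F ≡ third a c) × (π ⟨$⟩ʳ 1F ≡ a) × (π ⟨$⟩ʳ 2F ≡ c)
pick a c a≢c = π , at0 , at1 , trans at2 (third-third a c a≢c)
  where open Through (through (third a c) a (third-≢ a c a≢c))

high-deg : ∀ K x y r → K * 12 ≤ x + y + r → y * 25 ≤ K * 144 → K * 156 ≤ x * 25 + r * 25
high-deg K x y r h0 h1 = farkas (K * 156) (x * 25 + r * 25) (0) (+-mono-≤ (*-monoˡ-≤ 25 h0) h1) (identity K x y r)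
  where
  identity : ∀ K x y r → (K * 156) + ((x + y + r) * 25 + ((K * 144))) + (0) ≡ (x * 25 + r * 25) + ((K * 12) * 25 + ((y * 25)))
  identity = solve-∀

inner-deg-⊥ : ∀ K x r → K * 6 ≤ x + r → x * 25 ≤ K * 144 → r * 1000 < K → ⊥
inner-deg-⊥ K x r h0 h1 h2 = contra-≤ (K * 5 + r * 975) (+-mono-≤ (*-monoˡ-≤ 25 h0) (+-mono-≤ h1 h2)) (identity K x r)
  where
  identity : ∀ K x r → (K * 6) * 25 + ((x * 25) + ((suc (r * 1000)))) ≡ ((x + r) * 25 + ((K * 144) + ((K)))) + suc (K * 5 + r * 975)
  identity = solve-∀

-- The surplus of 156/25 over 6 gives a degree sum of at least 18k² + 6k²/25 - 3r, above the
-- permitted 18k² + 70k.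
few-W-⊥ : ∀ k r x y z → k * k * 300 ≤ (x + y) * 25 + r * 50 → k * k * 156 ≤ z * 25 + r * 25 → x + (y + z) ≤ k * k * 18 + k * 7 * 10 → k * 100 ≤ r → r * 1000 < k * k → ⊥
few-W-⊥ k r x y z h0 h1 h2 h3 h4 = contra-≤ (k * 50 + k * k * 5 + r * 907) (+-mono-≤ h0 (+-mono-≤ h1 (+-mono-≤ (*-monoˡ-≤ 25 h2) (+-mono-≤ (*-monoˡ-≤ 18 h3) h4)))) (identity k r x y z)
  where
  identity : ∀ k r x y z → (k * k * 300) + ((k * k * 156) + ((x + (y + z)) * 25 + ((k * 100) * 18 + ((suc (r * 1000)))))) ≡ (((x + y) * 25 + r * 50) + ((z * 25 + r * 25) + ((k * k * 18 + k * 7 * 10) * 25 + ((r) * 18 + ((k * k)))))) + suc (k * 50 + k * k * 5 + r * 907)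
  identity = solve-∀

widen-300 : ∀ K r x y → K * 156 ≤ x * 25 + r * 25 → K * 156 ≤ y * 25 + r * 25 → K * 300 ≤ (x + y) * 25 + r * 50
widen-300 K r x y h0 h1 = farkas (K * 300) ((x + y) * 25 + r * 50) (K * 12) (+-mono-≤ h0 h1) (identity K r x y)
  where
  identity : ∀ K r x y → (K * 300) + ((x * 25 + r * 25) + ((y * 25 + r * 25))) + (K * 12) ≡ ((x + y) * 25 + r * 50) + ((K * 156) + ((K * 156)))
  identity = solve-∀

adjacent-300 : ∀ K r x y → K * 12 ≤ x + y + r → K * 300 ≤ (x + y) * 25 + r * 50
adjacent-300 K r x y h0 = farkas (K * 300) ((x + y) * 25 + r * 50) (r * 25) (*-monoˡ-≤ 25 h0) (identity K r x y)
  where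
  identity : ∀ K r x y → (K * 300) + ((x + y + r) * 25) + (r * 25) ≡ ((x + y) * 25 + r * 50) + ((K * 12) * 25)
  identity = solve-∀

-- With `μ` at least 2k/5, the loss of 3 per pair amounts to at least 12k²/25, more than the errors
-- `r` and 63k.
fake-U-⊥ : ∀ k r x y μ → x + y + μ * μ * 3 ≤ k * k * 12 + k * 7 * 9 → k * k * 12 ≤ x + y + r → k * 100 ≤ r → r * 1000 < k * k → (k * 2) * (k * 2) ≤ (μ * 5) * (μ * 5) → ⊥
fake-U-⊥ k r x y μ h0 h1 h2 h3 h4 = contra-≤ (k * 925 + k * k * 11 + r * 950) (+-mono-≤ (*-monoˡ-≤ 25 h0) (+-mono-≤ (*-monoˡ-≤ 25 h1) (+-mono-≤ (*-monoˡ-≤ 25 h2) (+-mono-≤ h3 (*-monoˡ-≤ 3 h4))))) (identity k r x y μ)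
  where
  identity : ∀ k r x y μ → (x + y + μ * μ * 3) * 25 + ((k * k * 12) * 25 + ((k * 100) * 25 + ((suc (r * 1000)) + (((k * 2) * (k * 2)) * 3)))) ≡ ((k * k * 12 + k * 7 * 9) * 25 + ((x + y + r) * 25 + ((r) * 25 + ((k * k) + (((μ * 5) * (μ * 5)) * 3))))) + suc (k * 925 + k * k * 11 + r * 950)
  identity = solve-∀

marked-few : ∀ k ω μ → k * 12 < ω * 5 → ω ≤ k * 2 + μ → k * 2 ≤ μ * 5
marked-few k ω μ h0 h1 = farkas (k * 2) (μ * 5) (1) (+-mono-≤ h0 (*-monoˡ-≤ 5 h1)) (identity k ω μ)
  where
  identity : ∀ k ω μ → (k * 2) + ((ω * 5) + ((k * 2 + μ) * 5)) + (1) ≡ (μ * 5) + ((suc (k * 12)) + ((ω) * 5))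
  identity = solve-∀

module Setting {k n : ℕ} (H : Hypergraph3 n) (w : Fin n → Bool) (r : ℕ)
  (legal : ∀ a b c → E H a b c ≡ true → w a ≡ false → w b ≡ true)
  (degW : ∀ v → w v ≡ true → k * k * 6 ≤ deg₂ H v + r)
  (degAdj : ∀ u v x → E H u v x ≡ true → k * k * 12 ≤ deg₂ H u + deg₂ H v + r)
  (k≪r : k * 100 ≤ r) (r≪kk : r * 1000 < k * k) where

  open Rearrange {k} {n} H

  ω : ℕ
  ω = sum (λ v → ind (w v))

  BetterW : Arr k n → Fin k → Set
  BetterW m t = ∃[ m′ ] Step m t m′ × (∀ i → w (at m′ t i) ≡ true)

  legal₃ : ∀ a b c → E H a b c ≡ true → w a ≡ false → w c ≡ true
  legal₃ a b c e = legal a c b (trans (sym (sym₂₃ H a b c)) e)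

  legal₂₃ : ∀ a b c → E H a b c ≡ true → w b ≡ false → w c ≡ true
  legal₂₃ a b c e = legal₃ b a c (trans (sym (sym₁₂ H a b c)) e)

  link-in-W : ∀ v → (∀ a b → E H v a b ≡ true → w a ≡ true × w b ≡ true) → deg₂ H v ≤ ω * ω
  link-in-W v h = ≤-trans (sum₂-mono pointwise) (≤-reflexive (sum₂-prod (λ a → ind (w a)) (λ b → ind (w b))))
    where
    pointwise : ∀ a b → ind (E H v a b) ≤ ind (w a) * ind (w b)
    pointwise a b with E H v a b in e
    ... | false = z≤n
    ... | true rewrite proj₁ (h a b e) | proj₂ (h a b e) = ≤-refl

  module FewW (small : ω * 5 ≤ k * 12) where

    private
      ωω : ω * ω * 25 ≤ k * k * 144
      ωω = ≤-trans (≤-reflexive (l₁ ω)) (≤-trans (*-mono-≤ small small) (≤-reflexive (l₂ k)))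
        where
        l₁ : ∀ ω → ω * ω * 25 ≡ (ω * 5) * (ω * 5)
        l₁ = solve-∀
        l₂ : ∀ k → (k * 12) * (k * 12) ≡ k * k * 144
        l₂ = solve-∀

      scale : ∀ c {a b} → a ≤ b → a * c ≤ b * c
      scale c = *-monoˡ-≤ c

    degU : ∀ u → w u ≡ false → deg₂ H u * 25 ≤ k * k * 144
    degU u wu = ≤-trans (scale 25 (link-in-W u λ a b e → legal u a b e wu , legal₃ u a b e wu)) ωω

    -- A neighbour outside W has its link inside W, hence `deg₂` at most ω², which is at most
    -- 144k²/25; this leaves 156k²/25 - r for `v`. Without such a neighbour the link of `v` itself
    -- would lie in W, and 144/25 < 6 contradicts `degW`.
    high : ∀ v → w v ≡ true → k * k * 156 ≤ deg₂ H v * 25 + r * 25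
    high v wv = go (Fin.any? (λ a → Fin.any? (λ b → (E H v a b Bool.≟ true) ×-dec (w a Bool.≟ false))))
      where
      Outer : Set
      Outer = ∃[ a ] ∃[ b ] E H v a b ≡ true × w a ≡ false
      inW : ¬ Outer → ∀ a b → E H v a b ≡ true → w a ≡ true
      inW ¬nb a b e = bool-case (w a) (λ q → q) (λ q → ⊥-elim (¬nb (a , b , e , q)))
      go : Dec Outer → k * k * 156 ≤ deg₂ H v * 25 + r * 25
      go (yes (a , b , e , wa)) = high-deg (k * k) (deg₂ H v) (deg₂ H a) r (degAdj v a b e) (degU a wa)
      go (no ¬nb) = ⊥-elim (inner-deg-⊥ (k * k) (deg₂ H v) r (degW v wv) (≤-trans (scale 25 (link-in-W v λ a b e → inW ¬nb a b e , inW ¬nb b a (trans (sym (sym₂₃ H v a b)) e))) ωω) r≪kk)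

    -- Vertices adjacent to the other side have degree well above k * k * 6, which
    -- contradicts the bound 18 on three vertices and two rows.
    private
      total : ∀ m t → ¬ Better m t → deg₂ H (at m t 0F) + (deg₂ H (at m t 1F) + deg₂ H (at m t 2F)) ≤ k * k * 18 + k * 7 * 10
      total m t ¬b = ≤-trans (m≤m+n _ _) (degree-sum-bad m (at m t) (tight {m} {t} ¬b))

      conclude : ∀ m t → ¬ Better m t → w (at m t 2F) ≡ true → k * k * 300 ≤ (deg₂ H (at m t 0F) + deg₂ H (at m t 1F)) * 25 + r * 50 → ⊥
      conclude m t ¬b w₂ h = few-W-⊥ k r (deg₂ H (at m t 0F)) (deg₂ H (at m t 1F)) (deg₂ H (at m t 2F)) h (high (at m t 2F) w₂) (total m t ¬b) k≪r r≪kk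

    -- The first two vertices have degree sum about 12k² or more, either because both are in W or
    -- because they are adjacent. The third provides the surplus.
    no-fake : ∀ m t → ¬ Better m t → w (at m t 1F) ≡ true → w (at m t 2F) ≡ true
      → (w (at m t 0F) ≡ true ⊎ ∃[ x ] E H (at m t 0F) (at m t 1F) x ≡ true) → ⊥
    no-fake m t ¬b w₁ w₂ (inj₁ w₀) = conclude m t ¬b w₂ (widen-300 (k * k) r (deg₂ H (at m t 0F)) (deg₂ H (at m t 1F)) (high (at m t 0F) w₀) (high (at m t 1F) w₁))
    no-fake m t ¬b w₁ w₂ (inj₂ (x , e)) = conclude m t ¬b w₂ (adjacent-300 (k * k) r (deg₂ H (at m t 0F)) (deg₂ H (at m t 1F)) (degAdj (at m t 0F) (at m t 1F) x e))

  marked : Bool → Bool → Bool → Maybe (Fin 3)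
  marked false _     _     = just 0F
  marked true  false _     = just 1F
  marked true  true  false = just 2F
  marked true  true  true  = nothing

  tag : Arr k n → Fin k → Maybe (Fin 3)
  tag m e = marked (w (at m e 0F)) (w (at m e 1F)) (w (at m e 2F))

  LegalRow : Arr k n → Fin k → Set
  LegalRow m e = (w (at m e 0F) ≡ false → w (at m e 1F) ≡ true) × (w (at m e 0F) ≡ false → w (at m e 2F) ≡ true) × (w (at m e 1F) ≡ false → w (at m e 2F) ≡ true)

  real-legal : ∀ m e → Real m e → LegalRow m e
  real-legal m e re = legal _ _ _ re , legal₃ _ _ _ re , legal₂₃ _ _ _ re

  tag-correct : ∀ m e → LegalRow m e → ∀ i → w (at m e i) ≡ not (mark (tag m e) i)
  tag-correct m e (h₁ , h₂ , h₃) = go (w (at m e 0F)) (w (at m e 1F)) (w (at m e 2F)) refl refl refl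
    where
    go : ∀ a b c → w (at m e 0F) ≡ a → w (at m e 1F) ≡ b → w (at m e 2F) ≡ c → ∀ i → w (at m e i) ≡ not (mark (marked a b c) i)
    go false b     c     p q s 0F = p
    go false b     c     p q s 1F = h₁ p
    go false b     c     p q s 2F = h₂ p
    go true  false c     p q s 0F = p
    go true  false c     p q s 1F = q
    go true  false c     p q s 2F = h₃ q
    go true  true  false p q s 0F = p
    go true  true  false p q s 1F = q
    go true  true  false p q s 2F = s
    go true  true  true  p q s 0F = p
    go true  true  true  p q s 1F = q
    go true  true  true  p q s 2F = s

  μ : Arr k n → ℕ
  μ m = sum (λ e → unmarked (tag m e))

  ω≤ : ∀ m → ω ≤ k * 2 + μ m
  ω≤ m = ≤-trans (≤-reflexive (sum-at m (λ v → ind (w v)))) (≤-trans (sum-mono λ e → row (w (at m e 0F)) (w (at m e 1F)) (w (at m e 2F)))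
    (≤-reflexive (trans (sum-+ (λ _ → 2) (λ e → unmarked (tag m e))) (cong (_+ μ m) (sum-const k 2)))))
    where
    row : ∀ a b c → ind a + (ind b + ind c) ≤ 2 + unmarked (marked a b c)
    row false b     c     = ≤-trans (+-mono-≤ (ind≤1 b) (ind≤1 c)) (m≤m+n 2 _)
    row true  false c     = s≤s (≤-trans (ind≤1 c) (m≤m+n 1 _))
    row true  true  false = ≤-refl
    row true  true  true  = ≤-refl

  module ManyW (large : k * 12 < ω * 5) where

    μ-large : ∀ m → k * 2 ≤ μ m * 5
    μ-large m = marked-few k ω (μ m) large (ω≤ m)

    -- A fake row containing u ∉ W can be traded for one inside W: matching u and
    -- its neighbour into two other rows is possible because their degree sum is k * k * 12,
    -- while failing on all pairs of rows inside W would cost 3 per pair.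
    no-fakeU : ∀ m t → (∀ e → LegalRow m e) → ¬ BetterW m t → w (at m t 0F) ≡ false → w (at m t 2F) ≡ true
      → ∃[ x ] E H (at m t 0F) (at m t 1F) x ≡ true → ⊥
    no-fakeU m t leg ¬b w₀ w₂ (x , adj) = fake-U-⊥ k r (deg₂ H x₀) (deg₂ H x₁) (μ m) total (degAdj x₀ x₁ x adj) k≪r r≪kk (*-mono-≤ (μ-large m) (μ-large m))
      where
      x₀ = at m t 0F
      x₁ = at m t 1F
      M M′ : Fin k → Fin k → Mat
      M e f a b  = E H x₀ (at m e a) (at m f b)
      M′ e f a b = E H x₁ (at m e a) (at m f b)
      W-mark : ∀ e i → w (at m e i) ≡ true → mark (tag m e) i ≡ false
      W-mark e i p with mark (tag m e) i | tag-correct m e (leg e) i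
      ... | false | _ = refl
      ... | true  | q = ⊥-elim (true≢false p q)
      mark-W : ∀ e i → mark (tag m e) i ≡ false → w (at m e i) ≡ true
      mark-W e i p = trans (tag-correct m e (leg e) i) (cong not p)
      mark-U : ∀ e i → mark (tag m e) i ≡ true → w (at m e i) ≡ false
      mark-U e i p = trans (tag-correct m e (leg e) i) (cong not p)
      trade : ∀ {e f} → Apart t t t e f → ∀ a b c d → M e f a b ≡ true → M′ e f c d ≡ true → a ≢ c → b ≢ d
        → mark (tag m e) (third a c) ≡ false → mark (tag m f) (third b d) ≡ false → ⊥
      trade {e} {f} (apart ef et _ _ ft _ _) a b c d h h′ a≢c b≢d u v with pick 0F 1F (λ ()) | pick a c a≢c | pick b d b≢d
      ... | ρ , ρ₀ , ρ₁ , ρ₂ | σ , σ₀ , σ₁ , σ₂ | τ , τ₀ , τ₁ , τ₂ = ¬b (m′ , swap-step m t≢e t≢f ef ρ σ τ hit₁ hit₂ , allW)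
        where
        t≢e = et ∘ sym
        t≢f = ft ∘ sym
        m′ = swap m t≢e t≢f ef ρ σ τ
        hit₁ : hit m t≢e t≢f ef ρ σ τ 1F
        hit₁ rewrite ρ₁ | σ₁ | τ₁ = h
        hit₂ : hit m t≢e t≢f ef ρ σ τ 2F
        hit₂ rewrite ρ₂ | σ₂ | τ₂ = h′
        cellW : ∀ i → w (cell m t≢e t≢f ef ρ σ τ 0F i) ≡ true
        cellW 0F rewrite ρ₀ = w₂
        cellW 1F rewrite σ₀ = mark-W e _ u
        cellW 2F rewrite τ₀ = mark-W f _ v
        allW : ∀ i → w (at m′ t i) ≡ true
        allW i = trans (cong w (swap-row m t≢e t≢f ef ρ σ τ 0F i)) (cellW i)
      s : Fin k → ℕ
      s e = unmarked (tag m e)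
      s≤1 : ∀ e → s e ≤ 1
      s≤1 e with tag m e
      ... | nothing = ≤-refl
      ... | just _  = z≤n
      pointwise : ∀ e f → cnt (M e f) + cnt (M′ e f) + 3 * (s e * s f) ≤ 12 + clash t t t e f * 9
      pointwise e f with clash-or-apart t t t e f
      -- The trivial bound is 9 + 9 + 3 = 12 + 9.
      ... | inj₁ c  = ≤-trans (+-mono-≤ (+-mono-≤ (cnt≤9 (M e f)) (cnt≤9 (M′ e f))) (*-monoʳ-≤ 3 (*-mono-≤ (s≤1 e) (s≤1 f)))) (+-monoʳ-≤ 12 (*-monoˡ-≤ 9 c))
      ... | inj₂ ap = ≤-trans (link-pair≤12 (tag m e) (tag m f) (M e f) (M′ e f)
              (λ a b h → W-mark e a (legal _ _ _ h w₀) , W-mark f b (legal₃ _ _ _ h w₀))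
              (λ a b h u v → true≢false (legal₂₃ _ _ _ h (mark-U e a u)) (mark-U f b v))
              (trade ap)) (m≤m+n 12 _)
      total : deg₂ H x₀ + deg₂ H x₁ + μ m * μ m * 3 ≤ k * k * 12 + k * 7 * 9
      total = ≤-trans (≤-reflexive sums) (sum₂-bound _ (clash t t t) 12 9 pointwise (k * 7) (≤-reflexive (sum₂-clash t t t)))
        where
        sums : deg₂ H x₀ + deg₂ H x₁ + μ m * μ m * 3 ≡ sum₂ (λ e f → cnt (M e f) + cnt (M′ e f) + 3 * (s e * s f))
        sums = sym (trans (sum₂-+ (λ e f → cnt (M e f) + cnt (M′ e f)) (λ e f → 3 * (s e * s f)))
          (cong₂ _+_ (trans (sum₂-+ (λ e f → cnt (M e f)) (λ e f → cnt (M′ e f))) (cong₂ _+_ (sym (deg₂-rows H m x₀)) (sym (deg₂-rows H m x₁))))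
                     (trans (sum₂-* 3 (λ e f → s e * s f)) (trans (cong (3 *_) (sum₂-prod s s)) (*-comm 3 (sum s * sum s))))))

-- Centres in the fake row

bad-few : ∀ k r s b → s + b ≤ k * k * 18 + k * 7 * 10 → k * k * 18 ≤ s + r * 3 → k * 100 ≤ r → b ≤ r * 4
bad-few k r s b h0 h1 h2 = farkas (b) (r * 4) (k * 30) (+-mono-≤ h0 (+-mono-≤ h1 h2)) (identity k r s b)
  where
  identity : ∀ k r s b → (b) + ((k * k * 18 + k * 7 * 10) + ((s + r * 3) + ((r)))) + (k * 30) ≡ (r * 4) + ((s + b) + ((k * k * 18) + ((k * 100))))
  identity = solve-∀

three-degrees : ∀ K r x y z → K * 6 ≤ x + r → K * 6 ≤ y + r → K * 6 ≤ z + r → K * 18 ≤ x + (y + z) + r * 3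
three-degrees K r x y z h0 h1 h2 = farkas (K * 18) (x + (y + z) + r * 3) (0) (+-mono-≤ h0 (+-mono-≤ h1 h2)) (identity K r x y z)
  where
  identity : ∀ K r x y z → (K * 18) + ((x + r) + ((y + r) + ((z + r)))) + (0) ≡ (x + (y + z) + r * 3) + ((K * 6) + ((K * 6) + ((K * 6))))
  identity = solve-∀

hole-few : ∀ k r d x t b → d + x * 9 ≤ k * k * 6 + (t + b + k * 7) * 3 → k * k * 6 ≤ d + r → b ≤ r * 4 → k * 100 ≤ r → x * 9 ≤ t * 3 + r * 14
hole-few k r d x t b h0 h1 h2 h3 = farkas (x * 9) (t * 3 + r * 14) (k * 79) (+-mono-≤ h0 (+-mono-≤ h1 (+-mono-≤ (*-monoˡ-≤ 3 h2) h3))) (identity k r d x t b)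
  where
  identity : ∀ k r d x t b → (x * 9) + ((k * k * 6 + (t + b + k * 7) * 3) + ((d + r) + ((r * 4) * 3 + ((r))))) + (k * 79) ≡ (t * 3 + r * 14) + ((d + x * 9) + ((k * k * 6) + ((b) * 3 + ((k * 100)))))
  identity = solve-∀

full-cell : ∀ M → cnt M ≡ 9 → ∀ a b → M a b ≡ true
full-cell M e a b = cnt-eq {M} {λ _ _ → true} (λ _ _ _ → refl) e a b

cnt-rows : ∀ r → cnt (λ a b → not (eq a r)) ≡ 6
cnt-rows 0F = refl
cnt-rows 1F = refl
cnt-rows 2F = refl

cnt-cols : ∀ r → cnt (λ a b → not (eq b r)) ≡ 6
cnt-cols 0F = refl
cnt-cols 1F = refl
cnt-cols 2F = refl

cnt-cong : ∀ {A B : Mat} → (∀ a b → A a b ≡ B a b) → cnt A ≡ cnt B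
cnt-cong h = sum₃-cong λ a → sum₃-cong λ b → cong ind (h a b)

sum₃-pos : ∀ g → 1 ≤ sum₃ g → ∃[ i ] 1 ≤ g i
sum₃-pos g h with g 0F in p | g 1F in q | g 2F in s
... | suc _ | _     | _     = 0F , subst (1 ≤_) (sym p) (s≤s z≤n)
... | zero  | suc _ | _     = 1F , subst (1 ≤_) (sym q) (s≤s z≤n)
... | zero  | zero  | suc _ = 2F , subst (1 ≤_) (sym s) (s≤s z≤n)

1≤ind : ∀ {b} → 1 ≤ ind b → b ≡ true
1≤ind {true} _ = refl

size-pos : ∀ c → 1 ≤ size c → ∃[ p ] ∃[ a ] ∃[ b ] c p a b ≡ true
size-pos c h with sum₃-pos (λ p → cnt (c p)) h
... | p , h₁ with sum₃-pos (λ a → sum₃ (λ b → ind (c p a b))) h₁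
...   | a , h₂ with sum₃-pos (λ b → ind (c p a b)) h₂
...     | b , h₃ = p , a , b , 1≤ind h₃

T⇒≡ : ∀ {b} → T b → b ≡ true
T⇒≡ {true} _ = refl

∧-split : ∀ {a b} → a ∧ b ≡ true → a ≡ true × b ≡ true
∧-split {true} {true} _ = refl , refl

next²-≢ : ∀ ε a → next ε (next ε a) ≢ a
next²-≢ true  0F ()
next²-≢ true  1F ()
next²-≢ true  2F ()
next²-≢ false 0F ()
next²-≢ false 1F ()
next²-≢ false 2F ()

from : Fin 3 → Permutation′ 3
from a = proj₁ (spin-perm true a)

from-spin : ∀ a s → from a ⟨$⟩ʳ s ≡ spin true a s
from-spin a = proj₂ (spin-perm true a)

0-or-1≤ : ∀ a → a ≡ 0 ⊎ 1 ≤ a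
0-or-1≤ zero    = inj₁ refl
0-or-1≤ (suc a) = inj₂ (s≤s z≤n)

module Stability {k n : ℕ} (H : Hypergraph3 n) (w : Fin n → Bool) (r : ℕ)
  (legal : ∀ a b c → E H a b c ≡ true → w a ≡ false → w b ≡ true)
  (degW : ∀ v → w v ≡ true → k * k * 6 ≤ deg₂ H v + r)
  (degAdj : ∀ u v x → E H u v x ≡ true → k * k * 12 ≤ deg₂ H u + deg₂ H v + r)
  (k≪r : k * 100 ≤ r) (r≪kk : r * 1000 < k * k) where

  open Rearrange {k} {n} H
  open Setting {k} {n} H w r legal degW degAdj k≪r r≪kk

  Full : Arr k n → Fin n → Fin k → Fin k → Set
  Full m y e f = ∀ a b → E H y (at m e a) (at m f b) ≡ true

  Full-sym : ∀ {m y e f} → Full m y e f → Full m y f e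
  Full-sym h a b = trans (sym₂₃ H _ _ _) (h b a)

  -- Three vertices of W have degree sum at least 18k² - 3r, while every bad pair costs one out of
  -- 18k² + 70k.
  bad-count : ∀ m y {s₁ s₂ s₃} → (∀ i → w (y i) ≡ true) → Tight m y s₁ s₂ s₃ → sum₂ (bad m y) ≤ r * 4
  bad-count m y wy ti = bad-few k r (degree-sum m y) (sum₂ (bad m y)) (degree-sum-bad m y ti)
    (three-degrees (k * k) r (deg₂ H (y 0F)) (deg₂ H (y 1F)) (deg₂ H (y 2F)) (degW (y 0F) (wy 0F)) (degW (y 1F) (wy 1F)) (degW (y 2F) (wy 2F))) k≪r

  module Pentagon (m : Arr k n) {t e f g h : Fin k}
    (te : t ≢ e) (tf : t ≢ f) (tg : t ≢ g) (th : t ≢ h) (ef : e ≢ f) (eg : e ≢ g) (eh : e ≢ h) (fg : f ≢ g) (fh : f ≢ h) (gh : g ≢ h) where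

    private
      row : Fin 5 → Fin k
      row 0F = t
      row 1F = e
      row 2F = f
      row 3F = g
      row 4F = h

      row-inj : ∀ {i j} → row i ≡ row j → i ≡ j
      row-inj {0F} {0F} p = refl
      row-inj {1F} {1F} p = refl
      row-inj {2F} {2F} p = refl
      row-inj {3F} {3F} p = refl
      row-inj {4F} {4F} p = refl
      row-inj {0F} {1F} p = ⊥-elim (te p)
      row-inj {0F} {2F} p = ⊥-elim (tf p)
      row-inj {0F} {3F} p = ⊥-elim (tg p)
      row-inj {0F} {4F} p = ⊥-elim (th p)
      row-inj {1F} {2F} p = ⊥-elim (ef p)
      row-inj {1F} {3F} p = ⊥-elim (eg p)
      row-inj {1F} {4F} p = ⊥-elim (eh p)
      row-inj {2F} {3F} p = ⊥-elim (fg p)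
      row-inj {2F} {4F} p = ⊥-elim (fh p)
      row-inj {3F} {4F} p = ⊥-elim (gh p)
      row-inj {1F} {0F} p = ⊥-elim (te (sym p))
      row-inj {2F} {0F} p = ⊥-elim (tf (sym p))
      row-inj {3F} {0F} p = ⊥-elim (tg (sym p))
      row-inj {4F} {0F} p = ⊥-elim (th (sym p))
      row-inj {2F} {1F} p = ⊥-elim (ef (sym p))
      row-inj {3F} {1F} p = ⊥-elim (eg (sym p))
      row-inj {4F} {1F} p = ⊥-elim (eh (sym p))
      row-inj {3F} {2F} p = ⊥-elim (fg (sym p))
      row-inj {4F} {2F} p = ⊥-elim (fh (sym p))
      row-inj {4F} {3F} p = ⊥-elim (gh (sym p))

    -- Only the edge in `t`, `e`, `g` is prescribed in full. The other four edges use full links, so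
    -- only the vertices carrying these links have to be placed and the rest of each row may be
    -- distributed at will.
    pent : (ρ : Permutation′ 3) (i j : Fin 3) (a b : Fin 3)
      → E H (at m t (ρ ⟨$⟩ʳ 0F)) (at m e i) (at m g j) ≡ true
      → Full m (at m t (ρ ⟨$⟩ʳ 1F)) e f → Full m (at m t (ρ ⟨$⟩ʳ 2F)) g h
      → Full m (at m h b) e f → Full m (at m f a) g h → Better m t
    pent ρ i j a b teg tef tgh hef fgh = move , step , real₀
      where
      perms : Fin 5 → Permutation′ 3
      perms 0F = ρ
      perms 1F = from i
      perms 2F = from a
      perms 3F = from j
      perms 4F = from b
      open Move m row row-inj pentagon perms
      real₀ : Real move t
      real₀ rewrite move-row 0F 0F | move-row 0F 1F | move-row 0F 2F | from-spin i 0F | from-spin j 0F = teg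
      real₁ : Real move e
      real₁ rewrite move-row 1F 0F | move-row 1F 1F | move-row 1F 2F = tef _ _
      real₂ : Real move f
      real₂ rewrite move-row 2F 0F | move-row 2F 1F | move-row 2F 2F = tgh _ _
      real₃ : Real move g
      real₃ rewrite move-row 3F 0F | move-row 3F 1F | move-row 3F 2F | from-spin b 0F = hef _ _
      real₄ : Real move h
      real₄ rewrite move-row 4F 0F | move-row 4F 1F | move-row 4F 2F | from-spin a 0F = fgh _ _
      step : Step m t move
      step x x≢t with x Fin.≟ e | x Fin.≟ f | x Fin.≟ g | x Fin.≟ h
      ... | yes refl | _ | _ | _ = inj₁ real₁
      ... | no _ | yes refl | _ | _ = inj₁ real₂
      ... | no _ | no _ | yes refl | _ = inj₁ real₃
      ... | no _ | no _ | no _ | yes refl = inj₁ real₄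
      ... | no xe | no xf | no xg | no xh = inj₂ (move-out x λ { 0F → x≢t ∘ sym ; 1F → xe ∘ sym ; 2F → xf ∘ sym ; 3F → xg ∘ sym ; 4F → xh ∘ sym })

  module Fake (m : Arr k n) (t : Fin k) (¬b : ¬ Better m t) (inW : ∀ i → w (at m t i) ≡ true) (leg : ∀ e → LegalRow m e) where

    x : Fin 3 → Fin n
    x = at m t

    c : Fin k → Fin k → Cube
    c = cube m x

    isHole : Fin 3 → Fin k → Fin k → Bool
    isHole p e f = (clash t t t e f ≡ᵇ 0) ∧ ((cnt (c e f p) ≡ᵇ 0) ∧ all₃ (λ q → eq q p ∨ (cnt (c e f q) ≡ᵇ 9)))

    X : Fin 3 → Fin k → Fin k → ℕ
    X p e f = ind (isHole p e f)

    record Hole (p : Fin 3) (e f : Fin k) : Set where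
      constructor mkHole
      field
        away : Apart t t t e f
        none : cnt (c e f p) ≡ 0
        full : ∀ q → q ≢ p → cnt (c e f q) ≡ 9

    hole-of : ∀ p e f → 1 ≤ X p e f → Hole p e f
    hole-of p e f h = mkHole (away (clash-or-apart t t t e f)) (≡ᵇ⇒≡ (cnt (c e f p)) 0 (≡⇒T (proj₁ (proj₂ split)))) full
      where
      split : (clash t t t e f ≡ᵇ 0) ≡ true × (cnt (c e f p) ≡ᵇ 0) ≡ true × all₃ (λ q → eq q p ∨ (cnt (c e f q) ≡ᵇ 9)) ≡ true
      split = proj₁ (∧-split {clash t t t e f ≡ᵇ 0} (1≤ind h)) , ∧-split (proj₂ (∧-split {clash t t t e f ≡ᵇ 0} (1≤ind h)))
      away : 1 ≤ clash t t t e f ⊎ Apart t t t e f → Apart t t t e f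
      away (inj₂ a) = a
      away (inj₁ l) = ⊥-elim (1+n≰n (subst (1 ≤_) (≡ᵇ⇒≡ (clash t t t e f) 0 (≡⇒T (proj₁ split))) l))
      full : ∀ q → q ≢ p → cnt (c e f q) ≡ 9
      full q q≢p with all₃-sound (λ q → eq q p ∨ (cnt (c e f q) ≡ᵇ 9)) (≡⇒T (proj₂ (proj₂ split))) q
      ... | tq rewrite eq-≢ q≢p = ≡ᵇ⇒≡ _ 9 tq

    X-of : ∀ {p e f} → Hole p e f → X p e f ≡ 1
    X-of {p} {e} {f} (mkHole away none full) = ind-true (and (T⇒≡ (≡⇒≡ᵇ (clash t t t e f) 0 (apart-clash away))) (and (T⇒≡ (≡⇒≡ᵇ (cnt (c e f p)) 0 none)) (all₃-complete _ others)))
      where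
      and : ∀ {x y} → x ≡ true → y ≡ true → x ∧ y ≡ true
      and refl refl = refl
      apart-clash : ∀ {s₁ s₂ s₃ g h : Fin k} → Apart s₁ s₂ s₃ g h → clash s₁ s₂ s₃ g h ≡ 0
      apart-clash (apart a b c d e f i) rewrite δ-≢ a | δ-≢ b | δ-≢ c | δ-≢ d | δ-≢ e | δ-≢ f | δ-≢ i = refl
      others : ∀ q → eq q p ∨ (cnt (c e f q) ≡ᵇ 9) ≡ true
      others q with q Fin.≟ p
      ... | yes refl rewrite eq-refl q = refl
      ... | no q≢p rewrite eq-≢ q≢p = T⇒≡ (≡⇒≡ᵇ (cnt (c e f q)) 9 (full q q≢p))

    record Centred (e f : Fin k) : Set where
      constructor centred
      field
        away  : Apart t t t e f
        lines : (∃[ v ] ∀ p a b → c e f p a b ≡ not (eq a v)) ⊎ (∃[ v ] ∀ p a b → c e f p a b ≡ not (eq b v))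

    ΣX : Fin k → Fin k → ℕ
    ΣX e f = sum₃ (λ p → X p e f)

    flaws : Fin k → Fin k → ℕ
    flaws e f = ΣX e f + bad m x e f + clash t t t e f

    classify : ∀ e f → 1 ≤ flaws e f ⊎ Centred e f
    classify e f with clash-or-apart t t t e f
    ... | inj₁ l = inj₁ (≤-trans l (m≤n+m (clash t t t e f) (ΣX e f + bad m x e f)))
    ... | inj₂ ap with 0-or-1≤ (bad m x e f)
    ...   | inj₂ l = inj₁ (≤-trans l (≤-trans (m≤n+m (bad m x e f) (ΣX e f)) (m≤m+n (ΣX e f + bad m x e f) (clash t t t e f))))
    ...   | inj₁ b≡0 with shape (c e f) (tight {m} {t} ¬b ap) (exact m x e f b≡0)
    ...     | rows v h = inj₂ (centred ap (inj₁ (v , h)))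
    ...     | cols v h = inj₂ (centred ap (inj₂ (v , h)))
    ...     | hole p z q = inj₁ (≤-trans (≤-reflexive (sym (X-of (mkHole ap z q)))) (≤-trans (term p) (≤-trans (m≤m+n (ΣX e f) (bad m x e f)) (m≤m+n (ΣX e f + bad m x e f) (clash t t t e f)))))
      where
      term : ∀ p → X p e f ≤ ΣX e f
      term 0F = m≤m+n (X 0F e f) (X 1F e f + X 2F e f)
      term 1F = ≤-trans (m≤m+n (X 1F e f) (X 2F e f)) (m≤n+m (X 1F e f + X 2F e f) (X 0F e f))
      term 2F = ≤-trans (m≤n+m (X 2F e f) (X 1F e f)) (m≤n+m (X 1F e f + X 2F e f) (X 0F e f))

    N : Fin 3 → ℕ
    N p = sum₂ (X p)

    Σbad : sum₂ (bad m x) ≤ r * 4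
    Σbad = bad-count m x inW (tight {m} {t} ¬b)

    Σflaws : sum₂ flaws ≡ sum₃ N + sum₂ (bad m x) + k * 7
    Σflaws = trans (sum₂-+ (λ e f → ΣX e f + bad m x e f) (clash t t t)) (cong₂ _+_
      (trans (sum₂-+ ΣX (bad m x)) (cong (_+ sum₂ (bad m x))
        (sym (trans (sum₃-sum (λ p e → sum (X p e))) (sum-cong-≗ (λ e → sum₃-sum (λ p f → X p e f)))))))
      (sum₂-clash t t t))

    -- The link of `x p` has 0 triples on a pair with centre `x p`, 9 on a pair with centre at
    -- another vertex of `t`, and 6 on a pair without flaw. To reach about 6k² the pairs of the
    -- first kind must be balanced by those of the second, so `x p` cannot be the centre of much
    -- more than a third of the pairs with centre in `t`.
    N-bound : ∀ p → N p * 9 ≤ sum₃ N * 3 + r * 14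
    N-bound p = hole-few k r (deg₂ H (x p)) (N p) (sum₃ N) (sum₂ (bad m x)) total (degW (x p) (inW p)) Σbad k≪r
      where
      -- The weight 9 makes both kinds of pairs with centre in `t` count 6 + 3.
      pointwise : ∀ e f → cnt (c e f p) + X p e f * 9 ≤ 6 + flaws e f * 3
      pointwise e f with 0-or-1≤ (X p e f)
      ... | inj₂ l = ≤-trans (+-mono-≤ (≤-reflexive (Hole.none (hole-of p e f l))) (*-monoˡ-≤ 9 (ind≤1 (isHole p e f)))) (+-monoʳ-≤ 6 (*-monoˡ-≤ 3 flawed))
        where
        flawed : 1 ≤ flaws e f
        flawed with classify e f
        ... | inj₁ l′ = l′
        ... | inj₂ (centred _ (inj₁ (v , q))) = ⊥-elim (6≢0 (trans (sym (trans (cnt-cong (q p)) (cnt-rows v))) (Hole.none (hole-of p e f l))))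
          where
          6≢0 : 6 ≢ 0
          6≢0 ()
        ... | inj₂ (centred _ (inj₂ (v , q))) = ⊥-elim (6≢0 (trans (sym (trans (cnt-cong (q p)) (cnt-cols v))) (Hole.none (hole-of p e f l))))
          where
          6≢0 : 6 ≢ 0
          6≢0 ()
      ... | inj₁ x≡0 with classify e f
      ...   | inj₁ l = ≤-trans (+-mono-≤ (cnt≤9 (c e f p)) (≤-reflexive (cong (_* 9) x≡0))) (≤-trans (≤-reflexive refl) (+-monoʳ-≤ 6 (*-monoˡ-≤ 3 l)))
      ...   | inj₂ (centred _ (inj₁ (v , q))) = ≤-trans (≤-reflexive (cong₂ _+_ (trans (cnt-cong (q p)) (cnt-rows v)) (cong (_* 9) x≡0))) (m≤m+n 6 _)
      ...   | inj₂ (centred _ (inj₂ (v , q))) = ≤-trans (≤-reflexive (cong₂ _+_ (trans (cnt-cong (q p)) (cnt-cols v)) (cong (_* 9) x≡0))) (m≤m+n 6 _)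
      total : deg₂ H (x p) + N p * 9 ≤ k * k * 6 + (sum₃ N + sum₂ (bad m x) + k * 7) * 3
      total = ≤-trans (≤-reflexive (sym (trans (sum₂-+ (λ e f → cnt (c e f p)) (λ e f → X p e f * 9))
          (cong₂ _+_ (sym (deg₂-rows H m (x p))) (trans (sum₂-cong (λ e f → *-comm (X p e f) 9)) (trans (sum₂-* 9 (X p)) (*-comm 9 (N p))))))))
        (sum₂-bound _ flaws 6 3 pointwise _ (≤-reflexive Σflaws))

-- Two different centres in the fake row

quad-⊥ : ∀ z r K k a b → a * b ≤ K * (k * 4 + r * 24) → z * z ≤ a * b → K * (k * 4) ≤ K * r → K * (r * 25) < z * z → ⊥
quad-⊥ z r K k a b h0 h1 h2 h3 = contra-≤ (0) (+-mono-≤ h0 (+-mono-≤ h1 (+-mono-≤ h2 h3))) (identity z r K k a b)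
  where
  identity : ∀ z r K k a b → (a * b) + ((z * z) + ((K * (k * 4)) + ((suc (K * (r * 25)))))) ≡ ((K * (k * 4 + r * 24)) + ((a * b) + ((K * r) + ((z * z))))) + suc (0)
  identity = solve-∀

third-≢ʳ : ∀ a c → a ≢ c → third a c ≢ c
third-≢ʳ 0F 0F n _ = n refl
third-≢ʳ 1F 1F n _ = n refl
third-≢ʳ 2F 2F n _ = n refl
third-≢ʳ 0F 1F _ ()
third-≢ʳ 0F 2F _ ()
third-≢ʳ 1F 0F _ ()
third-≢ʳ 1F 2F _ ()
third-≢ʳ 2F 0F _ ()
third-≢ʳ 2F 1F _ ()

-- Distributes the vertices of `t` in `pent`: the first is prescribed, the second must have a full
-- link on the pair with centre `p`, the third on the pair with centre `q`.
avoiding : ∀ p q s → p ≢ q → ∃[ ρ ] (ρ ⟨$⟩ʳ 0F ≡ s) × (ρ ⟨$⟩ʳ 1F ≢ p) × (ρ ⟨$⟩ʳ 2F ≢ q)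
avoiding p q s p≢q with s Fin.≟ p | s Fin.≟ q
... | yes refl | _ = π , at0 , (λ e → p≢q (trans (sym e) at1)) , (λ e → third-≢ʳ p q p≢q (trans (sym at2) e))
  where open Through (through p q p≢q)
... | no _ | yes refl = π , at0 , (λ e → third-≢ p q p≢q (trans (sym at1) e)) , (λ e → third-≢ q (third p q) (third-≢ʳ p q p≢q ∘ sym) (trans (sym at2) e))
  where open Through (through q (third p q) (third-≢ʳ p q p≢q ∘ sym))
... | no _ | no s≢q = π , at0 , (λ e → p≢q (trans (sym e) at1)) , (λ e → third-≢ʳ s q s≢q (trans (sym at2) e))
  where open Through (through s q s≢q)

sum₂₂-swap : ∀ {k} (G : Fin k → Fin k → Fin k → Fin k → ℕ) → sum₂ (λ e f → sum₂ (λ g h → G e f g h)) ≡ sum₂ (λ g h → sum₂ (λ e f → G e f g h))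
sum₂₂-swap G = begin
  sum (λ e → sum (λ f → sum (λ g → sum (λ h → G e f g h)))) ≡⟨ sum-cong-≗ (λ e → sum-comm (λ f g → sum (λ h → G e f g h))) ⟩
  sum (λ e → sum (λ g → sum (λ f → sum (λ h → G e f g h)))) ≡⟨ sum-comm (λ e g → sum (λ f → sum (λ h → G e f g h))) ⟩
  sum (λ g → sum (λ e → sum (λ f → sum (λ h → G e f g h)))) ≡⟨ sum-cong-≗ (λ g → sum-cong-≗ (λ e → sum-comm (λ f h → G e f g h))) ⟩
  sum (λ g → sum (λ e → sum (λ h → sum (λ f → G e f g h)))) ≡⟨ sum-cong-≗ (λ g → sum-comm (λ e h → sum (λ f → G e f g h))) ⟩
  sum (λ g → sum (λ h → sum (λ e → sum (λ f → G e f g h)))) ∎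
  where open ≡-Reasoning

sum₂-fst : ∀ {k} (f : Fin k → ℕ) → sum₂ {k} (λ g h → f g) ≡ k * sum f
sum₂-fst {k} f = trans (sum-cong-≗ (λ g → sum-const k (f g))) (sum-* k f)

sum₂-snd : ∀ {k} (f : Fin k → ℕ) → sum₂ {k} (λ g h → f h) ≡ k * sum f
sum₂-snd f = trans (sum₂-swap (λ g h → f h)) (sum₂-fst f)

module _ {k : ℕ} (F : Fin k → Fin k → ℕ) where

  private
    outer : sum {k} (λ e → k * sum (F e)) ≡ k * sum₂ F
    outer = sum-* k (λ e → sum (F e))

  sum₄-eg : sum₂ {k} (λ e f → sum₂ {k} (λ g h → F e g)) ≡ k * (k * sum₂ F)
  sum₄-eg = trans (sum₂-cong (λ e f → sum₂-fst (F e))) (trans (sum₂-fst (λ e → k * sum (F e))) (cong (k *_) outer))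

  sum₄-eh : sum₂ {k} (λ e f → sum₂ {k} (λ g h → F e h)) ≡ k * (k * sum₂ F)
  sum₄-eh = trans (sum₂-cong (λ e f → sum₂-snd (F e))) (trans (sum₂-fst (λ e → k * sum (F e))) (cong (k *_) outer))

  sum₄-fg : sum₂ {k} (λ e f → sum₂ {k} (λ g h → F f g)) ≡ k * (k * sum₂ F)
  sum₄-fg = trans (sum₂-cong (λ e f → sum₂-fst (F f))) (trans (sum₂-snd (λ e → k * sum (F e))) (cong (k *_) outer))

  sum₄-fh : sum₂ {k} (λ e f → sum₂ {k} (λ g h → F f h)) ≡ k * (k * sum₂ F)
  sum₄-fh = trans (sum₂-cong (λ e f → sum₂-snd (F f))) (trans (sum₂-snd (λ e → k * sum (F e))) (cong (k *_) outer))

module TwoHoles {k n : ℕ} (H : Hypergraph3 n) (w : Fin n → Bool) (r : ℕ)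
  (legal : ∀ a b c → E H a b c ≡ true → w a ≡ false → w b ≡ true)
  (degW : ∀ v → w v ≡ true → k * k * 6 ≤ deg₂ H v + r)
  (degAdj : ∀ u v x → E H u v x ≡ true → k * k * 12 ≤ deg₂ H u + deg₂ H v + r)
  (k≪r : k * 100 ≤ r) (r≪kk : r * 1000 < k * k)
  (m : Arr k n) (t : Fin k) (¬b : ¬ Rearrange.Better {k} {n} H m t) (inW : ∀ i → w (at m t i) ≡ true)
  (leg : ∀ e → Setting.LegalRow {k} {n} H w r legal degW degAdj k≪r r≪kk m e) where

  open Rearrange {k} {n} H
  open Setting {k} {n} H w r legal degW degAdj k≪r r≪kk
  open Stability {k} {n} H w r legal degW degAdj k≪r r≪kk
  open Fake m t ¬b inW leg

  -- The exchanged triple must lie in W for `bad-count` to apply, so the vertices left over from `e`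
  -- and `f` are chosen there.
  wi : ∀ e → ∃[ i ] w (at m e i) ≡ true
  wi e = bool-case (w (at m e 0F)) (λ p → 0F , p) (λ q → 1F , proj₁ (leg e) q)

  y : Fin 3 → Fin k → Fin k → Fin 3 → Fin n
  y p e f = triple (x p) (at m e (proj₁ (wi e))) (at m f (proj₁ (wi f)))

  yW : ∀ p e f i → w (y p e f i) ≡ true
  yW p e f 0F = inW p
  yW p e f 1F = proj₂ (wi e)
  yW p e f 2F = proj₂ (wi f)

  -- The two vertices of `t` other than the centre `x p` have full links on `e` and `f`. They give
  -- two disjoint edges that leave over `x p` and any desired vertices of `e` and `f`.
  tight-y : ∀ {p e f} → Hole p e f → Tight m (y p e f) t e f
  tight-y {p} {e} {f} (mkHole (apart ef et _ _ ft _ _) _ full) {g} {h} ap =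
    NoPM-cong {cube m (cell m te tf ef ρ σ τ 0F) g h} same (tight-swap {m} {t} {e} {f} ¬b te tf ef ρ σ τ (hits 1F next-≢ρ) (hits 2F next²-≢ρ) ap)
    where
    te = et ∘ sym
    tf = ft ∘ sym
    ρ = from p
    σ = from (proj₁ (wi e))
    τ = from (proj₁ (wi f))
    next-≢ρ : ρ ⟨$⟩ʳ 1F ≢ p
    next-≢ρ q = next-≢ true p (sym (trans (sym (from-spin p 1F)) q))
    next²-≢ρ : ρ ⟨$⟩ʳ 2F ≢ p
    next²-≢ρ q = next²-≢ true p (trans (sym (from-spin p 2F)) q)
    hits : ∀ s → ρ ⟨$⟩ʳ s ≢ p → hit m te tf ef ρ σ τ s
    hits s s≢p = full-cell (c e f (ρ ⟨$⟩ʳ s)) (full _ s≢p) _ _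
    same : ∀ i a b → cube m (y p e f) g h i a b ≡ cube m (cell m te tf ef ρ σ τ 0F) g h i a b
    same 0F a b rewrite from-spin p 0F = refl
    same 1F a b rewrite from-spin (proj₁ (wi e)) 0F = refl
    same 2F a b rewrite from-spin (proj₁ (wi f)) 0F = refl

  Winner : Fin k → Fin k → Fin k → Set
  Winner f g h = ∃[ a ] Full m (at m f a) g h

  -- On `g` and `h` the vertex `x p` has all nine triples, the centre being `x q`. For the exchanged
  -- triple a centre in `g` or `h` would leave `x p` six and a centre at `x p` none. So the centre
  -- is the vertex from `e` or `f`, and the other of these two has a full link.
  winner : ∀ {p q e f g h} → p ≢ q → Hole p e f → Hole q g h → Apart t e f g h → bad m (y p e f) g h ≡ 0 → Winner f g h ⊎ Winner e g h
  winner {p} {q} {e} {f} {g} {h} p≢q H₁ H₂ ap b≡0 with shape (cube m (y p e f) g h) (tight-y H₁ ap) (exact m (y p e f) g h b≡0)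
  ... | hole 0F none _ = ⊥-elim (9≢0 (trans (sym (Hole.full H₂ p p≢q)) none))
    where
    9≢0 : 9 ≢ 0
    9≢0 ()
  ... | hole 1F _ full = inj₁ (_ , full-cell (cube m (y p e f) g h 2F) (full 2F (λ ())))
  ... | hole 2F _ full = inj₂ (_ , full-cell (cube m (y p e f) g h 1F) (full 1F (λ ())))
  ... | rows v l = ⊥-elim (6≢9 (trans (sym (trans (cnt-cong (l 0F)) (cnt-rows v))) (Hole.full H₂ p p≢q)))
    where
    6≢9 : 6 ≢ 9
    6≢9 ()
  ... | cols v l = ⊥-elim (6≢9 (trans (sym (trans (cnt-cong (l 0F)) (cnt-cols v))) (Hole.full H₂ p p≢q)))
    where
    6≢9 : 6 ≢ 9
    6≢9 ()

  five : ∀ {p q e f g h} → p ≢ q → t ≢ e → t ≢ f → t ≢ g → t ≢ h → e ≢ f → e ≢ g → e ≢ h → f ≢ g → f ≢ h → g ≢ h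
    → (∀ s → s ≢ p → Full m (x s) e f) → (∀ s → s ≢ q → Full m (x s) g h) → Winner f g h → Winner h e f → bad m x e g ≡ 0 → ⊥
  five {p} {q} {e} {f} {g} {h} p≢q te tf tg th ef eg eh fg fh gh F G (a , fgh) (b , hef) b≡0
    with size-pos (c e g) (≤-trans (s≤s z≤n) (≤-reflexive (sym (exact m x e g b≡0))))
  ... | s , i , j , xeg with avoiding p q s p≢q
  ...   | ρ , refl , ρ₁ , ρ₂ = ¬b (Pentagon.pent m te tf tg th ef eg eh fg fh gh ρ i j a b xeg (F _ ρ₁) (G _ ρ₂) hef fgh)

  -- The four combinations of outcomes of `winner` become one after exchanging `e` with `f` or `g`
  -- with `h`.
  quad : ∀ {p q e f g h} → p ≢ q → Hole p e f → Hole q g h → e ≢ g → e ≢ h → f ≢ g → f ≢ h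
    → bad m x e g ≡ 0 → bad m x e h ≡ 0 → bad m x f g ≡ 0 → bad m x f h ≡ 0
    → bad m (y p e f) g h ≡ 0 → bad m (y q g h) e f ≡ 0 → ⊥
  quad {p} {q} {e} {f} {g} {h} p≢q H₁@(mkHole (apart ef et _ _ ft _ _) _ F₁) H₂@(mkHole (apart gh gt _ _ ht _ _) _ F₂) eg eh fg fh beg beh bfg bfh b₁ b₂ =
    go (winner p≢q H₁ H₂ (apart gh gt (eg ∘ sym) (fg ∘ sym) ht (eh ∘ sym) (fh ∘ sym)) b₁) (winner (p≢q ∘ sym) H₂ H₁ (apart ef et eg eh ft fg fh) b₂)
    where
    te = et ∘ sym
    tf = ft ∘ sym
    tg = gt ∘ sym
    th = ht ∘ sym
    F : ∀ s → s ≢ p → Full m (x s) e f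
    F s s≢p = full-cell (c e f s) (F₁ s s≢p)
    G : ∀ s → s ≢ q → Full m (x s) g h
    G s s≢q = full-cell (c g h s) (F₂ s s≢q)
    F′ : ∀ s → s ≢ p → Full m (x s) f e
    F′ s s≢p = Full-sym {m} (F s s≢p)
    G′ : ∀ s → s ≢ q → Full m (x s) h g
    G′ s s≢q = Full-sym {m} (G s s≢q)
    flip : ∀ {a b d} → Winner a b d → Winner a d b
    flip (i , l) = i , Full-sym {m} l
    go : Winner f g h ⊎ Winner e g h → Winner h e f ⊎ Winner g e f → ⊥
    go (inj₁ a) (inj₁ b) = five p≢q te tf tg th ef eg eh fg fh gh F G a b beg
    go (inj₁ a) (inj₂ b) = five p≢q te tf th tg ef eh eg fh fg (gh ∘ sym) F G′ (flip a) b beh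
    go (inj₂ a) (inj₁ b) = five p≢q tf te tg th (ef ∘ sym) fg fh eg eh gh F′ G a (flip b) bfg
    go (inj₂ a) (inj₂ b) = five p≢q tf te th tg (ef ∘ sym) fh fg eh eg (gh ∘ sym) F′ G′ (flip a) (flip b) bfh

  err : Fin k → Fin k → ℕ
  err a b = δ a b + bad m x a b

  -- Weighted by `X p e f`, since the bound on bad pairs for `y p e f` is available only if the
  -- centre of (e , f) is `x p`.
  swapErr : Fin 3 → Fin k → Fin k → Fin k → Fin k → ℕ
  swapErr p e f g h = X p e f * bad m (y p e f) g h

  Err : Fin 3 → Fin 3 → Fin k → Fin k → Fin k → Fin k → ℕ
  Err p q e f g h = ((err e g + err e h) + (err f g + err f h)) + (swapErr p e f g h + swapErr q g h e f)

  module _ {p q : Fin 3} (p≢q : p ≢ q) where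

    private
      δ0 : ∀ {a b : Fin k} → δ a b ≡ 0 → a ≢ b
      δ0 {a} z refl = 1+n≢0 (trans (sym (δ-refl a)) z)

      pointwise : ∀ e f g h → X p e f * X q g h ≤ Err p q e f g h
      pointwise e f g h with 0-or-1≤ (X p e f) | 0-or-1≤ (X q g h) | 0-or-1≤ (Err p q e f g h)
      ... | inj₁ z | _ | _ = ≤-trans (≤-reflexive (cong (_* X q g h) z)) z≤n
      ... | inj₂ _ | inj₁ z | _ = ≤-trans (≤-reflexive (trans (cong (X p e f *_) z) (*-zeroʳ (X p e f)))) z≤n
      ... | inj₂ _ | inj₂ _ | inj₂ l = ≤-trans (*-mono-≤ (ind≤1 (isHole p e f)) (ind≤1 (isHole q g h))) l
      ... | inj₂ a | inj₂ b | inj₁ z = ⊥-elim (quad p≢q (hole-of p e f a) (hole-of q g h b)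
              (δ0 (m+n≡0⇒m≡0 _ eg)) (δ0 (m+n≡0⇒m≡0 _ eh)) (δ0 (m+n≡0⇒m≡0 _ fg)) (δ0 (m+n≡0⇒m≡0 _ fh))
              (m+n≡0⇒n≡0 (δ e g) eg) (m+n≡0⇒n≡0 (δ e h) eh) (m+n≡0⇒n≡0 (δ f g) fg) (m+n≡0⇒n≡0 (δ f h) fh)
              (cancel a (m+n≡0⇒m≡0 (swapErr p e f g h) rest)) (cancel b (m+n≡0⇒n≡0 (swapErr p e f g h) rest)))
        where
        cancel : ∀ {u v} → 1 ≤ u → u * v ≡ 0 → v ≡ 0
        cancel {suc u} {v} _ uv = m+n≡0⇒m≡0 v uv
        pairs₄ : (err e g + err e h) + (err f g + err f h) ≡ 0
        pairs₄ = m+n≡0⇒m≡0 _ z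
        rest : swapErr p e f g h + swapErr q g h e f ≡ 0
        rest = m+n≡0⇒n≡0 ((err e g + err e h) + (err f g + err f h)) z
        eg : err e g ≡ 0
        eg = m+n≡0⇒m≡0 _ (m+n≡0⇒m≡0 (err e g + err e h) pairs₄)
        eh : err e h ≡ 0
        eh = m+n≡0⇒n≡0 (err e g) (m+n≡0⇒m≡0 (err e g + err e h) pairs₄)
        fg : err f g ≡ 0
        fg = m+n≡0⇒m≡0 _ (m+n≡0⇒n≡0 (err e g + err e h) pairs₄)
        fh : err f h ≡ 0
        fh = m+n≡0⇒n≡0 (err f g) (m+n≡0⇒n≡0 (err e g + err e h) pairs₄)

      Σerr : sum₂ err ≤ k + r * 4
      Σerr = ≤-trans (≤-reflexive (sum₂-+ δ (bad m x))) (+-mono-≤ (≤-reflexive sum₂-δ) Σbad)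

      Σerr₄ : ∀ {s} → s ≡ k * (k * sum₂ err) → s ≤ k * k * (k + r * 4)
      Σerr₄ refl = ≤-trans (≤-reflexive (sym (*-assoc k k _))) (*-monoʳ-≤ (k * k) Σerr)

      Σswap : ∀ p → sum₂ (λ e f → sum₂ (λ g h → swapErr p e f g h)) ≤ k * k * (r * 4)
      Σswap p = ≤-trans (sum₂-mono each) (≤-reflexive (sum₂-const k (r * 4)))
        where
        each : ∀ e f → sum₂ (λ g h → swapErr p e f g h) ≤ r * 4
        each e f = ≤-trans (≤-reflexive (sum₂-* (X p e f) (bad m (y p e f)))) (go (0-or-1≤ (X p e f)))
          where
          go : X p e f ≡ 0 ⊎ 1 ≤ X p e f → X p e f * sum₂ (bad m (y p e f)) ≤ r * 4
          go (inj₁ z) = ≤-trans (≤-reflexive (cong (_* sum₂ (bad m (y p e f))) z)) z≤n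
          go (inj₂ l) = ≤-trans (*-monoˡ-≤ _ (ind≤1 (isHole p e f))) (≤-trans (≤-reflexive (*-identityˡ _)) (bad-count m (y p e f) (yW p e f) (tight-y (hole-of p e f l))))

      split₄ : sum₂ (λ e f → sum₂ (λ g h → Err p q e f g h)) ≡
        ((sum₂ {k} (λ e f → sum₂ {k} (λ g h → err e g)) + sum₂ {k} (λ e f → sum₂ {k} (λ g h → err e h)))
        + (sum₂ {k} (λ e f → sum₂ {k} (λ g h → err f g)) + sum₂ {k} (λ e f → sum₂ {k} (λ g h → err f h))))
        + (sum₂ (λ e f → sum₂ (λ g h → swapErr p e f g h)) + sum₂ (λ e f → sum₂ (λ g h → swapErr q g h e f)))
      split₄ = trans (plus _ _) (cong₂ _+_ (trans (plus _ _) (cong₂ _+_ (plus _ _) (plus _ _))) (plus _ _))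
        where
        plus : ∀ (A B : Fin k → Fin k → Fin k → Fin k → ℕ) → sum₂ (λ e f → sum₂ (λ g h → A e f g h + B e f g h)) ≡ sum₂ (λ e f → sum₂ (λ g h → A e f g h)) + sum₂ (λ e f → sum₂ (λ g h → B e f g h))
        plus A B = trans (sum₂-cong (λ e f → sum₂-+ (A e f) (B e f))) (sum₂-+ (λ e f → sum₂ (A e f)) (λ e f → sum₂ (B e f)))

    -- A quadruple of rows counted by the product violates a hypothesis of `quad`. The four
    -- conditions on pairs of rows cost k + 4r each, the two on exchanged triples 4r each, all times
    -- k².
    two-holes : N p * N q ≤ k * k * (k * 4 + r * 24)
    two-holes = begin
      N p * N q                                               ≡⟨ sym (trans (sum₂-cong (λ e f → sum₂-* (X p e f) (X q))) (trans (sum₂-cong (λ e f → *-comm (X p e f) (N q))) (trans (sum₂-* (N q) (X p)) (*-comm (N q) (N p))))) ⟩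
      sum₂ (λ e f → sum₂ (λ g h → X p e f * X q g h))         ≤⟨ sum₂-mono (λ e f → sum₂-mono (pointwise e f)) ⟩
      sum₂ (λ e f → sum₂ (λ g h → Err p q e f g h))           ≡⟨ split₄ ⟩
      _                                                       ≤⟨ +-mono-≤ (+-mono-≤ (+-mono-≤ (Σerr₄ (sum₄-eg err)) (Σerr₄ (sum₄-eh err))) (+-mono-≤ (Σerr₄ (sum₄-fg err)) (Σerr₄ (sum₄-fh err))))
                                                                    (+-mono-≤ (Σswap p) (≤-trans (≤-reflexive (sum₂₂-swap (λ e f g h → swapErr q g h e f))) (Σswap q))) ⟩
      ((k * k * (k + r * 4) + k * k * (k + r * 4)) + (k * k * (k + r * 4) + k * k * (k + r * 4))) + (k * k * (r * 4) + k * k * (r * 4)) ≡⟨ collect (k * k) k r ⟩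
      k * k * (k * 4 + r * 24) ∎
      where
      open ≤-Reasoning
      collect : ∀ K k r → ((K * (k + r * 4) + K * (k + r * 4)) + (K * (k + r * 4) + K * (k + r * 4))) + (K * (r * 4) + K * (r * 4)) ≡ K * (k * 4 + r * 24)
      collect = solve-∀

    not-both : ∀ z → k * k * (r * 25) < z * z → z ≤ N p → z ≤ N q → ⊥
    not-both z big hp hq = quad-⊥ z r (k * k) k (N p) (N q) two-holes (*-mono-≤ hp hq) (*-monoʳ-≤ (k * k) (≤-trans (*-monoʳ-≤ k (m≤m+n 4 96)) k≪r)) big

-- Centres outside the fake row

hole-sum : ∀ a b d r z → a * 9 ≤ (a + (b + d)) * 3 + r * 14 → b ≤ z → d ≤ z → r ≤ z → (a + (b + d)) * 6 ≤ z * 32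
hole-sum a b d r z h0 h1 h2 h3 = farkas ((a + (b + d)) * 6) (z * 32) (0) (+-mono-≤ h0 (+-mono-≤ (*-monoˡ-≤ 9 h1) (+-mono-≤ (*-monoˡ-≤ 9 h2) (*-monoˡ-≤ 14 h3)))) (identity a b d r z)
  where
  identity : ∀ a b d r z → ((a + (b + d)) * 6) + (((a + (b + d)) * 3 + r * 14) + ((z) * 9 + ((z) * 9 + ((z) * 14)))) + (0) ≡ (z * 32) + ((a * 9) + ((b) * 9 + ((d) * 9 + ((r) * 14))))
  identity = solve-∀

flaw-sum : ∀ s b k r z → s * 6 ≤ z * 32 → b ≤ r * 4 → r ≤ z → k * 100 ≤ r → (s + b + k * 7) * 6 ≤ z * 60
flaw-sum s b k r z h0 h1 h2 h3 = farkas ((s + b + k * 7) * 6) (z * 60) (k * 58 + z * 3) (+-mono-≤ h0 (+-mono-≤ (*-monoˡ-≤ 6 h1) (+-mono-≤ (*-monoˡ-≤ 25 h2) h3))) (identity s b k r z)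
  where
  identity : ∀ s b k r z → ((s + b + k * 7) * 6) + ((z * 32) + ((r * 4) * 6 + ((z) * 25 + ((r))))) + (k * 58 + z * 3) ≡ (z * 60) + ((s * 6) + ((b) * 6 + ((r) * 25 + ((k * 100)))))
  identity = solve-∀

square-small : ∀ b z K → b * b ≤ z * 10 → z * 10000 ≤ K → (b * 30) * (b * 30) ≤ K
square-small b z K h0 h1 = farkas ((b * 30) * (b * 30)) (K) (z * 1000) (+-mono-≤ (*-monoˡ-≤ 900 h0) h1) (identity b z K)
  where
  identity : ∀ b z K → ((b * 30) * (b * 30)) + ((z * 10) * 900 + ((K))) + (z * 1000) ≡ (K) + ((b * b) * 900 + ((z * 10000)))
  identity = solve-∀

sources-large : ∀ k a b μ → k * 2 ≤ μ * 5 → μ ≤ a + b → b * 30 ≤ k → k * 7 ≤ a * 30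
sources-large k a b μ h0 h1 h2 = farkas (k * 7) (a * 30) (k * 4) (+-mono-≤ (*-monoˡ-≤ 6 h0) (+-mono-≤ (*-monoˡ-≤ 30 h1) h2)) (identity k a b μ)
  where
  identity : ∀ k a b μ → (k * 7) + ((μ * 5) * 6 + ((a + b) * 30 + ((k)))) + (k * 4) ≡ (a * 30) + ((k * 2) * 6 + ((μ) * 30 + ((b * 30))))
  identity = solve-∀

beta-sum : ∀ k r a b d → a ≤ r * 4 → b ≤ r * 4 → d ≤ r * 4 → k * 100 ≤ r → a + (b + d) + (k + k) ≤ r * 13
beta-sum k r a b d h0 h1 h2 h3 = farkas (a + (b + d) + (k + k)) (r * 13) (k * 98) (+-mono-≤ h0 (+-mono-≤ h1 (+-mono-≤ h2 h3))) (identity k r a b d)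
  where
  identity : ∀ k r a b d → (a + (b + d) + (k + k)) + ((r * 4) + ((r * 4) + ((r * 4) + ((r))))) + (k * 98) ≡ (r * 13) + ((a) + ((b) + ((d) + ((k * 100)))))
  identity = solve-∀

-- The numerical point is that (7/30)³ = 343/27000 exceeds 69/10000.
triple-⊥ : ∀ k a z → a ≤ k * (z * 69) → k * k * k * 343 ≤ a * 27000 → k * (z * 10000) ≤ k * (k * k) → 0 < k * k * k → ⊥
triple-⊥ k a z h0 h1 h2 h3 = contra-≤ (k * k * k * 155 + k * z * 7000) (+-mono-≤ (*-monoˡ-≤ 27000 h0) (+-mono-≤ h1 (+-mono-≤ (*-monoˡ-≤ 187 h2) h3))) (identity k a z)
  where
  identity : ∀ k a z → (a) * 27000 + ((k * k * k * 343) + ((k * (z * 10000)) * 187 + ((suc (0))))) ≡ ((k * (z * 69)) * 27000 + ((a * 27000) + ((k * (k * k)) * 187 + ((k * k * k))))) + suc (k * k * k * 155 + k * z * 7000)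
  identity = solve-∀

cube-pos : ∀ {k} → Fin k → 0 < k * k * k
cube-pos {suc k} _ = s≤s z≤n

square-cancel : ∀ {a b} → a * a ≤ b * b → a ≤ b
square-cancel {a} {b} h with a ≤? b
... | yes p = p
... | no ¬p = ⊥-elim (<⇒≱ (*-mono-< (≰⇒> ¬p) (≰⇒> ¬p)) h)

sum₃-distinct : ∀ (f : Fin 3 → ℕ) → (f 1F + (f 0F + f 2F) ≡ sum₃ f) × (f 2F + (f 0F + f 1F) ≡ sum₃ f)
sum₃-distinct f = l₁ (f 0F) (f 1F) (f 2F) , l₂ (f 0F) (f 1F) (f 2F)
  where
  l₁ : ∀ a b c → b + (a + c) ≡ a + (b + c)
  l₁ = solve-∀
  l₂ : ∀ a b c → c + (a + b) ≡ a + (b + c)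
  l₂ = solve-∀

module Centres {k n : ℕ} (H : Hypergraph3 n) (w : Fin n → Bool) (r : ℕ)
  (legal : ∀ a b c → E H a b c ≡ true → w a ≡ false → w b ≡ true)
  (degW : ∀ v → w v ≡ true → k * k * 6 ≤ deg₂ H v + r)
  (degAdj : ∀ u v x → E H u v x ≡ true → k * k * 12 ≤ deg₂ H u + deg₂ H v + r)
  (k≪r : k * 100 ≤ r) (r≪kk : r * 1000 < k * k)
  (z : ℕ) (r≤z : r ≤ z) (z-big : k * k * (r * 25) < z * z) (z-small : z * 10000 ≤ k * k)
  (large : k * 12 < Setting.ω {k} {n} H w r legal degW degAdj k≪r r≪kk * 5)
  (m : Arr k n) (t : Fin k) (¬b : ¬ Rearrange.Better {k} {n} H m t) (inW : ∀ i → w (at m t i) ≡ true)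
  (leg : ∀ e → Setting.LegalRow {k} {n} H w r legal degW degAdj k≪r r≪kk m e) where

  open Rearrange {k} {n} H
  open Setting {k} {n} H w r legal degW degAdj k≪r r≪kk
  open ManyW large
  open Stability {k} {n} H w r legal degW degAdj k≪r r≪kk
  open Fake m t ¬b inW leg
  open TwoHoles {k} {n} H w r legal degW degAdj k≪r r≪kk m t ¬b inW leg using (not-both)

  -- At most one of the three counts reaches `z`, and `N-bound` controls that one by the other two.
  ΣN : sum₃ N * 6 ≤ z * 32
  ΣN with z ≤? N 0F | z ≤? N 1F
  ... | yes h₀ | yes h₁ = ⊥-elim (not-both (λ ()) z z-big h₀ h₁)
  ... | yes h₀ | no h₁ = hole-sum (N 0F) (N 1F) (N 2F) r z (N-bound 0F) (<⇒≤ (≰⇒> h₁)) (<⇒≤ (≰⇒> (λ h₂ → not-both (λ ()) z z-big h₀ h₂))) r≤z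
  ... | no h₀ | yes h₁ = subst (λ s → s * 6 ≤ z * 32) (proj₁ (sum₃-distinct N))
          (hole-sum (N 1F) (N 0F) (N 2F) r z (subst (λ s → N 1F * 9 ≤ s * 3 + r * 14) (sym (proj₁ (sum₃-distinct N))) (N-bound 1F)) (<⇒≤ (≰⇒> h₀)) (<⇒≤ (≰⇒> (λ h₂ → not-both (λ ()) z z-big h₁ h₂))) r≤z)
  ... | no h₀ | no h₁ = subst (λ s → s * 6 ≤ z * 32) (proj₂ (sum₃-distinct N))
          (hole-sum (N 2F) (N 0F) (N 1F) r z (subst (λ s → N 2F * 9 ≤ s * 3 + r * 14) (sym (proj₂ (sum₃-distinct N))) (N-bound 2F)) (<⇒≤ (≰⇒> h₀)) (<⇒≤ (≰⇒> h₁)) r≤z)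

  Σflaws≤ : sum₂ flaws ≤ z * 10
  Σflaws≤ = *-cancelʳ-≤ (sum₂ flaws) (z * 10) 6 (≤-trans (≤-reflexive (cong (_* 6) Σflaws)) (≤-trans (flaw-sum (sum₃ N) (sum₂ (bad m x)) k r z ΣN Σbad r≤z k≪r) (≤-reflexive (sym (*-assoc z 10 6)))))

  s : Fin k → ℕ
  s e = unmarked (tag m e)

  s-W : ∀ e → s e ≡ 1 → ∀ i → w (at m e i) ≡ true
  s-W e q i with tag m e | tag-correct m e (leg e) i
  ... | nothing | p = p

  Cols : Fin k → Fin k → Fin 3 → Set
  Cols e f v = ∀ p a b → c e f p a b ≡ not (eq b v)

  -- The centre lies in the partner `f`, so any vertex of `e` can be left over by an exchange. Both
  -- rows lie in W, as `bad-count` requires of the triple left over.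
  Source : Fin k → Set
  Source e = ∃[ f ] ∃[ v ] (s e ≡ 1 × s f ≡ 1) × (clash t t t e f ≡ 0 × Cols e f v)

  source? : ∀ e → Dec (Source e)
  source? e = Fin.any? λ f → Fin.any? λ v → ((s e ≟ 1) ×-dec (s f ≟ 1)) ×-dec ((clash t t t e f ≟ 0) ×-dec
    (Fin.all? λ p → Fin.all? λ a → Fin.all? λ b → c e f p a b Bool.≟ not (eq b v)))

  S : Fin k → ℕ
  S e = ind (does (source? e))

  idle : Fin k → ℕ
  idle e = s e ∸ S e

  s≤1 : ∀ e → s e ≤ 1
  s≤1 e with tag m e
  ... | nothing = ≤-refl
  ... | just _  = z≤n

  apart-sym : ∀ {e f} → Apart t t t e f → Apart t t t f e
  apart-sym (apart ef a b c d e f) = apart (ef ∘ sym) d e f a b c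

  apart-clash : ∀ {e f} → Apart t t t e f → clash t t t e f ≡ 0
  apart-clash (apart a b c d e f i) rewrite δ-≢ a | δ-≢ b | δ-≢ e = refl

  clash-apart : ∀ {e f} → clash t t t e f ≡ 0 → Apart t t t e f
  clash-apart {e} {f} q with clash-or-apart t t t e f
  ... | inj₂ a = a
  ... | inj₁ l = ⊥-elim (1+n≰n (subst (1 ≤_) q l))

  rows-cols : ∀ {e f v} → (∀ p a b → c e f p a b ≡ not (eq a v)) → Cols f e v
  rows-cols h p a b = trans (sym₂₃ H _ _ _) (h p b a)

  idle-s : ∀ e → 1 ≤ idle e → s e ≡ 1
  idle-s e l = ≤-antisym (s≤1 e) (≤-trans l (m∸n≤m (s e) (S e)))

  not-source : ∀ e → 1 ≤ idle e → ¬ Source e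
  not-source e l src = 1+n≰n (≤-trans l (≤-reflexive (trans (cong (s e ∸_) (ind-true (dec-true (source? e) src))) (m≤n⇒m∸n≡0 (s≤1 e)))))

  -- A flawless pair has its centre in one of its two rows; if both rows lie in W, the other one is
  -- a source.
  idle-pair : ∀ e f → idle e * idle f ≤ flaws e f
  idle-pair e f = go (idle e) (idle f) refl refl (classify e f)
    where
    absurd : 1 ≤ idle e → 1 ≤ idle f → Centred e f → ⊥
    absurd a b (centred ap (inj₂ (v , h))) = not-source e a (f , v , (idle-s e a , idle-s f b) , (apart-clash ap , h))
    absurd a b (centred ap (inj₁ (v , h))) = not-source f b (e , v , (idle-s f b , idle-s e a) , (apart-clash (apart-sym ap) , rows-cols {e} {f} {v} h))
    go : ∀ i j → i ≡ idle e → j ≡ idle f → 1 ≤ flaws e f ⊎ Centred e f → i * j ≤ flaws e f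
    go zero    j       p q _        = z≤n
    go (suc i) zero    p q _        = ≤-trans (≤-reflexive (*-zeroʳ i)) z≤n
    go (suc i) (suc j) p q (inj₁ l) = ≤-trans (*-mono-≤ (≤-trans (≤-reflexive p) (≤-trans (m∸n≤m (s e) (S e)) (s≤1 e))) (≤-trans (≤-reflexive q) (≤-trans (m∸n≤m (s f) (S f)) (s≤1 f)))) l
    go (suc i) (suc j) p q (inj₂ C) = ⊥-elim (absurd (≤-trans (s≤s z≤n) (≤-reflexive p)) (≤-trans (s≤s z≤n) (≤-reflexive q)) C)

  sources : k * 7 ≤ sum S * 30
  sources = sources-large k (sum S) (sum idle) (μ m) (μ-large m)
    (≤-trans (sum-mono (λ e → m≤n+m∸n (s e) (S e))) (≤-reflexive (sum-+ S idle)))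
    (square-cancel (square-small (sum idle) z (k * k) (≤-trans (≤-reflexive (sym (sum₂-prod idle idle))) (≤-trans (sum₂-mono idle-pair) Σflaws≤)) z-small))

  y : Fin k → Fin k → Fin 3 → Fin 3 → Fin 3 → Fin n
  y e f v a = triple (x 0F) (at m e a) (at m f v)

  -- Every triple across `t`, `e`, `f` avoiding the centre is an edge. Two disjoint ones can leave
  -- over `x 0F`, an arbitrary vertex `a` of `e` and the centre.
  tight-y : ∀ {e f v} a → Apart t t t e f → Cols e f v → Tight m (y e f v a) t e f
  tight-y {e} {f} {v} a (apart ef et _ _ ft _ _) C {g} {h} ap =
    NoPM-cong {cube m (cell m te tf ef ρ σ τ 0F) g h} same (tight-swap {m} {t} {e} {f} ¬b te tf ef ρ σ τ (hits 1F next-≢τ) (hits 2F next²-≢τ) ap)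
    where
    te = et ∘ sym
    tf = ft ∘ sym
    ρ = from 0F
    σ = from a
    τ = from v
    next-≢τ : τ ⟨$⟩ʳ 1F ≢ v
    next-≢τ q = next-≢ true v (sym (trans (sym (from-spin v 1F)) q))
    next²-≢τ : τ ⟨$⟩ʳ 2F ≢ v
    next²-≢τ q = next²-≢ true v (trans (sym (from-spin v 2F)) q)
    hits : ∀ s → τ ⟨$⟩ʳ s ≢ v → hit m te tf ef ρ σ τ s
    hits s s≢v = trans (C (ρ ⟨$⟩ʳ s) (σ ⟨$⟩ʳ s) (τ ⟨$⟩ʳ s)) (cong not (eq-≢ s≢v))
    same : ∀ i a′ b → cube m (y e f v a) g h i a′ b ≡ cube m (cell m te tf ef ρ σ τ 0F) g h i a′ b
    same 0F a′ b rewrite from-spin 0F 0F = refl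
    same 1F a′ b rewrite from-spin a 0F = refl
    same 2F a′ b rewrite from-spin v 0F = refl

  -- Marks the pairs that are bad for an exchanged triple of some vertex of `e`, or that meet the
  -- partner `f`. The partner is the one found by `source?`, hence the decision as an argument.
  β′ : ∀ {e} → Dec (Source e) → Fin k → Fin k → ℕ
  β′ {e} (yes (f , v , _)) g h = sum₃ (λ a → bad m (y e f v a) g h) + (δ g f + δ h f)
  β′ (no _) g h = 0

  β : Fin k → Fin k → Fin k → ℕ
  β e = β′ (source? e)

  Σβ : ∀ e → sum₂ (β e) ≤ r * 13
  Σβ e = go (source? e)
    where
    go : (d : Dec (Source e)) → sum₂ (β′ d) ≤ r * 13
    go (no _) = ≤-trans (≤-reflexive (trans (sum₂-const k 0) (*-zeroʳ (k * k)))) z≤n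
    go (yes (f , v , (se , sf) , (cl , C))) = ≤-trans (≤-reflexive split) (beta-sum k r (B 0F) (B 1F) (B 2F) (each 0F) (each 1F) (each 2F) k≪r)
      where
      B : Fin 3 → ℕ
      B a = sum₂ (bad m (y e f v a))
      yW : ∀ a i → w (y e f v a i) ≡ true
      yW a 0F = inW 0F
      yW a 1F = s-W e se a
      yW a 2F = s-W f sf v
      each : ∀ a → B a ≤ r * 4
      each a = bad-count m (y e f v a) (yW a) (tight-y a (clash-apart cl) C)
      split : sum₂ (λ g h → sum₃ (λ a → bad m (y e f v a) g h) + (δ g f + δ h f)) ≡ B 0F + (B 1F + B 2F) + (k + k)
      split = trans (sum₂-+ (λ g h → sum₃ (λ a → bad m (y e f v a) g h)) (λ g h → δ g f + δ h f))
        (cong₂ _+_ (sym (trans (sum₃-sum (λ a g → sum (bad m (y e f v a) g))) (sum-cong-≗ (λ g → sum₃-sum (λ a h → bad m (y e f v a) g h)))))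
          (trans (sum₂-+ (λ g h → δ g f) (λ g h → δ h f)) (cong₂ _+_ (sum₂-δˡ f) (sum₂-δʳ f))))

  -- Outside the exceptional pairs, every vertex of a source row has the same link
  -- as x 0F between the rows g and h.
  Info : Fin k → Fin k → Fin k → Set
  Info e g h = ∀ a b d → E H (at m e a) (at m g b) (at m h d) ≡ c g h 0F b d

  six : ∀ {g h} → Centred g h → cnt (c g h 0F) ≡ 6
  six (centred _ (inj₁ (v , q))) = trans (cnt-cong (q 0F)) (cnt-rows v)
  six (centred _ (inj₂ (v , q))) = trans (cnt-cong (q 0F)) (cnt-cols v)

  -- `x 0F` has six triples between `g` and `h`, neither none nor nine. So the centre of the
  -- exchanged triple is in `g` or `h`, and then its three vertices have equal links.
  info : ∀ {e g h} → 1 ≤ S e → Centred g h → e ≢ g → e ≢ h → β e g h ≡ 0 → Info e g h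
  info {e} {g} {h} Se C eg eh = go (source? e) (1≤ind Se)
    where
    go : (d : Dec (Source e)) → does d ≡ true → β′ d g h ≡ 0 → Info e g h
    go (yes (f , v , _ , (cl , Co))) _ q a b d = link (shape (cube m (y e f v a) g h) (tight-y a (clash-apart cl) Co ap) (exact m (y e f v a) g h (b0 a)))
      where
      δ0 : ∀ {a b : Fin k} → δ a b ≡ 0 → a ≢ b
      δ0 {a} z refl = 1+n≢0 (trans (sym (δ-refl a)) z)
      bads : sum₃ (λ a → bad m (y e f v a) g h) ≡ 0
      bads = m+n≡0⇒m≡0 _ q
      deltas : δ g f + δ h f ≡ 0
      deltas = m+n≡0⇒n≡0 (sum₃ (λ a → bad m (y e f v a) g h)) q
      b0 : ∀ a → bad m (y e f v a) g h ≡ 0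
      b0 0F = m+n≡0⇒m≡0 _ bads
      b0 1F = m+n≡0⇒m≡0 _ (m+n≡0⇒n≡0 (bad m (y e f v 0F) g h) bads)
      b0 2F = m+n≡0⇒n≡0 (bad m (y e f v 1F) g h) (m+n≡0⇒n≡0 (bad m (y e f v 0F) g h) bads)
      ap : Apart t e f g h
      ap = apart (Apart.gh (Centred.away C)) (Apart.g₁ (Centred.away C)) (eg ∘ sym) (δ0 (m+n≡0⇒m≡0 _ deltas))
                 (Apart.h₁ (Centred.away C)) (eh ∘ sym) (δ0 (m+n≡0⇒n≡0 (δ g f) deltas))
      link : Shape (cube m (y e f v a) g h) → E H (at m e a) (at m g b) (at m h d) ≡ c g h 0F b d
      link (rows v l) = trans (l 1F b d) (sym (l 0F b d))
      link (cols v l) = trans (l 1F b d) (sym (l 0F b d))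
      link (hole 0F none _) = ⊥-elim (6≢0 (trans (sym (six C)) none))
        where
        6≢0 : 6 ≢ 0
        6≢0 ()
      link (hole 1F _ full) = ⊥-elim (6≢9 (trans (sym (six C)) (full 0F (λ ()))))
        where
        6≢9 : 6 ≢ 9
        6≢9 ()
      link (hole 2F _ full) = ⊥-elim (6≢9 (trans (sym (six C)) (full 0F (λ ()))))
        where
        6≢9 : 6 ≢ 9
        6≢9 ()

  -- A link on (g , h) that is also one on (e , g) and one on (e , h) is constant.
  clash-of-links : ∀ {e g h} → Centred g h → Info e g h → Info g e h → Info h e g → ⊥
  clash-of-links {e} {g} {h} C I J K = nonconst C (λ b d → trans (shift b d) (trans (dfree 0F d) (sym (dfree 0F 0F))))
    where
    L : Fin 3 → Fin 3 → Bool
    L b d = c g h 0F b d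
    -- The same edge seen from `h`: by `K` the link between `e` and `g` is common to all vertices of
    -- `h`, so `d` does not matter. Likewise `J` removes the dependence on `b`.
    dfree : ∀ b d → L b d ≡ c e g 0F 0F b
    dfree b d = trans (sym (I 0F b d)) (trans (trans (sym₂₃ H _ _ _) (sym₁₂ H _ _ _)) (K d 0F b))
    bfree : ∀ b d → L b d ≡ c e h 0F 0F d
    bfree b d = trans (sym (I 0F b d)) (trans (sym₁₂ H _ _ _) (J b 0F d))
    shift : ∀ b d → L b d ≡ L 0F d
    shift b d = trans (bfree b d) (sym (bfree 0F d))
    nonconst : Centred g h → (∀ b d → L b d ≡ L 0F 0F) → ⊥
    nonconst (centred _ (inj₁ (v , q))) h = true≢false
      (trans (sym (h (next true v) 0F)) (trans (q 0F (next true v) 0F) (cong not (eq-≢ (next-≢ true v ∘ sym)))))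
      (trans (sym (h v 0F)) (trans (q 0F v 0F) (cong not (eq-refl v))))
    nonconst (centred _ (inj₂ (v , q))) h = true≢false
      (trans (sym (h 0F (next true v))) (trans (q 0F 0F (next true v)) (cong not (eq-≢ (next-≢ true v ∘ sym)))))
      (trans (sym (h 0F v)) (trans (q 0F 0F v) (cong not (eq-refl v))))

  bound : Fin k → Fin k → Fin k → ℕ
  bound e g h = (flaws e g + (flaws e h + flaws g h)) + (β e g h + (β g e h + β h e g))

  triples : ∀ e g h → S e * (S g * S h) ≤ bound e g h
  triples e g h = go (S e) (S g) (S h) refl refl refl (classify e g) (classify e h) (classify g h) (0-or-1≤ (β e g h)) (0-or-1≤ (β g e h)) (0-or-1≤ (β h e g))
    where
    Fl Be : ℕ
    Fl = flaws e g + (flaws e h + flaws g h)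
    Be = β e g h + (β g e h + β h e g)
    flawed : 1 ≤ Fl → 1 ≤ bound e g h
    flawed l = ≤-trans l (m≤m+n Fl Be)
    exceptional : 1 ≤ Be → 1 ≤ bound e g h
    exceptional l = ≤-trans l (m≤n+m Be Fl)
    S≤1 : ∀ e {i} → i ≡ S e → i ≤ 1
    S≤1 e p = ≤-trans (≤-reflexive p) (ind≤1 (does (source? e)))
    positive : ∀ e {i} → suc i ≡ S e → 1 ≤ S e
    positive e p = ≤-trans (s≤s z≤n) (≤-reflexive p)
    small : ∀ {i j l} → i ≡ S e → j ≡ S g → l ≡ S h → 1 ≤ bound e g h → i * (j * l) ≤ bound e g h
    small p q o = ≤-trans (*-mono-≤ (S≤1 e p) (*-mono-≤ (S≤1 g q) (S≤1 h o)))
    go : ∀ i j l → i ≡ S e → j ≡ S g → l ≡ S h → 1 ≤ flaws e g ⊎ Centred e g → 1 ≤ flaws e h ⊎ Centred e h → 1 ≤ flaws g h ⊎ Centred g h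
      → β e g h ≡ 0 ⊎ 1 ≤ β e g h → β g e h ≡ 0 ⊎ 1 ≤ β g e h → β h e g ≡ 0 ⊎ 1 ≤ β h e g → i * (j * l) ≤ bound e g h
    go zero j l p q o _ _ _ _ _ _ = z≤n
    go (suc i) zero l p q o _ _ _ _ _ _ = ≤-trans (≤-reflexive (*-zeroʳ i)) z≤n
    go (suc i) (suc j) zero p q o _ _ _ _ _ _ = ≤-trans (≤-reflexive (trans (cong (suc i *_) (*-zeroʳ j)) (*-zeroʳ i))) z≤n
    go (suc i) (suc j) (suc l) p q o (inj₁ d) _ _ _ _ _ = small p q o (flawed (≤-trans d (m≤m+n (flaws e g) (flaws e h + flaws g h))))
    go (suc i) (suc j) (suc l) p q o _ (inj₁ d) _ _ _ _ = small p q o (flawed (≤-trans d (≤-trans (m≤m+n (flaws e h) (flaws g h)) (m≤n+m (flaws e h + flaws g h) (flaws e g)))))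
    go (suc i) (suc j) (suc l) p q o _ _ (inj₁ d) _ _ _ = small p q o (flawed (≤-trans d (≤-trans (m≤n+m (flaws g h) (flaws e h)) (m≤n+m (flaws e h + flaws g h) (flaws e g)))))
    go (suc i) (suc j) (suc l) p q o _ _ _ (inj₂ d) _ _ = small p q o (exceptional (≤-trans d (m≤m+n (β e g h) (β g e h + β h e g))))
    go (suc i) (suc j) (suc l) p q o _ _ _ _ (inj₂ d) _ = small p q o (exceptional (≤-trans d (≤-trans (m≤m+n (β g e h) (β h e g)) (m≤n+m (β g e h + β h e g) (β e g h)))))
    go (suc i) (suc j) (suc l) p q o _ _ _ _ _ (inj₂ d) = small p q o (exceptional (≤-trans d (≤-trans (m≤n+m (β h e g) (β g e h)) (m≤n+m (β g e h + β h e g) (β e g h)))))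
    go (suc i) (suc j) (suc l) p q o (inj₂ Ceg) (inj₂ Ceh) (inj₂ Cgh) (inj₁ b₁) (inj₁ b₂) (inj₁ b₃) =
      ⊥-elim (clash-of-links Cgh (info (positive e p) Cgh eg eh b₁) (info (positive g q) Ceh (eg ∘ sym) gh b₂) (info (positive h o) Ceg (eh ∘ sym) (gh ∘ sym) b₃))
      where
      eg = Apart.gh (Centred.away Ceg)
      eh = Apart.gh (Centred.away Ceh)
      gh = Apart.gh (Centred.away Cgh)

  sum₃ₖ : (Fin k → Fin k → Fin k → ℕ) → ℕ
  sum₃ₖ F = sum (λ e → sum₂ (F e))

  sum₃ₖ-+ : ∀ F G → sum₃ₖ (λ e g h → F e g h + G e g h) ≡ sum₃ₖ F + sum₃ₖ G
  sum₃ₖ-+ F G = trans (sum-cong-≗ (λ e → sum₂-+ (F e) (G e))) (sum-+ (λ e → sum₂ (F e)) (λ e → sum₂ (G e)))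

  -- 69 = 3 · 10 + 3 · 13, once `r` is replaced by `z`.
  Σtriples : sum S * (sum S * sum S) ≤ k * (z * 69)
  Σtriples = begin
    sum S * (sum S * sum S) ≡⟨ sym (trans (sum-cong-≗ (λ e → trans (sum₂-* (S e) (λ g h → S g * S h)) (cong (S e *_) (sum₂-prod S S)))) (sum-*ʳ (sum S * sum S) S)) ⟩
    sum₃ₖ (λ e g h → S e * (S g * S h)) ≤⟨ sum-mono (λ e → sum₂-mono (triples e)) ⟩
    sum₃ₖ bound ≡⟨ trans (sum₃ₖ-+ (λ e g h → flaws e g + (flaws e h + flaws g h)) (λ e g h → β e g h + (β g e h + β h e g)))
                    (cong₂ _+_ (trans (sum₃ₖ-+ (λ e g h → flaws e g) (λ e g h → flaws e h + flaws g h)) (cong (sum₃ₖ (λ e g h → flaws e g) +_) (sum₃ₖ-+ (λ e g h → flaws e h) (λ e g h → flaws g h))))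
                               (trans (sum₃ₖ-+ (λ e g h → β e g h) (λ e g h → β g e h + β h e g)) (cong (sum₃ₖ β +_) (sum₃ₖ-+ (λ e g h → β g e h) (λ e g h → β h e g))))) ⟩
    (sum₃ₖ (λ e g h → flaws e g) + (sum₃ₖ (λ e g h → flaws e h) + sum₃ₖ (λ e g h → flaws g h))) + (sum₃ₖ β + (sum₃ₖ (λ e g h → β g e h) + sum₃ₖ (λ e g h → β h e g)))
      ≤⟨ +-mono-≤ (+-mono-≤ f₁ (+-mono-≤ f₂ f₃)) (+-mono-≤ g₁ (+-mono-≤ g₂ g₃)) ⟩
    (k * (z * 10) + (k * (z * 10) + k * (z * 10))) + (k * (r * 13) + (k * (r * 13) + k * (r * 13))) ≤⟨ +-monoʳ-≤ (k * (z * 10) + (k * (z * 10) + k * (z * 10))) (+-mono-≤ rz (+-mono-≤ rz rz)) ⟩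
    (k * (z * 10) + (k * (z * 10) + k * (z * 10))) + (k * (z * 13) + (k * (z * 13) + k * (z * 13))) ≡⟨ collect k z ⟩
    k * (z * 69) ∎
    where
    open ≤-Reasoning
    collect : ∀ k z → (k * (z * 10) + (k * (z * 10) + k * (z * 10))) + (k * (z * 13) + (k * (z * 13) + k * (z * 13))) ≡ k * (z * 69)
    collect = solve-∀
    rz : k * (r * 13) ≤ k * (z * 13)
    rz = *-monoʳ-≤ k (*-monoˡ-≤ 13 r≤z)
    F : ℕ
    F = sum₂ flaws
    each : k * F ≤ k * (z * 10)
    each = *-monoʳ-≤ k Σflaws≤
    f₁ : sum₃ₖ (λ e g h → flaws e g) ≤ k * (z * 10)
    f₁ = ≤-trans (≤-reflexive (trans (sum-cong-≗ (λ e → sum₂-fst (flaws e))) (sum-* k (λ e → sum (flaws e))))) each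
    f₂ : sum₃ₖ (λ e g h → flaws e h) ≤ k * (z * 10)
    f₂ = ≤-trans (≤-reflexive (trans (sum-cong-≗ (λ e → sum₂-snd (flaws e))) (sum-* k (λ e → sum (flaws e))))) each
    f₃ : sum₃ₖ (λ e g h → flaws g h) ≤ k * (z * 10)
    f₃ = ≤-trans (≤-reflexive (sum-const k F)) each
    βs : sum (λ e → sum₂ (β e)) ≤ k * (r * 13)
    βs = ≤-trans (sum-mono Σβ) (≤-reflexive (sum-const k (r * 13)))
    g₁ : sum₃ₖ β ≤ k * (r * 13)
    g₁ = βs
    g₂ : sum₃ₖ (λ e g h → β g e h) ≤ k * (r * 13)
    g₂ = ≤-trans (≤-reflexive (sum-comm (λ e g → sum (λ h → β g e h)))) βs
    g₃ : sum₃ₖ (λ e g h → β h e g) ≤ k * (r * 13)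
    g₃ = ≤-trans (≤-reflexive (trans (sum-cong-≗ (λ e → sum₂-swap (λ g h → β h e g))) (sum-comm (λ e h → sum (λ g → β h e g))))) βs

  impossible : ⊥
  impossible = triple-⊥ k (sum S * (sum S * sum S)) z Σtriples
    (≤-trans (≤-reflexive (l₁ k)) (≤-trans (*-mono-≤ sources (*-mono-≤ sources sources)) (≤-reflexive (l₂ (sum S)))))
    (*-monoʳ-≤ k z-small) (cube-pos t)
    where
    l₁ : ∀ k → k * k * k * 343 ≡ (k * 7) * ((k * 7) * (k * 7))
    l₁ = solve-∀
    l₂ : ∀ a → (a * 30) * ((a * 30) * (a * 30)) ≡ a * (a * a) * 27000
    l₂ = solve-∀

-- Existence of a perfect matching

neighbour-⊥ : ∀ K x v s r → K * 12 ≤ x + v + r → v ≤ K * 9 → x ≤ s * s → s * s ≤ K → r * 1000 < K → ⊥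
neighbour-⊥ K x v s r h0 h1 h2 h3 h4 = contra-≤ (K + r * 999) (+-mono-≤ h0 (+-mono-≤ h1 (+-mono-≤ h2 (+-mono-≤ h3 h4)))) (identity K x v s r)
  where
  identity : ∀ K x v s r → (K * 12) + ((v) + ((x) + ((s * s) + ((suc (r * 1000)))))) ≡ ((x + v + r) + ((K * 9) + ((s * s) + ((K) + ((K)))))) + suc (K + r * 999)
  identity = solve-∀

outer-⊥ : ∀ k ω s → k * 2 ≤ ω → ω ≤ s → s < k * 2 → ⊥
outer-⊥ k ω s h0 h1 h2 = contra-≤ (0) (+-mono-≤ h0 (+-mono-≤ h1 h2)) (identity k ω s)
  where
  identity : ∀ k ω s → (k * 2) + ((ω) + ((suc (s)))) ≡ ((ω) + ((s) + ((k * 2)))) + suc (0)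
  identity = solve-∀

identity-arr : ∀ k → Arr k (3 * k)
identity-arr k = record
  { at     = λ e i → combine i e
  ; pos    = λ v → proj₂ (remQuot {3} k v) , proj₁ (remQuot {3} k v)
  ; at-pos = λ v → Fin.combine-remQuot {3} k v
  ; pos-at = λ e i → cong (λ p → proj₂ p , proj₁ p) (Fin.remQuot-combine i e)
  }

module Existence {k n : ℕ} (H : Hypergraph3 n) (w : Fin n → Bool) (r : ℕ)
  (legal : ∀ a b c → E H a b c ≡ true → w a ≡ false → w b ≡ true)
  (degW : ∀ v → w v ≡ true → k * k * 6 ≤ deg₂ H v + r)
  (degAdj : ∀ u v x → E H u v x ≡ true → k * k * 12 ≤ deg₂ H u + deg₂ H v + r)
  (k≪r : k * 100 ≤ r) (r≪kk : r * 1000 < k * k)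
  (z : ℕ) (r≤z : r ≤ z) (z-big : k * k * (r * 25) < z * z) (z-small : z * 10000 ≤ k * k)
  (nonisolated : ∀ u → ∃[ v ] ∃[ x ] E H u v x ≡ true) (deg≤ : ∀ v → deg₂ H v ≤ k * k * 9)
  (manyW : k * 2 ≤ sum (λ v → ind (w v))) where

  open Rearrange {k} {n} H
  open Setting {k} {n} H w r legal degW degAdj k≪r r≪kk

  -- A vertex outside W stands only in position 0, with a neighbour beside it, so that a fake row
  -- containing it offers the degree sum of an adjacent pair.
  Good : Arr k n → Fin k → Set
  Good m e = w (at m e 1F) ≡ true × w (at m e 2F) ≡ true × (w (at m e 0F) ≡ true ⊎ ∃[ x ] E H (at m e 0F) (at m e 1F) x ≡ true)

  Good-same : ∀ {m m′ e} → Same m m′ e → Good m e → Good m′ e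
  Good-same s (a , b , c) rewrite s 0F | s 1F | s 2F = a , b , c

  good-legal : ∀ m e → Real m e ⊎ Good m e → LegalRow m e
  good-legal m e (inj₁ re)          = real-legal m e re
  good-legal m e (inj₂ (a , b , _)) = (λ _ → a) , (λ _ → b) , (λ _ → b)

  -- A fake row inside W weighs less than one meeting the complement, so trading the second kind for
  -- the first is progress.
  φ₃ : Bool → Bool → ℕ
  φ₃ true  _     = 0
  φ₃ false true  = 1
  φ₃ false false = 2

  φ : Arr k n → Fin k → ℕ
  φ m e = φ₃ (E H (at m e 0F) (at m e 1F) (at m e 2F)) (w (at m e 0F))

  φ-real : ∀ m e → Real m e → φ m e ≡ 0
  φ-real m e re rewrite re = refl

  φ-same : ∀ {m m′ e} → Same m m′ e → φ m′ e ≡ φ m e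
  φ-same s rewrite s 0F | s 1F | s 2F = refl

  φ-step : ∀ {m m′ t} → Step m t m′ → φ m′ t < φ m t → sum (φ m′) < sum (φ m)
  φ-step {m} {m′} {t} st lt = sum-mono-< pointwise t lt
    where
    pointwise : ∀ e → φ m′ e ≤ φ m e
    pointwise e with e Fin.≟ t
    ... | yes refl = <⇒≤ lt
    ... | no e≢t with st e e≢t
    ...   | inj₁ re = ≤-trans (≤-reflexive (φ-real m′ e re)) z≤n
    ...   | inj₂ s  = ≤-reflexive (φ-same {m} {m′} {e} s)

  Perfect : Set
  Perfect = ∃[ m ] ∀ e → Real m e

  -- Induction on the potential with `bound` as fuel. The conclusion being `⊥`, a hypothetical
  -- improvement is refuted by the recursive call, which yields `¬b` and `¬bW` without deciding
  -- anything.
  improve : ¬ Perfect → ∀ bound m → (∀ e → Real m e ⊎ Good m e) → sum (φ m) < bound → ⊥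
  improve ¬pm (suc bound) m good (s≤s lt) = search (Fin.any? (λ t → E H (at m t 0F) (at m t 1F) (at m t 2F) Bool.≟ false))
    where
    search : Dec (∃[ t ] E H (at m t 0F) (at m t 1F) (at m t 2F) ≡ false) → ⊥
    search (no ¬t) = ¬pm (m , λ e → bool-case (E H (at m e 0F) (at m e 1F) (at m e 2F)) (λ p → p) (λ p → ⊥-elim (¬t (e , p))))
    search (yes (t , fake)) = attack (good t)
      where
      step-good : ∀ {m′} → Step m t m′ → Real m′ t ⊎ Good m′ t → ∀ e → Real m′ e ⊎ Good m′ e
      step-good {m′} st gt e with e Fin.≟ t
      ... | yes refl = gt
      ... | no e≢t with st e e≢t | good e
      ...   | inj₁ re | _       = inj₁ re
      ...   | inj₂ s  | inj₁ re = inj₁ (Real-same {m} {m′} {e} s re)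
      ...   | inj₂ s  | inj₂ g  = inj₂ (Good-same {m} {m′} {e} s g)
      φ₃-fake : ∀ b → 1 ≤ φ₃ false b
      φ₃-fake true  = ≤-refl
      φ₃-fake false = s≤s z≤n
      φ-fake : 1 ≤ φ m t
      φ-fake rewrite fake = φ₃-fake _
      ¬b : ¬ Better m t
      ¬b (m′ , st , re) = improve ¬pm bound m′ (step-good {m′} st (inj₁ re))
        (≤-trans (φ-step {m} {m′} {t} st (≤-trans (≤-reflexive (cong suc (φ-real m′ t re))) φ-fake)) lt)
      ¬bW : w (at m t 0F) ≡ false → ¬ BetterW m t
      ¬bW w₀ (m′ , st , aw) = improve ¬pm bound m′ (step-good {m′} st (inj₂ (aw 1F , aw 2F , inj₁ (aw 0F)))) (≤-trans (φ-step {m} {m′} {t} st drop) lt)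
        where
        φ₃-W : ∀ b → φ₃ b true ≤ 1
        φ₃-W true  = z≤n
        φ₃-W false = ≤-refl
        drop : φ m′ t < φ m t
        drop rewrite fake | w₀ | aw 0F = s≤s (φ₃-W _)
      leg : ∀ e → LegalRow m e
      leg e = good-legal m e (good e)
      attack : Real m t ⊎ Good m t → ⊥
      attack (inj₁ re) = true≢false re fake
      attack (inj₂ (w₁ , w₂ , c)) with ω * 5 ≤? k * 12
      ... | yes few = FewW.no-fake few m t ¬b w₁ w₂ c
      ... | no ¬few = bool-case (w (at m t 0F))
              (λ w₀ → Centres.impossible {k} {n} H w r legal degW degAdj k≪r r≪kk z r≤z z-big z-small (≰⇒> ¬few) m t ¬b (inW w₀) leg)
              (λ w₀ → ManyW.no-fakeU (≰⇒> ¬few) m t leg (¬bW w₀) w₀ w₂ (adjacent w₀ c))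
        where
        inW : w (at m t 0F) ≡ true → ∀ i → w (at m t i) ≡ true
        inW w₀ 0F = w₀
        inW w₀ 1F = w₁
        inW w₀ 2F = w₂
        adjacent : w (at m t 0F) ≡ false → w (at m t 0F) ≡ true ⊎ ∃[ x ] E H (at m t 0F) (at m t 1F) x ≡ true → ∃[ x ] E H (at m t 0F) (at m t 1F) x ≡ true
        adjacent w₀ (inj₁ p) = ⊥-elim (true≢false p w₀)
        adjacent w₀ (inj₂ p) = p

  -- The initial arrangement

  Inner : Arr k n → Set
  Inner m = ∀ e → w (at m e 1F) ≡ true × w (at m e 2F) ≡ true

  front : Arr k n → ℕ
  front m = sum (λ e → ind (w (at m e 0F)))

  -- Each exchange moves a vertex of W out of position 0 and lowers `front`. If position 0 has none
  -- left, W lies in the other 2k positions, one of which holds a vertex outside W, against `manyW`.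
  inner-from : ∀ bound m → front m < bound → ∃[ m′ ] Inner m′
  inner-from (suc bound) m (s≤s lt) = go (Fin.any? (λ e → w (at m e 1F) Bool.≟ false)) (Fin.any? (λ e → w (at m e 2F) Bool.≟ false))
    where
    fix : ∀ e i → i ≢ 0F → w (at m e i) ≡ false → ∃[ m′ ] Inner m′
    fix e i i≢0 we = use (Fin.any? (λ f → w (at m f 0F) Bool.≟ true))
      where
      use : Dec (∃[ f ] w (at m f 0F) ≡ true) → ∃[ m′ ] Inner m′
      use (yes (f , wf)) with exchange m (f , 0F) (e , i)
      ... | m′ , p , q , out = inner-from bound m′ (≤-trans (sum-mono-< pointwise f strict) lt)
        where
        strict : ind (w (at m′ f 0F)) < ind (w (at m f 0F))
        strict rewrite p | we | wf = ≤-refl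
        pointwise : ∀ g → ind (w (at m′ g 0F)) ≤ ind (w (at m g 0F))
        pointwise g with g Fin.≟ f
        ... | yes refl = <⇒≤ strict
        ... | no g≢f = ≤-reflexive (cong (ind ∘ w) (out g 0F (g≢f ∘ cong proj₁) (i≢0 ∘ sym ∘ cong proj₂)))
      use (no ¬f) = ⊥-elim (outer-⊥ k ω (sum rest) manyW (≤-trans (≤-reflexive (sum-at m (λ v → ind (w v)))) (sum-mono bound₂))
          (≤-trans (sum-mono-< rest≤ e (strict i i≢0 we)) (≤-reflexive (sum-const k 2))))
        where
        rest : Fin k → ℕ
        rest g = ind (w (at m g 1F)) + ind (w (at m g 2F))
        rest≤ : ∀ g → rest g ≤ 2
        rest≤ g = +-mono-≤ (ind≤1 (w (at m g 1F))) (ind≤1 (w (at m g 2F)))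
        bound₂ : ∀ g → sum₃ (λ i → ind (w (at m g i))) ≤ rest g
        bound₂ g = ≤-reflexive (cong (_+ rest g) (ind-false (bool-case (w (at m g 0F)) (λ p → ⊥-elim (¬f (g , p))) (λ p → p))))
        strict : ∀ i → i ≢ 0F → w (at m e i) ≡ false → rest e < 2
        strict 0F i≢0 _  = ⊥-elim (i≢0 refl)
        strict 1F _   we = ≤-trans (≤-reflexive (cong (λ b → suc (ind b + ind (w (at m e 2F)))) we)) (s≤s (ind≤1 (w (at m e 2F))))
        strict 2F _   we = ≤-trans (≤-reflexive (trans (cong (λ b → suc (ind (w (at m e 1F)) + ind b)) we) (cong suc (+-identityʳ _)))) (s≤s (ind≤1 (w (at m e 1F))))
    go : Dec (∃[ e ] w (at m e 1F) ≡ false) → Dec (∃[ e ] w (at m e 2F) ≡ false) → ∃[ m′ ] Inner m′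
    go (yes (e , p)) _ = fix e 1F (λ ()) p
    go (no _) (yes (e , p)) = fix e 2F (λ ()) p
    go (no ¬1) (no ¬2) = m , λ e → bool-case (w (at m e 1F)) (λ p → p) (λ p → ⊥-elim (¬1 (e , p))) , bool-case (w (at m e 2F)) (λ p → p) (λ p → ⊥-elim (¬2 (e , p)))

  nb? : ∀ u v → Dec (∃[ x ] E H u v x ≡ true)
  nb? u v = Fin.any? (λ x → E H u v x Bool.≟ true)

  nb : Fin n → Fin n → Bool
  nb u v = does (nb? u v)

  nb-true : ∀ {u v} → nb u v ≡ true → ∃[ x ] E H u v x ≡ true
  nb-true {u} {v} p = go (nb? u v) p
    where
    go : (d : Dec (∃[ x ] E H u v x ≡ true)) → does d ≡ true → ∃[ x ] E H u v x ≡ true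
    go (yes q) _ = q

  nb-edge : ∀ {u v} x → E H u v x ≡ true → nb u v ≡ true
  nb-edge {u} {v} x e = dec-true (nb? u v) (x , e)

  -- A neighbour accounts for at most 9k² of the degree sum, so about 3k² remain for `u`, whose link
  -- is at most the square of its number of neighbours.
  many-nb : ∀ u → ¬ (sum (λ v → ind (nb u v)) ≤ k)
  many-nb u small with nonisolated u
  ... | v , x , e = neighbour-⊥ (k * k) (deg₂ H u) (deg₂ H v) (sum (λ v → ind (nb u v))) r (degAdj u v x e) (deg≤ v) link (*-mono-≤ small small) r≪kk
    where
    link : deg₂ H u ≤ sum (λ v → ind (nb u v)) * sum (λ v → ind (nb u v))
    link = ≤-trans (sum₂-mono pointwise) (≤-reflexive (sum₂-prod (λ a → ind (nb u a)) (λ a → ind (nb u a))))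
      where
      pointwise : ∀ a b → ind (E H u a b) ≤ ind (nb u a) * ind (nb u b)
      pointwise a b = bool-case (E H u a b)
        (λ p → ≤-trans (≤-reflexive (ind-true p)) (≤-reflexive (sym (cong₂ _*_ (ind-true (nb-edge b p)) (ind-true (nb-edge a (trans (sym (sym₂₃ H u a b)) p)))))))
        (λ p → ≤-trans (≤-reflexive (ind-false p)) z≤n)

  lonely : Arr k n → Fin k → ℕ
  lonely m e = ind (not (w (at m e 0F) ∨ nb (at m e 0F) (at m e 1F)))

  -- More than k neighbours of `u` cannot all stand in position 1. One in position 0 or 2 is
  -- exchanged with the vertex beside `u`; both lie in W, and no other row changes in position 1, so
  -- no other row becomes lonely.
  good-from : ∀ bound m → Inner m → sum (lonely m) < bound → ∃[ m′ ] ∀ e → Good m′ e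
  good-from (suc bound) m inner (s≤s lt) = go (Fin.any? (λ e → (w (at m e 0F) Bool.≟ false) ×-dec (nb (at m e 0F) (at m e 1F) Bool.≟ false)))
    where
    go : Dec (∃[ e ] w (at m e 0F) ≡ false × nb (at m e 0F) (at m e 1F) ≡ false) → ∃[ m′ ] ∀ e → Good m′ e
    go (no ¬e) = m , λ e → proj₁ (inner e) , proj₂ (inner e) , bool-case (w (at m e 0F)) inj₁
      (λ p → bool-case (nb (at m e 0F) (at m e 1F)) (λ q → inj₂ (nb-true q)) (λ q → ⊥-elim (¬e (e , p , q))))
    go (yes (e , we , ne)) = use (Fin.any? (λ f → nb u (at m f 0F) Bool.≟ true)) (Fin.any? (λ f → nb u (at m f 2F) Bool.≟ true))
      where
      u = at m e 0F
      place : ∀ f i → i ≢ 1F → nb u (at m f i) ≡ true → ∃[ m′ ] ∀ e → Good m′ e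
      place f i i≢1 nf with exchange m (e , 1F) (f , i)
      ... | m′ , p , q , out = good-from bound m′ inner′ (≤-trans (sum-mono-< pointwise e strict) lt)
        where
        vW : w (at m f i) ≡ true
        vW = legal _ _ _ (proj₂ (nb-true nf)) we
        back : w (at m′ f i) ≡ true
        back = trans (cong w q) (proj₁ (inner e))
        still : ∀ g j → w (at m g j) ≡ true → w (at m′ g j) ≡ true
        still g j wg with g Fin.≟ e | j Fin.≟ 1F | g Fin.≟ f | j Fin.≟ i
        ... | yes refl | yes refl | _ | _ = trans (cong w p) vW
        ... | _ | _ | yes refl | yes refl = back
        ... | no ge | _ | no gf | _ = trans (cong w (out g j (ge ∘ cong proj₁) (gf ∘ cong proj₁))) wg
        ... | no ge | _ | _ | no ji = trans (cong w (out g j (ge ∘ cong proj₁) (ji ∘ cong proj₂))) wg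
        ... | _ | no j1 | no gf | _ = trans (cong w (out g j (j1 ∘ cong proj₂) (gf ∘ cong proj₁))) wg
        ... | _ | no j1 | _ | no ji = trans (cong w (out g j (j1 ∘ cong proj₂) (ji ∘ cong proj₂))) wg
        inner′ : Inner m′
        inner′ g = still g 1F (proj₁ (inner g)) , still g 2F (proj₂ (inner g))
        e≢ : ¬ ((e , 0F) ≡ (f , i))
        e≢ refl = irreflexive (nb-true nf)
          where
          irreflexive : ¬ (∃[ x ] E H (at m e 0F) (at m e 0F) x ≡ true)
          irreflexive (x , ed) = proj₁ (distinct H _ _ _ ed) refl
        head-same : at m′ e 0F ≡ at m e 0F
        head-same = out e 0F (λ ()) e≢
        strict : lonely m′ e < lonely m e
        strict rewrite head-same | p | we | ne | nf = ≤-refl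
        pointwise : ∀ g → lonely m′ g ≤ lonely m g
        pointwise g with g Fin.≟ e
        ... | yes refl = <⇒≤ strict
        ... | no g≢e with w (at m g 0F) in wg
        ...   | true rewrite still g 0F wg = z≤n
        ...   | false rewrite out g 1F (g≢e ∘ cong proj₁) (i≢1 ∘ sym ∘ cong proj₂) | out g 0F (g≢e ∘ cong proj₁) (λ r → true≢false (trans (cong (λ y → w (at m (proj₁ y) (proj₂ y))) r) vW) wg) | wg = ≤-refl
      use : Dec (∃[ f ] nb u (at m f 0F) ≡ true) → Dec (∃[ f ] nb u (at m f 2F) ≡ true) → ∃[ m′ ] ∀ e → Good m′ e
      use (yes (f , p)) _ = place f 0F (λ ()) p
      use (no _) (yes (f , p)) = place f 2F (λ ()) p
      use (no ¬0) (no ¬2) = ⊥-elim (many-nb u (≤-trans (≤-reflexive (sum-at m (λ v → ind (nb u v)))) (≤-trans (sum-mono each) (≤-reflexive (trans (sum-const k 1) (*-identityʳ k))))))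
        where
        off : ∀ {i} → ¬ (∃[ f ] nb u (at m f i) ≡ true) → ∀ f → ind (nb u (at m f i)) ≡ 0
        off ¬p f = ind-false (bool-case (nb u (at m f _)) (λ p → ⊥-elim (¬p (f , p))) (λ p → p))
        each : ∀ f → sum₃ (λ i → ind (nb u (at m f i))) ≤ 1
        each f = ≤-trans (≤-reflexive (cong₂ (λ a b → a + (ind (nb u (at m f 1F)) + b)) (off ¬0 f) (off ¬2 f))) (≤-trans (≤-reflexive (+-identityʳ _)) (ind≤1 (nb u (at m f 1F))))

  perfect : Arr k n → ¬ ¬ Perfect
  perfect m₀ ¬pm with inner-from (suc (front m₀)) m₀ ≤-refl
  ... | m₁ , inner with good-from (suc (sum (lonely m₁))) m₁ inner ≤-refl
  ...   | m₂ , good = improve ¬pm (suc (sum (φ m₂))) m₂ (λ e → inj₂ (good e)) ≤-refl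

open import Data.Integer using (+_; -[1+_])
import Data.Integer as ℤ
import Data.Integer.Properties as ℤ
import Data.Integer.Tactic.RingSolver as ℤ-Solver
open import Data.Rational using (ℚ; 0ℚ; toℚᵘ)
import Data.Rational as ℚ
import Data.Rational.Properties as ℚ
open import Data.Rational.Unnormalised using (mkℚᵘ; *<*)
import Data.Rational.Unnormalised as ℚᵘ
import Data.Rational.Unnormalised.Properties as ℚᵘ

-- Degrees, lists and rational numbers

lsum : ∀ {A : Set} → (A → ℕ) → List A → ℕ
lsum f []       = 0
lsum f (x ∷ xs) = f x + lsum f xs

length-filter-T : ∀ {A : Set} (q : A → Bool) xs → length (filter (λ p → T? (q p)) xs) ≡ lsum (λ x → ind (q x)) xs
length-filter-T q []       = refl
length-filter-T q (x ∷ xs) with q x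
... | true  = cong suc (length-filter-T q xs)
... | false = length-filter-T q xs

lsum-++ : ∀ {A : Set} (f : A → ℕ) xs ys → lsum f (xs ++ ys) ≡ lsum f xs + lsum f ys
lsum-++ f []       ys = refl
lsum-++ f (x ∷ xs) ys = trans (cong (_+_ (f x)) (lsum-++ f xs ys)) (sym (+-assoc (f x) _ _))

lsum-map : ∀ {A B : Set} (f : B → ℕ) (g : A → B) xs → lsum f (map g xs) ≡ lsum (λ x → f (g x)) xs
lsum-map f g []       = refl
lsum-map f g (x ∷ xs) = cong (_+_ (f (g x))) (lsum-map f g xs)

lsum-concatMap : ∀ {A B : Set} (f : B → ℕ) (g : A → List B) xs → lsum f (concatMap g xs) ≡ lsum (λ x → lsum f (g x)) xs
lsum-concatMap f g []       = refl
lsum-concatMap f g (x ∷ xs) = trans (lsum-++ f (g x) (concatMap g xs)) (cong (_+_ (lsum f (g x))) (lsum-concatMap f g xs))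

lsum-cong : ∀ {A : Set} {f g : A → ℕ} → (∀ x → f x ≡ g x) → ∀ xs → lsum f xs ≡ lsum g xs
lsum-cong h []       = refl
lsum-cong h (x ∷ xs) = cong₂ _+_ (h x) (lsum-cong h xs)

opaque
  unfolding sum

  lsum-tabulate : ∀ {n} {A : Set} (f : A → ℕ) (g : Fin n → A) → lsum f (tabulate g) ≡ sum (λ i → f (g i))
  lsum-tabulate {zero}  f g = refl
  lsum-tabulate {suc n} f g = cong (_+_ (f (g zero))) (lsum-tabulate f (λ i → g (suc i)))

length-pairs : ∀ {n} (q : Fin n × Fin n → Bool) → length (filter (λ p → T? (q p)) (pairs n)) ≡ sum₂ (λ a b → ind (q (a , b)))
length-pairs {n} q = begin
  length (filter (λ p → T? (q p)) (pairs n))                                          ≡⟨ length-filter-T q (pairs n) ⟩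
  lsum (λ p → ind (q p)) (pairs n)                                                    ≡⟨ lsum-concatMap (λ p → ind (q p)) (λ a → map (a ,_) (allFin n)) (allFin n) ⟩
  lsum (λ a → lsum (λ p → ind (q p)) (map (a ,_) (allFin n))) (allFin n)              ≡⟨ lsum-cong (λ a → trans (lsum-map (λ p → ind (q p)) (a ,_) (allFin n)) (lsum-tabulate (λ b → ind (q (a , b))) (λ i → i))) (allFin n) ⟩
  lsum (λ a → sum (λ b → ind (q (a , b)))) (allFin n)                                 ≡⟨ lsum-tabulate (λ a → sum (λ b → ind (q (a , b)))) (λ i → i) ⟩
  sum₂ (λ a b → ind (q (a , b)))                                                      ∎
  where open ≡-Reasoning

deg₂-deg : ∀ {n} (H : Hypergraph3 n) v → deg₂ H v ≡ deg H v + deg H v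
deg₂-deg {n} H v = begin
  sum₂ (λ a b → ind (E H v a b))                   ≡⟨ sum₂-cong split ⟩
  sum₂ (λ a b → up a b + up b a)                   ≡⟨ sum₂-+ up (λ a b → up b a) ⟩
  sum₂ up + sum₂ (λ a b → up b a)                  ≡⟨ cong₂ _+_ (sym (length-pairs _)) (trans (sym (sum₂-swap up)) (sym (length-pairs _))) ⟩
  deg H v + deg H v ∎
  where
  open ≡-Reasoning
  up : Fin n → Fin n → ℕ
  up a b = ind ((toℕ a <ᵇ toℕ b) ∧ E H v a b)
  <ᵇ-true : ∀ {x y} → x < y → (x <ᵇ y) ≡ true
  <ᵇ-true p = T⇒true (<⇒<ᵇ p)
    where
    T⇒true : ∀ {b} → T b → b ≡ true
    T⇒true {true} _ = refl
  <ᵇ-false : ∀ {x y} → ¬ (x < y) → (x <ᵇ y) ≡ false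
  <ᵇ-false {x} {y} ¬p with x <ᵇ y in q
  ... | false = refl
  ... | true  = ⊥-elim (¬p (<ᵇ⇒< x y (≡⇒T q)))
  split : ∀ a b → ind (E H v a b) ≡ up a b + up b a
  split a b with <-cmp (toℕ a) (toℕ b)
  ... | tri< p _ ¬q rewrite <ᵇ-true p | <ᵇ-false ¬q = sym (+-identityʳ _)
  ... | tri> ¬p _ q rewrite <ᵇ-true q | <ᵇ-false ¬p = cong ind (sym₂₃ H v a b)
  ... | tri≈ ¬p a≡b ¬q rewrite <ᵇ-false ¬p | <ᵇ-false ¬q = ind-false (bool-case (E H v a b) (λ e → ⊥-elim (proj₁ (proj₂ (distinct H v a b e)) (Fin.toℕ-injective a≡b))) (λ p → p))

-- The search runs over functions built by `cons`. Without extensionality a given function only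
-- agrees pointwise with one of these, whence the second hypothesis.
any-function? : ∀ N {n} {P : (Fin N → Fin n) → Set} → (∀ f → Dec (P f)) → (∀ {f g} → (∀ i → f i ≡ g i) → P f → P g) → Dec (∃[ f ] P f)
any-function? zero {n} P? resp = map′ (λ p → none , p) (λ (f , p) → resp {f} {none} (λ ()) p) (P? none)
  where
  none : Fin 0 → Fin n
  none ()
any-function? (suc N) {n} {P} P? resp = map′ (λ (a , f , p) → cons a f , p) (λ (f , p) → f zero , (λ i → f (suc i)) , resp (λ { zero → refl ; (suc i) → refl }) p)
    (Fin.any? λ a → any-function? N (λ f → P? (cons a f)) (λ {f} {g} h → resp (λ { zero → refl ; (suc i) → h i })))
  where
  cons : Fin n → (Fin N → Fin n) → Fin (suc N) → Fin n
  cons a f zero    = a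
  cons a f (suc i) = f i

-- Perfect matchings from arrangements

module Matchings {k : ℕ} (H : Hypergraph3 (3 * k)) where

  open Rearrange {k} {3 * k} H

  slot : Fin 3 → Fin k → Fin (3 * k)
  slot = combine

  edge-cong : ∀ {a a′ b b′ c c′} → a ≡ a′ → b ≡ b′ → c ≡ c′ → E H a b c ≡ true → E H a′ b′ c′ ≡ true
  edge-cong refl refl refl e = e

  -- An arrangement reduced to a bijection with decidable conditions, so that existence is settled
  -- by search among finitely many functions.
  Matched : (Fin (3 * k) → Fin (3 * k)) → Set
  Matched f = (∀ v → ∃[ x ] f x ≡ v) × (∀ x y → f x ≡ f y → x ≡ y) × (∀ (e : Fin k) → E H (f (slot 0F e)) (f (slot 1F e)) (f (slot 2F e)) ≡ true)

  matched? : ∀ f → Dec (Matched f)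
  matched? f = (Fin.all? λ v → Fin.any? λ x → f x Fin.≟ v) ×-dec ((Fin.all? λ x → Fin.all? λ y → (f x Fin.≟ f y) →-dec (x Fin.≟ y)) ×-dec
    (Fin.all? λ e → E H (f (slot 0F e)) (f (slot 1F e)) (f (slot 2F e)) Bool.≟ true))

  matched-resp : ∀ {f g} → (∀ i → f i ≡ g i) → Matched f → Matched g
  matched-resp h (s , i , r) = (λ v → proj₁ (s v) , trans (sym (h _)) (proj₂ (s v))) , (λ x y p → i x y (trans (h x) (trans p (sym (h y))))) ,
    λ e → edge-cong (h _) (h _) (h _) (r e)

  matched-of : (∃[ m ] ∀ e → Real m e) → ∃[ f ] Matched f
  matched-of (m , real) = f , (λ v → slot (proj₂ (pos m v)) (proj₁ (pos m v)) , trans (fslot _ _) (at-pos m v)) , inj , λ e → edge-cong (sym (fslot 0F e)) (sym (fslot 1F e)) (sym (fslot 2F e)) (real e)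
    where
    f : Fin (3 * k) → Fin (3 * k)
    f x = at m (proj₂ (remQuot {3} k x)) (proj₁ (remQuot {3} k x))
    fslot : ∀ i e → f (slot i e) ≡ at m e i
    fslot i e = cong (λ p → at m (proj₂ p) (proj₁ p)) (Fin.remQuot-combine {3} {k} i e)
    inj : ∀ x y → f x ≡ f y → x ≡ y
    inj x y p = trans (sym (Fin.combine-remQuot {3} k x)) (trans (cong (λ q → slot (proj₂ q) (proj₁ q)) (at-injective m p)) (Fin.combine-remQuot {3} k y))

  module _ {f : Fin (3 * k) → Fin (3 * k)} (matched : Matched f) where

    private
      surj = proj₁ matched
      inj  = proj₁ (proj₂ matched)
      real = proj₂ (proj₂ matched)

      row : Fin k → Fin (3 * k) × Fin (3 * k) × Fin (3 * k)
      row e = f (slot 0F e) , f (slot 1F e) , f (slot 2F e)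

      cells : List (Fin k) → List (Fin (3 * k))
      cells es = flatten (map row es)

      cell-inj : ∀ {i j : Fin 3} {e e′ : Fin k} → f (slot i e) ≡ f (slot j e′) → i ≡ j × e ≡ e′
      cell-inj {i} {j} {e} {e′} p = Fin.combine-injective i e j e′ (inj _ _ p)

      in-cells : ∀ {es} i e → e ∈ es → f (slot i e) ∈ cells es
      in-cells 0F e (here refl) = here refl
      in-cells 1F e (here refl) = there (here refl)
      in-cells 2F e (here refl) = there (there (here refl))
      in-cells i  e (there p)   = there (there (there (in-cells i e p)))

      not-in : ∀ {es e} i → All (e ≢_) es → All (f (slot i e) ≢_) (cells es)
      not-in i []        = []
      not-in i (ne ∷ ns) = (ne ∘ proj₂ ∘ cell-inj {i} {0F}) ∷ (ne ∘ proj₂ ∘ cell-inj {i} {1F}) ∷ (ne ∘ proj₂ ∘ cell-inj {i} {2F}) ∷ not-in i ns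

      column : ∀ {i j : Fin 3} {e : Fin k} → i ≢ j → f (slot i e) ≢ f (slot j e)
      column {i} {j} {e} i≢j p = i≢j (proj₁ (cell-inj {i} {j} {e} {e} p))

      unique : ∀ {es} → Unique es → Unique (cells es)
      unique []       = []
      unique {e ∷ es} (ne ∷ u) = (column {0F} {1F} (λ ()) ∷ column {0F} {2F} (λ ()) ∷ not-in 0F ne) ∷ (column {1F} {2F} (λ ()) ∷ not-in 1F ne) ∷ not-in 2F ne ∷ unique u

      covered : ∀ v → v ∈ cells (allFin k)
      covered v with surj v
      ... | x , refl = subst (λ y → f y ∈ cells (allFin k)) (Fin.combine-remQuot {3} k x) (in-cells (proj₁ (remQuot {3} k x)) (proj₂ (remQuot {3} k x)) (∈-allFin _))

    perfect-matching : PerfectMatching H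
    perfect-matching = map row (allFin k) , All.map⁺ (All.tabulate⁺ real) , unique (allFin⁺ k) , covered

  stable : ¬ ¬ (∃[ m ] ∀ e → Real m e) → PerfectMatching H
  stable ¬¬pm = perfect-matching (proj₂ (decidable-stable (any-function? (3 * k) matched? matched-resp) (λ ¬f → ¬¬pm (¬f ∘ matched-of))))

-- `SubH*` prescribes the size of the set, so W has to be filled up with arbitrary vertices.
cover : ∀ {n} (w : Fin n → Bool) s → sum (λ v → ind (w v)) ≤ s → s ≤ n → ∃[ T ] ∣ T ∣ ≡ s × (∀ v → w v ≡ true → v ∈ₛ T)
cover w s = opened w s
  where
  opaque
    unfolding sum
    opened : ∀ {n} (w : Fin n → Bool) s → sum (λ v → ind (w v)) ≤ s → s ≤ n → ∃[ T ] ∣ T ∣ ≡ s × (∀ v → w v ≡ true → v ∈ₛ T)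
    opened {zero} w zero h l = [] , refl , λ ()
    opened {suc n} w s h l = bool-case (w zero) take skip
      where
      add : ∀ {s} → sum (λ v → ind (w (suc v))) ≤ s → s ≤ n → ∃[ T ] ∣ T ∣ ≡ suc s × (∀ v → w v ≡ true → v ∈ₛ T)
      add {s} h l with opened (λ v → w (suc v)) s h l
      ... | T , c , i = Subset.inside ∷ T , cong suc c , λ { zero _ → here ; (suc v) p → there (i v p) }
      take : w zero ≡ true → ∃[ T ] ∣ T ∣ ≡ s × (∀ v → w v ≡ true → v ∈ₛ T)
      take p = go s (subst (λ b → ind b + sum (λ v → ind (w (suc v))) ≤ s) p h) l
        where
        go : ∀ s → suc (sum (λ v → ind (w (suc v)))) ≤ s → s ≤ suc n → ∃[ T ] ∣ T ∣ ≡ s × (∀ v → w v ≡ true → v ∈ₛ T)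
        go (suc s) (s≤s h′) (s≤s l′) = add h′ l′
      skip : w zero ≡ false → ∃[ T ] ∣ T ∣ ≡ s × (∀ v → w v ≡ true → v ∈ₛ T)
      skip p with s ≤? n
      ... | yes l′ with opened (λ v → w (suc v)) s (≤-trans (≤-reflexive (cong (λ b → ind b + sum (λ v → ind (w (suc v)))) (sym p))) h) l′
      ...   | T , c , i = Subset.outside ∷ T , c , λ { zero q → ⊥-elim (true≢false q p) ; (suc v) q → there (i v q) }
      skip p | no ¬l′ = subst (λ s → ∃[ T ] ∣ T ∣ ≡ s × (∀ v → w v ≡ true → v ∈ₛ T)) (≤-antisym (≰⇒> ¬l′) l)
        (add (≤-trans (sum-mono (λ v → ind≤1 (w (suc v)))) (≤-reflexive (trans (sum-const n 1) (*-identityʳ n)))) ≤-refl)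

-- Multiplication by the denominators 3 and `suc e`, with `3 * N` added on both sides to avoid
-- subtraction.
rational-bound : ∀ e N d → ((+ 2 ℚ./ 3) ℚ.- (+ 1 ℚ./ suc e)) ℚ.* (+ N ℚ./ 1) ℚ.< (+ d ℚ./ 1) → 2 * suc e * N < d * (3 * suc e) + 3 * N
rational-bound e N d h = ℤ.drop‿+<+ (subst₂ ℤ._<_ left right (ℤ.+-monoˡ-< (+ 3 ℤ.* + N) (ℚᵘ.drop-*<* unnormalised)))
  where
  p q X Y : ℚᵘ.ℚᵘ
  p = mkℚᵘ (+ 2) 2
  q = mkℚᵘ (+ 1) e
  X = mkℚᵘ (+ N) 0
  Y = mkℚᵘ (+ d) 0
  of : ∀ i n → toℚᵘ (i ℚ./ suc n) ℚᵘ.≃ mkℚᵘ i n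
  of i n = ℚ.toℚᵘ-fromℚᵘ (mkℚᵘ i n)
  lhs : toℚᵘ (((+ 2 ℚ./ 3) ℚ.- (+ 1 ℚ./ suc e)) ℚ.* (+ N ℚ./ 1)) ℚᵘ.≃ (p ℚᵘ.- q) ℚᵘ.* X
  lhs = ℚᵘ.≃-trans (ℚ.toℚᵘ-homo-* ((+ 2 ℚ./ 3) ℚ.- (+ 1 ℚ./ suc e)) (+ N ℚ./ 1))
    (ℚᵘ.*-cong (ℚᵘ.≃-trans (ℚ.toℚᵘ-homo-+ (+ 2 ℚ./ 3) (ℚ.- (+ 1 ℚ./ suc e)))
      (ℚᵘ.+-cong (of (+ 2) 2) (ℚᵘ.≃-trans (ℚ.toℚᵘ-homo‿- (+ 1 ℚ./ suc e)) (ℚᵘ.-‿cong (of (+ 1) e))))) (of (+ N) 0))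
  unnormalised : (p ℚᵘ.- q) ℚᵘ.* X ℚᵘ.< Y
  unnormalised = ℚᵘ.<-respˡ-≃ lhs (ℚᵘ.<-respʳ-≃ (of (+ d) 0) (ℚ.toℚᵘ-mono-< h))
  left : ℚᵘ.↥ ((p ℚᵘ.- q) ℚᵘ.* X) ℤ.* ℚᵘ.↧ Y ℤ.+ + 3 ℤ.* + N ≡ + (2 * suc e * N)
  left = trans (ring (+ suc e) (+ N)) (trans (cong (ℤ._* + N) (sym (ℤ.pos-* 2 (suc e)))) (sym (ℤ.pos-* (2 * suc e) N)))
    where
    ring : ∀ s N → ((+ 2 ℤ.* s ℤ.+ (-[1+ 0 ]) ℤ.* + 3) ℤ.* N) ℤ.* + 1 ℤ.+ + 3 ℤ.* N ≡ + 2 ℤ.* s ℤ.* N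
    ring = ℤ-Solver.solve-∀
  right : ℚᵘ.↥ Y ℤ.* ℚᵘ.↧ ((p ℚᵘ.- q) ℚᵘ.* X) ℤ.+ + 3 ℤ.* + N ≡ + (d * (3 * suc e) + 3 * N)
  right = trans (cong₂ ℤ._+_ (trans (sym (ℤ.pos-* d (3 * suc e * 1))) (cong (λ y → + (d * y)) (*-identityʳ (3 * suc e)))) (sym (ℤ.pos-* 3 N))) (sym (ℤ.pos-+ (d * (3 * suc e)) (3 * N)))

half-degree : ∀ K d r → K * 12 ≤ d * 2 + r → (K * 6) * 2 ≤ (d + r) * 2
half-degree K d r h0 = farkas ((K * 6) * 2) ((d + r) * 2) (r) h0 (identity K d r)
  where
  identity : ∀ K d r → ((K * 6) * 2) + ((d * 2 + r)) + (r) ≡ ((d + r) * 2) + ((K * 12))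
  identity = solve-∀

both-low-⊥ : ∀ K a b r → K * 12 ≤ a + b + r → a * 2 + r < K * 12 → b * 2 + r < K * 12 → ⊥
both-low-⊥ K a b r h0 h1 h2 = contra-≤ (1) (+-mono-≤ (*-monoˡ-≤ 2 h0) (+-mono-≤ h1 h2)) (identity K a b r)
  where
  identity : ∀ K a b r → (K * 12) * 2 + ((suc (a * 2 + r)) + ((suc (b * 2 + r)))) ≡ ((a + b + r) * 2 + ((K * 12) + ((K * 12)))) + suc (1)
  identity = solve-∀

-- For ε = 1/(18c) and n = 3k the loss εn² is k²/(2c). In terms of `deg₂` it doubles to k²/c, which
-- is below `r`.
degree-scaled : ∀ k c d r → 2 * (18 * c) * (3 * k * (3 * k)) < d * (3 * (18 * c)) + 3 * (3 * k * (3 * k)) → k * k < r * c → (k * k * 12) * (c * 27) ≤ (d * 2 + r) * (c * 27)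
degree-scaled k c d r h0 h1 = farkas ((k * k * 12) * (c * 27)) ((d * 2 + r) * (c * 27)) (28) (+-mono-≤ h0 (*-monoˡ-≤ 27 h1)) (identity k c d r)
  where
  identity : ∀ k c d r → ((k * k * 12) * (c * 27)) + ((d * (3 * (18 * c)) + 3 * (3 * k * (3 * k))) + ((r * c) * 27)) + (28) ≡ ((d * 2 + r) * (c * 27)) + ((suc (2 * (18 * c) * (3 * k * (3 * k)))) + ((suc (k * k)) * 27))
  identity = solve-∀

r-upper : ∀ q b K → q * (b * 10) ≤ K → b ≤ q * b → (q + 1) * b ≤ K
r-upper q b K h0 h1 = farkas ((q + 1) * b) (K) (b * q * 8) (+-mono-≤ h0 h1) (identity q b K)
  where
  identity : ∀ q b K → ((q + 1) * b) + ((K) + ((q * b))) + (b * q * 8) ≡ (K) + ((q * (b * 10)) + ((b)))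
  identity = solve-∀

ε-positive : ∀ e → 0ℚ ℚ.< + 1 ℚ./ suc e
ε-positive e = ℚ.toℚᵘ-cancel-< (ℚᵘ.<-respʳ-≃ (ℚᵘ.≃-sym (ℚ.toℚᵘ-fromℚᵘ (mkℚᵘ (+ 1) e))) (*<* (ℤ.+<+ (s≤s z≤n))))

-- r is about K / c and z is r * y; the conditions below make r ≪ z ≪ K and r K ≪ z².
module Parameters (b y : ℕ) (b-large : 1001 ≤ b) (y-pos : 1 ≤ y) (y-small : y * 10000 ≤ b) (y-large : b * 250 ≤ y * y)
  (k : ℕ) (k-large : b * 1000 ≤ k) where

  c K : ℕ
  -- The factor 10 absorbs the rounding in `r = q + 1`, so that `r * b ≤ K`.
  c = b * 10
  K = k * k

  instance
    b≢0 : NonZero b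
    b≢0 = >-nonZero (≤-trans (s≤s z≤n) b-large)

    c≢0 : NonZero c
    c≢0 = m*n≢0 b 10

    k≢0 : NonZero k
    k≢0 = >-nonZero (≤-trans (≤-trans (≤-trans (s≤s z≤n) b-large) (m≤m*n b 1000)) k-large)

  q r z : ℕ
  q = K / c
  r = q + 1
  z = r * y

  K<rc : K < r * c
  K<rc = ≤-trans (s≤s (≤-trans (≤-reflexive (m≡m%n+[m/n]*n K c)) (+-monoˡ-≤ (q * c) (<⇒≤pred (m%n<n K c)))))
    (≤-reflexive (trans (cong (_+ q * c) (suc-pred c)) (l q c)))
    where
    l : ∀ q c → c + q * c ≡ (q + 1) * c
    l = solve-∀

  c≤K : c ≤ K
  c≤K = ≤-trans (≤-trans (*-monoʳ-≤ b (m≤m+n 10 990)) k-large) (m≤m*n k k)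

  q≥1 : 1 ≤ q
  q≥1 = m≥n⇒m/n>0 c≤K

  r≥1 : 1 ≤ r
  r≥1 = m≤n+m 1 q

  r≤K : r * b ≤ K
  r≤K = r-upper q b K (m/n*n≤m K c) (m≤n*m b q {{>-nonZero q≥1}})

  k≪r : k * 100 ≤ r
  k≪r = <⇒≤ (*-cancelʳ-< c (k * 100) r (≤-trans (s≤s (≤-trans (≤-reflexive (l k b)) (*-monoʳ-≤ k k-large))) K<rc))
    where
    l : ∀ k b → k * 100 * (b * 10) ≡ k * (b * 1000)
    l = solve-∀

  r≪kk : r * 1000 < K
  r≪kk = ≤-trans (*-monoʳ-< r {{>-nonZero r≥1}} b-large) r≤K

  r≤z : r ≤ z
  r≤z = m≤m*n r y {{>-nonZero y-pos}}

  z-small : z * 10000 ≤ K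
  z-small = ≤-trans (≤-reflexive (*-assoc r y 10000)) (≤-trans (*-monoʳ-≤ r y-small) r≤K)

  z-big : K * (r * 25) < z * z
  z-big = ≤-trans (*-monoˡ-< (r * 25) {{>-nonZero (≤-trans r≥1 (m≤m*n r 25))}} K<rc)
    (≤-trans (≤-reflexive (l₁ r b)) (≤-trans (*-monoʳ-≤ (r * r) y-large) (≤-reflexive (l₂ r y))))
    where
    l₁ : ∀ r b → r * (b * 10) * (r * 25) ≡ r * r * (b * 250)
    l₁ = solve-∀
    l₂ : ∀ r y → r * r * (y * y) ≡ (r * y) * (r * y)
    l₂ = solve-∀

module Main (b y : ℕ) (b-large : 1001 ≤ b) (y-pos : 1 ≤ y) (y-small : y * 10000 ≤ b) (y-large : b * 250 ≤ y * y)
  (e : ℕ) (e-value : suc e ≡ 18 * (b * 10)) (k : ℕ) (k-large : b * 1000 ≤ k) (H : Hypergraph3 (3 * k)) (noIso : NoIsolated H)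
  (degrees : ∀ u v → Adjacent H u v → ((+ 2 ℚ./ 3) ℚ.- (+ 1 ℚ./ suc e)) ℚ.* (+ (3 * k * (3 * k)) ℚ./ 1) ℚ.< (+ (deg H u + deg H v) ℚ./ 1)) where

  open Parameters b y b-large y-pos y-small y-large k k-large

  degAdj : ∀ u v x → E H u v x ≡ true → K * 12 ≤ deg₂ H u + deg₂ H v + r
  degAdj u v x edge = *-cancelʳ-≤ (K * 12) (deg₂ H u + deg₂ H v + r) (c * 27) {{m*n≢0 c 27}} (≤-trans
      (degree-scaled k c d r (subst (λ s → 2 * s * (3 * k * (3 * k)) < d * (3 * s) + 3 * (3 * k * (3 * k))) e-value
        (rational-bound e (3 * k * (3 * k)) d (degrees u v (proj₁ (distinct H u v x edge) , x , edge)))) K<rc)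
      (≤-reflexive (cong (λ d → (d + r) * (c * 27)) (trans (double (deg H u) (deg H v)) (sym (cong₂ _+_ (deg₂-deg H u) (deg₂-deg H v)))))))
    where
    d = deg H u + deg H v
    double : ∀ a b → (a + b) * 2 ≡ (a + a) + (b + b)
    double = solve-∀

  -- The threshold is half of 12K - r, the guaranteed degree sum of an adjacent pair, so one of two
  -- adjacent vertices reaches it.
  high? : ∀ v → Dec (K * 12 ≤ deg₂ H v * 2 + r)
  high? v = K * 12 ≤? deg₂ H v * 2 + r

  w : Fin (3 * k) → Bool
  w v = does (high? v)

  degW : ∀ v → w v ≡ true → K * 6 ≤ deg₂ H v + r
  degW v p = go (high? v) p
    where
    go : (d : Dec (K * 12 ≤ deg₂ H v * 2 + r)) → does d ≡ true → K * 6 ≤ deg₂ H v + r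
    go (yes h) _ = *-cancelʳ-≤ (K * 6) (deg₂ H v + r) 2 (half-degree K (deg₂ H v) r h)

  low : ∀ v → w v ≡ false → deg₂ H v * 2 + r < K * 12
  low v p = go (high? v) p
    where
    go : (d : Dec (K * 12 ≤ deg₂ H v * 2 + r)) → does d ≡ false → deg₂ H v * 2 + r < K * 12
    go (no ¬h) _ = ≰⇒> ¬h

  legal : ∀ a b x → E H a b x ≡ true → w a ≡ false → w b ≡ true
  legal a b x e wa = bool-case (w b) (λ p → p) (λ p → ⊥-elim (both-low-⊥ K (deg₂ H a) (deg₂ H b) r (degAdj a b x e) (low a wa) (low b p)))

  nonisolated : ∀ u → ∃[ v ] ∃[ x ] E H u v x ≡ true
  nonisolated u = go (sum-pos (λ a → sum (λ b → ind (E H u a b))) (n≢0⇒n>0 (λ p → noIso u (m+n≡0⇒m≡0 (deg H u) (trans (sym (deg₂-deg H u)) p)))))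
    where
    go : ∃[ v ] 0 < sum (λ b → ind (E H u v b)) → ∃[ v ] ∃[ x ] E H u v x ≡ true
    go (v , p) = v , proj₁ found , 1≤ind (proj₂ found)
      where
      found : ∃[ x ] 0 < ind (E H u v x)
      found = sum-pos (λ b → ind (E H u v b)) p

  deg≤ : ∀ v → deg₂ H v ≤ K * 9
  deg≤ v = ≤-trans (sum₂-mono (λ a b → ind≤1 (E H v a b))) (≤-reflexive (trans (sum₂-const (3 * k) 1) (l k)))
    where
    l : ∀ k → 3 * k * (3 * k) * 1 ≡ k * k * 9
    l = solve-∀

  -- By `legal` an edge has at most one vertex outside W, so any set of 2k - 1 vertices containing W
  -- will do.
  inside : ¬ (k * 2 ≤ sum (λ v → ind (w v))) → SubH* H k
  inside ¬many = S , trans (cong (_+ 1) size-S) (trans (+-comm s 1) (trans suc-s (*-comm k 2))) , two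
    where
    s : ℕ
    s = pred (k * 2)
    few : sum (λ v → ind (w v)) < k * 2
    few = ≰⇒> ¬many
    suc-s : suc s ≡ k * 2
    suc-s = suc-pred (k * 2) {{>-nonZero (≤-trans (s≤s z≤n) few)}}
    s≤3k : s ≤ 3 * k
    s≤3k = ≤-trans pred[n]≤n (≤-trans (*-monoʳ-≤ k (n≤1+n 2)) (≤-reflexive (*-comm k 3)))
    covering = cover w s (<⇒≤pred few) s≤3k
    S = proj₁ covering
    size-S : ∣ S ∣ ≡ s
    size-S = proj₁ (proj₂ covering)
    in-S = proj₂ (proj₂ covering)
    two : ∀ a b x → E H a b x ≡ true → AtLeastTwoIn S a b x
    two a b x e = bool-case (w a)
      (λ wa → bool-case (w b) (λ wb → inj₁ (in-S a wa , in-S b wb))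
        (λ wb → inj₂ (inj₂ (in-S a wa , in-S x (legal b x a (trans (sym₂₃ H b x a) (trans (sym₁₂ H b a x) e)) wb)))))
      (λ wa → inj₂ (inj₁ (in-S b (legal a b x e wa) , in-S x (legal a x b (trans (sym₂₃ H a x b) e) wa))))

  result : SubH* H k ⊎ PerfectMatching H
  result = go (k * 2 ≤? sum (λ v → ind (w v)))
    where
    go : Dec (k * 2 ≤ sum (λ v → ind (w v))) → SubH* H k ⊎ PerfectMatching H
    go (no ¬many) = inj₁ (inside ¬many)
    go (yes many) = inj₂ (Matchings.stable {k} H (Existence.perfect {k} {3 * k} H w r legal degW degAdj k≪r r≪kk z r≤z z-big z-small nonisolated deg≤ many (identity-arr k)))

theorem1p2 : ∃[ ε ] ∃[ n₀ ] (0ℚ ℚ.< ε) × (∀ (k : ℕ) → n₀ ≤ 3 * k → (H : Hypergraph3 (3 * k)) → NoIsolated H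
    → (∀ u v → Adjacent H u v
    → ((+ 2 ℚ./ 3) ℚ.- ε) ℚ.* ((+ (3 * k * (3 * k))) ℚ./ 1) ℚ.< (+ (deg H u + deg H v)) ℚ./ 1)
    → SubH* H k ⊎ PerfectMatching H)
-- Here b = 10¹¹ and c = 10b, so that ε = 1/(18c) and n₀ = 3 · 1000b. The choice y = 10⁷ satisfies
-- 10⁴y ≤ b and 250b ≤ y².
theorem1p2 = + 1 ℚ./ 18000000000000 , 300000000000000 , ε-positive 17999999999999 ,
  λ k large H noIso degrees → Main.result 100000000000 10000000 (≤ᵇ⇒≤ _ _ tt) (≤ᵇ⇒≤ _ _ tt) (≤ᵇ⇒≤ _ _ tt) (≤ᵇ⇒≤ _ _ tt)
    17999999999999 refl k (*-cancelˡ-≤ 3 large) H noIso degrees
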